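{- Let $x=(x_1,\dots,x_n)$ and $m$ a nonnegative integer. Then \[ \sum_{\substack{\lambda\\ \lambda_1\le m}}h^{(m)}_\lambda(t_2;t)P_\lambda(x;t)=(x_1\cdots x_n)^{m/2}P^{(B_n)}_{(m/2)^n}(x;t,t_2). \]
   Context: $(a;t)_k=\prod_{j=0}^{k-1}(1-at^j)$. $P_\lambda(x;t)$ is the Hall–Littlewood polynomial $\frac{1}{v_\lambda(t)}\sum_{w\in S_n}w\big(x^\lambda\prod_{i<j}\frac{x_i-tx_j}{x_i-x_j}\big)$ with $v_\lambda(t)=\prod_{i\ge0}(t;t)_{m_i(\lambda)}/(1-t)^{m_i(\lambda)}$, $m_i(\lambda)$ the multiplicity of $i$, $m_0(\lambda)=n-\ell(\lambda)$. Rogers–Szegő: $H_k(z;q)=\sum_{j=0}^kz^j\frac{(q;q)_k}{(q;q)_j(q;q)_{k-j}}$; $h^{(m)}_\lambda(t_2;t)=\prod_{i=1}^{m-1}H_{m_i(\lambda)}(-t_2;t)$. $(m/2)^n=(m/2,\dots,m/2)$ is a partition ($m$ even) or a half-partition (all parts in $\frac12+\mathbb{Z}$). For $\lambda$ a partition of length $\le n$ or a half-partition of length $n$, \[P^{(B_n)}_\lambda(x;t,t_2)=\frac{1}{(-t_2;t)_{n-\ell(\lambda)}v_\lambda(t)}\sum_{w\in W}w\Big(x^{ -\lambda}\prod_{i=1}^n\frac{1-t_2x_i}{1-x_i}\prod_{i<j}\frac{(tx_i-x_j)(1-tx_ix_j)}{(x_i-x_j)(1-x_ix_j)}\Big),\]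 where $W$ is the hyperoctahedral group (permutations and inversions $x_i\mapsto x_i^{ -1}$), a half-partition has length $n$, and for half-partitions $v_\lambda(t)=\prod_{i}(t;t)_{m_i(\lambda)}/(1-t)^{m_i(\lambda)}$ with the product over positive half-odd-integers $i$. -}

module Defs where

open import Level using (Level)
open import Data.Nat as ℕ using (ℕ; zero; suc; _<ᵇ_; _≡ᵇ_)
open import Data.Bool using (Bool; true; false; if_then_else_)
open import Data.Fin using (Fin; toℕ; punchIn)
open import Data.Fin as Fin using ()
open import Data.List using (List; []; _∷_; foldr; map; concatMap; upTo; allFin)
open import Data.Vec using (Vec; []; _∷_; lookup; replicate)
open import Data.Product using (_×_; _,_)
open import Algebra.Bundles using (CommutativeRing)
open import Relation.Nullary using (¬_)

perms : (n : ℕ) → List (Fin n → Fin n)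
perms zero    = (λ ()) ∷ []
perms (suc n) =
  concatMap (λ k → map (λ σ → λ { Fin.zero → k ; (Fin.suc i) → punchIn k (σ i) })
                       (perms n))
            (allFin (suc n))

-- All sign vectors ε : Fin n → Bool (true = "invert this variable").
signs : (n : ℕ) → List (Fin n → Bool)
signs zero    = (λ ()) ∷ []
signs (suc n) =
  concatMap (λ b → map (λ ε → λ { Fin.zero → b ; (Fin.suc i) → ε i }) (signs n))
            (true ∷ false ∷ [])

-- All partitions λ of length ≤ n with λ₁ ≤ b, written as weakly
-- decreasing vectors (λ₁ ≥ … ≥ λₙ ≥ 0) padded with zeros.
partitionsLE : (n b : ℕ) → List (Vec ℕ n)
partitionsLE zero    b = [] ∷ []
partitionsLE (suc n) b =
  concatMap (λ a → map (a ∷_) (partitionsLE n a)) (upTo (suc b))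

-- multiplicity m_i(λ) of the value i among the n entries (so m_0 = n - ℓ(λ))
mult : {n : ℕ} → ℕ → Vec ℕ n → ℕ
mult i []       = 0
mult i (a ∷ as) = (if a ≡ᵇ i then 1 else 0) ℕ.+ mult i as

len : {n : ℕ} → Vec ℕ n → ℕ
len []             = 0
len (zero  ∷ as)   = len as
len (suc _ ∷ as)   = suc (len as)

-- Everything below lives in a commutative ring R equipped with an
-- inverse operation _⁻¹ (a field, given the law FieldInv below).

module Alg {c ℓ : Level} (R : CommutativeRing c ℓ) (_⁻¹ : CommutativeRing.Carrier R → CommutativeRing.Carrier R) where
  open CommutativeRing R

  FieldInv : Set _
  FieldInv = ∀ a → ¬ (a ≈ 0#) → a * (a ⁻¹) ≈ 1#

  _/_ : Carrier → Carrier → Carrier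
  a / b = a * (b ⁻¹)

  _^_ : Carrier → ℕ → Carrier
  a ^ zero  = 1#
  a ^ suc k = a * (a ^ k)

  sumL : List Carrier → Carrier
  sumL = foldr _+_ 0#

  prodL : List Carrier → Carrier
  prodL = foldr _*_ 1#

  prodRange : (ℕ → Carrier) → ℕ → Carrier
  prodRange f zero    = 1#
  prodRange f (suc k) = prodRange f k * f (suc k)

  prodFin : {n : ℕ} → (Fin n → Carrier) → Carrier
  prodFin {n} f = prodL (map f (allFin n))

  prodPairs : {n : ℕ} → (Fin n → Fin n → Carrier) → Carrier
  prodPairs f = prodFin (λ i → prodFin (λ j → if toℕ i <ᵇ toℕ j then f i j else 1#))

  poch : Carrier → Carrier → ℕ → Carrier
  poch a q k = prodRange (λ j → 1# - a * (q ^ (j ℕ.∸ 1))) k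

  rogersSzego : ℕ → Carrier → Carrier → Carrier
  rogersSzego k z q =
    sumL (map (λ j → (z ^ j) * (poch q q k / (poch q q j * poch q q (k ℕ.∸ j)))) (upTo (suc k)))

  hm : (m : ℕ) → {n : ℕ} → Vec ℕ n → Carrier → Carrier → Carrier
  hm m λ' t₂ t = prodRange (λ i → rogersSzego (mult i λ') (- t₂) t) (m ℕ.∸ 1)

  -- v_λ(t) = ∏_{i ≥ 0} (t;t)_{m_i} / (1-t)^{m_i}; the product is taken over
  -- i = 0..b where b bounds all entries (other factors are 1).
  vfac : {n : ℕ} → ℕ → Vec ℕ n → Carrier → Carrier
  vfac b λ' t = prodRange (λ i → f (i ℕ.∸ 1)) (suc b)
    where f : ℕ → Carrier
          f i = poch t t (mult i λ') / ((1# - t) ^ mult i λ')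

  mono : {n : ℕ} → (Fin n → Carrier) → Vec ℕ n → Carrier
  mono x λ' = prodFin (λ i → x i ^ lookup λ' i)

  -- Hall–Littlewood polynomial P_λ(x;t) in n variables
  -- (b is any bound on the parts of λ, used only for v_λ)
  HL : {n : ℕ} → ℕ → Vec ℕ n → Carrier → (Fin n → Carrier) → Carrier
  HL {n} b λ' t x = (vfac b λ' t) ⁻¹ * sumL (map (λ σ → F (λ i → x (σ i))) (perms n))
    where F : (Fin n → Carrier) → Carrier
          F y = mono y λ' * prodPairs (λ i j → (y i - t * y j) / (y i - y j))

  -- Action of the hyperoctahedral element (σ, ε) on the variables:
  -- y_i = s_{σ i} or its inverse according to ε i.
  act : {n : ℕ} → (Fin n → Fin n) → (Fin n → Bool) → (Fin n → Carrier) → Fin n → Carrier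
  act σ ε s i = if ε i then (s (σ i)) ⁻¹ else s (σ i)

  -- Type-B Koornwinder–Macdonald-type polynomial P^{(B_n)}_λ(x;t,t₂).
  -- Variables are given through square roots s_i (x_i = s_i²) so that
  -- half-integer exponents make sense. The shape is given DOUBLED:
  -- μ = 2λ ∈ ℕⁿ (λ a partition iff all μ_i even; λ a half-partition iff
  -- all μ_i odd). x^{-λ} = ∏ s_i^{-μ_i}. Multiplicities of λ are those of μ;
  -- b bounds the entries of μ.
  PB : {n : ℕ} → ℕ → Vec ℕ n → Carrier → Carrier → (Fin n → Carrier) → Carrier
  PB {n} b μ t t₂ s =
    ((poch (- t₂) t (n ℕ.∸ len μ) * vfac b μ t) ⁻¹)
      * sumL (concatMap (λ σ → map (λ ε → F (act σ ε s)) (signs n)) (perms n))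
    where F : (Fin n → Carrier) → Carrier
          F r = let y = λ i → r i * r i in
                mono (λ i → r i ⁻¹) μ
                * prodFin (λ i → (1# - t₂ * y i) / (1# - y i))
                * prodPairs (λ i j → ((t * y i - y j) * (1# - t * y i * y j))
                                     / ((y i - y j) * (1# - y i * y j)))

  LHS : (n m : ℕ) → Carrier → Carrier → (Fin n → Carrier) → Carrier
  LHS n m t t₂ x = sumL (map (λ λ' → hm m λ' t₂ t * HL m λ' t x) (partitionsLE n m))

  -- Right side: (x₁⋯xₙ)^{m/2} P^{(B_n)}_{(m/2)ⁿ}(x;t,t₂), with x_i = s_i²
  RHS : (n m : ℕ) → Carrier → Carrier → (Fin n → Carrier) → Carrier
  RHS n m t t₂ s = prodFin (λ i → s i ^ m) * PB m (replicate n m) t t₂ s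

{-# OPTIONS --safe #-}
module Submission where

-- On functions of finite lists of variables consider the (Hall algebra) product
--   (F ⊛ G)(X) = Σ_{X = S ⊔ T} F(S) G(T) ∏_{x ∈ S, y ∈ T} (x - t y)/(x - y),
-- and let (τF)(X) = F(X) ∏_{x ∈ X} x, 1(X) = 1 and e(X) = (-t₂)^|X|. Grouping equal parts of λ, the
-- left side of the identity is L_m = τᵐ1 ⊛ τᵐ⁻¹H ⊛ ⋯ ⊛ τH ⊛ 1 with H = H_|X|(-t₂; t) = e ⊛ 1.
-- Carrying out the sum over permutations, the right side is R_m = τᵐΦ̄ ⊛ Φ, where Φ̄(X) = Φ(X⁻¹) and
--   Φ(X) = ∏_i (1 - t₂ x_i)/(1 - x_i) ∏_{i<j} (1 - t x_i x_j)/(1 - x_i x_j)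
-- (up to the factor (-t₂; t)_n when m = 0). From H = e ⊛ 1 one reads off L_{m+1} = (τᵐ⁺¹1 ⊛ τᵐe) ⊛ L_m.
-- The same recursion for R_m amounts to τΦ̄ = (τ1 ⊛ e) ⊛ Φ̄, where (τ1 ⊛ e)(X) = ∏_i (x_i - t₂). Dividing
-- by this product leaves an identity free of t₂, which need only be checked after multiplication by an
-- invertible function on the right. It then becomes, like the cases m = 0 and m = 1, a sum over
-- sign changes x_i ↦ x_i^{±1}, and such sums are evaluated one variable at a time by partial fractions.

open import Defs
open import Level using (Level)
open import Algebra.Bundles using (CommutativeRing)
import Algebra.Solver.Ring
open import Algebra.Solver.Ring.AlmostCommutativeRing using (_-Raw-AlmostCommutative⟶_; fromCommutativeRing)
open import Data.Bool using (Bool; true; false; if_then_else_)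
open import Data.Fin as Fin using (Fin; toℕ; punchIn)
open import Data.Integer as ℤ using (ℤ; +_; -[1+_])
import Data.Integer.Properties as ℤ
open import Data.List using (List; []; _∷_; _++_; length; map; concatMap; replicate; applyUpTo; upTo; allFin; tabulate)
open import Data.List.Properties using (map-id; map-∘; map-++; ++-identityʳ; map-tabulate; map-upTo; upTo-∷ʳ; length-++; length-replicate; length-tabulate)
open import Data.List.Relation.Binary.Permutation.Propositional as Perm using (_↭_; ↭-refl; ↭-sym; ↭-trans; prep; swap)
open import Data.List.Relation.Binary.Permutation.Propositional.Properties using (shift; All-resp-↭; ↭-length)
open import Data.List.Relation.Binary.Pointwise using (Pointwise; []; _∷_)
open import Data.List.Relation.Unary.All as All using (All; []; _∷_)
import Data.List.Relation.Unary.All.Properties as All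
open import Data.List.Relation.Unary.AllPairs as AllPairs using (AllPairs; []; _∷_)
import Data.List.Relation.Unary.AllPairs.Properties as AllPairs
open import Data.Maybe using (Maybe; just; nothing)
open import Data.Nat as ℕ using (ℕ; zero; suc; z≤n; s≤s; _≤_; _<ᵇ_; _≡ᵇ_)
import Data.Nat.Properties as ℕ
open import Data.Product using (_×_; _,_; proj₁; proj₂)
open import Data.Vec as Vec using (Vec; []; _∷_; toList; lookup)
open import Data.Vec.Properties using (length-toList; lookup-replicate; toList-replicate)
open import Function using (_∘_)
open import Relation.Nullary using (¬_; yes; no; contradiction)
open import Relation.Binary.PropositionalEquality as ≡ using (_≡_; _≢_)

-- A recursion in m is possible because τ is an endomorphism of the product and m enters R_m only
-- through a power of τ on its left factor. For L_m the recursion holds from m = 1 on: neither the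
-- part 0 nor the part m carries a Rogers-Szegő factor, so applied to L_0 it would give τ1 ⊛ H
-- instead of L_1 = τ1 ⊛ 1. Hence the two base cases. The invertible function is ∏ 1/(1 - x_i) ∏ (1
-- - t x_i x_j)/(1 - x_i x_j). Its inverse is explicit, because the sum over signs with weights 1/(1
-- - x) and -1/(1 - x) vanishes for every nonempty list. In a sum over signs one variable u is
-- singled out and its kernel factors are expanded over poles at the other variables. The poles at x
-- and x⁻¹ meet in the sum over the sign of x, and cancel once a constant k has been subtracted from
-- their coefficients. The inverse is controlled only at nonzero arguments and is not assumed to
-- respect `≈`. Every congruence under a sum must therefore know that its arguments are
-- nondegenerate, which is why the sums hand permutations or sign-change witnesses to their
-- congruence lemmas.

module IntegerSolver {c ℓ} (R : CommutativeRing c ℓ) where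
  open CommutativeRing R
  open import Algebra.Properties.Ring ring using (-0#≈0#; -‿involutive; -‿+-comm; -‿distribˡ-*; -‿distribʳ-*)
  open import Algebra.Properties.Semiring.Mult.TCOptimised semiring using (1+×; ×-homo-+; ×1-homo-*) renaming (_×_ to _·_)
  open import Relation.Binary.Reasoning.Setoid setoid

  -- The solver normalises by deciding equality of coefficients. Equality in `R` need not be
  -- decidable, so the coefficients are integers, interpreted in `R`.
  fromℤ : ℤ → Carrier
  fromℤ (+ n)     = n · 1#
  fromℤ -[1+ n ]  = - (suc n · 1#)

  fromℤ-neg : ∀ i → fromℤ (ℤ.- i) ≈ - fromℤ i
  fromℤ-neg (+ zero)   = sym -0#≈0#
  fromℤ-neg (+ suc n)  = refl
  fromℤ-neg -[1+ n ]   = sym (-‿involutive _)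

  fromℤ-⊖ : ∀ m n → fromℤ (m ℤ.⊖ n) ≈ m · 1# + - (n · 1#)
  fromℤ-⊖ m zero = begin
    m · 1#          ≈⟨ +-identityʳ _ ⟨
    m · 1# + 0#     ≈⟨ +-congˡ -0#≈0# ⟨
    m · 1# + - 0#   ∎
  fromℤ-⊖ zero (suc n) = sym (+-identityˡ _)
  fromℤ-⊖ (suc m) (suc n) = begin
    fromℤ (suc m ℤ.⊖ suc n)                   ≡⟨ ≡.cong fromℤ (ℤ.[1+m]⊖[1+n]≡m⊖n m n) ⟩
    fromℤ (m ℤ.⊖ n)                           ≈⟨ fromℤ-⊖ m n ⟩
    a + - b                                   ≈⟨ +-identityˡ _ ⟨
    0# + (a + - b)                            ≈⟨ +-congʳ (-‿inverseʳ 1#) ⟨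
    (1# + - 1#) + (a + - b)                   ≈⟨ +-assoc _ _ _ ⟩
    1# + (- 1# + (a + - b))                   ≈⟨ +-congˡ (+-assoc _ _ _) ⟨
    1# + ((- 1# + a) + - b)                   ≈⟨ +-congˡ (+-congʳ (+-comm _ _)) ⟩
    1# + ((a + - 1#) + - b)                   ≈⟨ +-congˡ (+-assoc _ _ _) ⟩
    1# + (a + (- 1# + - b))                   ≈⟨ +-assoc _ _ _ ⟨
    (1# + a) + (- 1# + - b)                   ≈⟨ +-cong (sym (1+× m 1#)) (-‿+-comm 1# b) ⟩
    suc m · 1# + - (1# + b)                   ≈⟨ +-congˡ (-‿cong (1+× n 1#)) ⟨
    suc m · 1# + - (suc n · 1#)               ∎
    where a = m · 1#
          b = n · 1#

  fromℤ-+ : ∀ i j → fromℤ (i ℤ.+ j) ≈ fromℤ i + fromℤ j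
  fromℤ-+ (+ m)    (+ n)    = ×-homo-+ 1# m n
  fromℤ-+ (+ m)    -[1+ n ] = fromℤ-⊖ m (suc n)
  fromℤ-+ -[1+ m ] (+ n)    = trans (fromℤ-⊖ n (suc m)) (+-comm _ _)
  fromℤ-+ -[1+ m ] -[1+ n ] = begin
    - (suc (suc (m ℕ.+ n)) · 1#)         ≡⟨ ≡.cong (λ k → - (k · 1#)) (≡.sym (≡.cong suc (ℕ.+-suc m n))) ⟩
    - ((suc m ℕ.+ suc n) · 1#)           ≈⟨ -‿cong (×-homo-+ 1# (suc m) (suc n)) ⟩
    - (suc m · 1# + suc n · 1#)          ≈⟨ -‿+-comm _ _ ⟨
    - (suc m · 1#) + - (suc n · 1#)      ∎

  fromℤ-+* : ∀ m n → fromℤ (+ m ℤ.* + n) ≈ fromℤ (+ m) * fromℤ (+ n)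
  fromℤ-+* m n = trans (reflexive (≡.cong fromℤ (≡.sym (ℤ.pos-* m n)))) (×1-homo-* m n)

  fromℤ-* : ∀ i j → fromℤ (i ℤ.* j) ≈ fromℤ i * fromℤ j
  fromℤ-* (+ m)    (+ n)    = fromℤ-+* m n
  fromℤ-* (+ m)    -[1+ n ] = begin
    fromℤ (+ m ℤ.* -[1+ n ])             ≡⟨ ≡.cong fromℤ (≡.sym (ℤ.neg-distribʳ-* (+ m) (+ suc n))) ⟩
    fromℤ (ℤ.- (+ m ℤ.* + suc n))        ≈⟨ fromℤ-neg (+ m ℤ.* + suc n) ⟩
    - fromℤ (+ m ℤ.* + suc n)            ≈⟨ -‿cong (fromℤ-+* m (suc n)) ⟩
    - (m · 1# * suc n · 1#)              ≈⟨ -‿distribʳ-* _ _ ⟩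
    m · 1# * - (suc n · 1#)              ∎
  fromℤ-* -[1+ m ] j = begin
    fromℤ (-[1+ m ] ℤ.* j)               ≡⟨ ≡.cong fromℤ (≡.sym (ℤ.neg-distribˡ-* (+ suc m) j)) ⟩
    fromℤ (ℤ.- (+ suc m ℤ.* j))          ≈⟨ fromℤ-neg (+ suc m ℤ.* j) ⟩
    - fromℤ (+ suc m ℤ.* j)              ≈⟨ -‿cong (pos j) ⟩
    - (suc m · 1# * fromℤ j)             ≈⟨ -‿distribˡ-* _ _ ⟩
    - (suc m · 1#) * fromℤ j             ∎
    where
    pos : ∀ j → fromℤ (+ suc m ℤ.* j) ≈ suc m · 1# * fromℤ j
    pos (+ n)    = fromℤ-+* (suc m) n
    pos -[1+ n ] = begin
      fromℤ (+ suc m ℤ.* -[1+ n ])          ≡⟨ ≡.cong fromℤ (≡.sym (ℤ.neg-distribʳ-* (+ suc m) (+ suc n))) ⟩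
      fromℤ (ℤ.- (+ suc m ℤ.* + suc n))     ≈⟨ fromℤ-neg (+ suc m ℤ.* + suc n) ⟩
      - fromℤ (+ suc m ℤ.* + suc n)         ≈⟨ -‿cong (fromℤ-+* (suc m) (suc n)) ⟩
      - (suc m · 1# * suc n · 1#)           ≈⟨ -‿distribʳ-* _ _ ⟩
      suc m · 1# * - (suc n · 1#)           ∎

  morphism : ℤ.+-*-rawRing -Raw-AlmostCommutative⟶ fromCommutativeRing R
  morphism = record
    { ⟦_⟧    = fromℤ
    ; +-homo = fromℤ-+
    ; *-homo = fromℤ-*
    ; -‿homo = fromℤ-neg
    ; 0-homo = refl
    ; 1-homo = refl
    }

  coeff≟ : ∀ i j → Maybe (fromℤ i ≈ fromℤ j)
  coeff≟ i j with i ℤ.≟ j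
  ... | yes ≡.refl = just refl
  ... | no _       = nothing

  open Algebra.Solver.Ring ℤ.+-*-rawRing (fromCommutativeRing R) morphism coeff≟ public

-- Sums over the ways to pick an entry of a list, or to split the list in two.

module ListSums {c ℓ} (R : CommutativeRing c ℓ) where
  open CommutativeRing R
  open import Relation.Binary.Reasoning.Setoid setoid
  open import Algebra.Properties.CommutativeSemigroup (CommutativeRing.+-commutativeSemigroup R)
    using () renaming (interchange to +-interchange; x∙yz≈y∙xz to x+[y+z]≈y+[x+z])

  private variable
    a : Level
    A : Set a

  sumPicks : List A → (A → List A → Carrier) → Carrier
  sumPicks []      φ = 0#
  sumPicks (x ∷ X) φ = φ x X + sumPicks X (λ y Y → φ y (x ∷ Y))

  sumSplits : List A → (List A → List A → Carrier) → Carrier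
  sumSplits []      φ = φ [] []
  sumSplits (x ∷ X) φ = sumSplits X (λ S T → φ (x ∷ S) T) + sumSplits X (λ S T → φ S (x ∷ T))

  -- The permutation given to the hypothesis transports distinctness and nonvanishing from `X` to
  -- the picked entry and the remaining ones.
  sumPicks-cong : ∀ {X : List A} {φ ψ} → (∀ y Y → X ↭ y ∷ Y → φ y Y ≈ ψ y Y) →
                  sumPicks X φ ≈ sumPicks X ψ
  sumPicks-cong {X = []}    h = refl
  sumPicks-cong {X = x ∷ X} h = +-cong (h x X ↭-refl)
    (sumPicks-cong λ y Y p → h y (x ∷ Y) (↭-trans (prep x p) (swap x y ↭-refl)))

  sumSplits-cong : ∀ {X : List A} {φ ψ} → (∀ S T → X ↭ S ++ T → φ S T ≈ ψ S T) →
                   sumSplits X φ ≈ sumSplits X ψ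
  sumSplits-cong {X = []}    h = h [] [] ↭-refl
  sumSplits-cong {X = x ∷ X} h = +-cong
    (sumSplits-cong λ S T p → h (x ∷ S) T (prep x p))
    (sumSplits-cong λ S T p → h S (x ∷ T) (↭-trans (prep x p) (↭-sym (shift x S T))))

  sumPicks-+ : ∀ (X : List A) {φ ψ} → sumPicks X (λ y Y → φ y Y + ψ y Y) ≈ sumPicks X φ + sumPicks X ψ
  sumPicks-+ []      = sym (+-identityˡ 0#)
  sumPicks-+ (x ∷ X) = trans (+-congˡ (sumPicks-+ X)) (+-interchange _ _ _ _)

  sumSplits-+ : ∀ (X : List A) {φ ψ} → sumSplits X (λ S T → φ S T + ψ S T) ≈ sumSplits X φ + sumSplits X ψ
  sumSplits-+ []      = refl
  sumSplits-+ (x ∷ X) = trans (+-cong (sumSplits-+ X) (sumSplits-+ X)) (+-interchange _ _ _ _)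

  sumPicks-*ˡ : ∀ (X : List A) {φ} k → sumPicks X (λ y Y → k * φ y Y) ≈ k * sumPicks X φ
  sumPicks-*ˡ []      k = sym (zeroʳ k)
  sumPicks-*ˡ (x ∷ X) k = trans (+-congˡ (sumPicks-*ˡ X k)) (sym (distribˡ k _ _))

  sumSplits-*ˡ : ∀ (X : List A) {φ} k → sumSplits X (λ S T → k * φ S T) ≈ k * sumSplits X φ
  sumSplits-*ˡ []      k = refl
  sumSplits-*ˡ (x ∷ X) k = trans (+-cong (sumSplits-*ˡ X k) (sumSplits-*ˡ X k)) (sym (distribˡ k _ _))

  sumSplits-0 : ∀ (X : List A) → sumSplits X (λ _ _ → 0#) ≈ 0#
  sumSplits-0 []      = refl
  sumSplits-0 (x ∷ X) = trans (+-cong (sumSplits-0 X) (sumSplits-0 X)) (+-identityˡ 0#)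

  -- With `sumPicks-splitsʳ`, this turns a sum over the entries of one half into a sum over all
  -- entries of `X`. The contributions of one pole coming from the two halves can then be compared.
  sumPicks-splitsˡ : ∀ (X : List A) (φ : A → List A → List A → Carrier) →
    sumPicks X (λ y Y → sumSplits Y (φ y)) ≈ sumSplits X (λ S T → sumPicks S (λ y S′ → φ y S′ T))
  sumPicks-splitsˡ []      φ = refl
  sumPicks-splitsˡ (x ∷ X) φ = begin
    sumSplits X (φ x) + sumPicks X (λ y Y → sumSplits Y (λ S T → φ y (x ∷ S) T) + sumSplits Y (λ S T → φ y S (x ∷ T)))
      ≈⟨ +-congˡ (trans (sumPicks-+ X) (+-cong (sumPicks-splitsˡ X _) (sumPicks-splitsˡ X _))) ⟩
    sumSplits X (φ x) + (sumSplits X (λ S T → sumPicks S (λ y S′ → φ y (x ∷ S′) T)) + sumSplits X (λ S T → sumPicks S (λ y S′ → φ y S′ (x ∷ T))))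
      ≈⟨ +-assoc _ _ _ ⟨
    (sumSplits X (φ x) + sumSplits X (λ S T → sumPicks S (λ y S′ → φ y (x ∷ S′) T))) + sumSplits X (λ S T → sumPicks S (λ y S′ → φ y S′ (x ∷ T)))
      ≈⟨ +-congʳ (sym (sumSplits-+ X)) ⟩
    _ ∎

  sumPicks-splitsʳ : ∀ (X : List A) (φ : A → List A → List A → Carrier) →
    sumPicks X (λ y Y → sumSplits Y (φ y)) ≈ sumSplits X (λ S T → sumPicks T (λ y T′ → φ y S T′))
  sumPicks-splitsʳ []      φ = refl
  sumPicks-splitsʳ (x ∷ X) φ = begin
    sumSplits X (φ x) + sumPicks X (λ y Y → sumSplits Y (λ S T → φ y (x ∷ S) T) + sumSplits Y (λ S T → φ y S (x ∷ T)))
      ≈⟨ +-congˡ (trans (sumPicks-+ X) (+-cong (sumPicks-splitsʳ X _) (sumPicks-splitsʳ X _))) ⟩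
    sumSplits X (φ x) + (sumSplits X (λ S T → sumPicks T (λ y T′ → φ y (x ∷ S) T′)) + sumSplits X (λ S T → sumPicks T (λ y T′ → φ y S (x ∷ T′))))
      ≈⟨ x+[y+z]≈y+[x+z] _ _ _ ⟩
    sumSplits X (λ S T → sumPicks T (λ y T′ → φ y (x ∷ S) T′)) + (sumSplits X (φ x) + sumSplits X (λ S T → sumPicks T (λ y T′ → φ y S (x ∷ T′))))
      ≈⟨ +-congˡ (sym (sumSplits-+ X)) ⟩
    _ ∎

  sumSplits-assoc : ∀ (X : List A) (φ : List A → List A → List A → Carrier) →
    sumSplits X (λ S T → sumSplits S (λ U V → φ U V T)) ≈ sumSplits X (λ U W → sumSplits W (λ V T → φ U V T))
  sumSplits-assoc []      φ = refl
  sumSplits-assoc (x ∷ X) φ = begin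
    sumSplits X (λ S T → sumSplits S (λ U V → φ (x ∷ U) V T) + sumSplits S (λ U V → φ U (x ∷ V) T))
      + sumSplits X (λ S T → sumSplits S (λ U V → φ U V (x ∷ T)))
      ≈⟨ +-congʳ (sumSplits-+ X) ⟩
    (sumSplits X (λ S T → sumSplits S (λ U V → φ (x ∷ U) V T)) + sumSplits X (λ S T → sumSplits S (λ U V → φ U (x ∷ V) T)))
      + sumSplits X (λ S T → sumSplits S (λ U V → φ U V (x ∷ T)))
      ≈⟨ +-cong (+-cong (sumSplits-assoc X _) (sumSplits-assoc X _)) (sumSplits-assoc X _) ⟩
    (sumSplits X (λ U W → sumSplits W (λ V T → φ (x ∷ U) V T)) + sumSplits X (λ U W → sumSplits W (λ V T → φ U (x ∷ V) T)))
      + sumSplits X (λ U W → sumSplits W (λ V T → φ U V (x ∷ T)))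
      ≈⟨ +-assoc _ _ _ ⟩
    sumSplits X (λ U W → sumSplits W (λ V T → φ (x ∷ U) V T)) + (sumSplits X (λ U W → sumSplits W (λ V T → φ U (x ∷ V) T))
      + sumSplits X (λ U W → sumSplits W (λ V T → φ U V (x ∷ T))))
      ≈⟨ +-congˡ (sym (sumSplits-+ X)) ⟩
    _ ∎

  -- Triangularity: exactly one splitting has empty `T`, so equality of the totals and of all other
  -- terms forces equality of that term. The induction cancels the terms whose head lies in `T`.
  sumSplits-trailing : ∀ (X : List A) {φ ψ} →
    (∀ S y T → X ↭ S ++ y ∷ T → φ S (y ∷ T) ≈ ψ S (y ∷ T)) →
    sumSplits X φ ≈ sumSplits X ψ → φ X [] ≈ ψ X []
  sumSplits-trailing []      h eq = eq
  sumSplits-trailing (x ∷ X) {φ} {ψ} h eq =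
    sumSplits-trailing X (λ S y T p → h (x ∷ S) y T (prep x p)) (+-cancelʳ _ _ _ (begin
      sumSplits X (λ S T → φ (x ∷ S) T) + sumSplits X (λ S T → φ S (x ∷ T)) ≈⟨ eq ⟩
      sumSplits X (λ S T → ψ (x ∷ S) T) + sumSplits X (λ S T → ψ S (x ∷ T))
        ≈⟨ +-congˡ (sumSplits-cong λ S T p → h S x T (↭-trans (prep x p) (↭-sym (shift x S T)))) ⟨
      sumSplits X (λ S T → ψ (x ∷ S) T) + sumSplits X (λ S T → φ S (x ∷ T)) ∎))
    where open import Algebra.Properties.Group +-group using () renaming (∙-cancelʳ to +-cancelʳ)

-- Division with an inverse specified only away from zero.

module FieldLemmas {c ℓ : Level} (R : CommutativeRing c ℓ)
  (_⁻¹ : CommutativeRing.Carrier R → CommutativeRing.Carrier R)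
  (inverseʳ : Alg.FieldInv R _⁻¹) where
  open CommutativeRing R
  open import Relation.Binary.Reasoning.Setoid setoid
  open import Algebra.Properties.CommutativeSemigroup *-commutativeSemigroup
    using () renaming (interchange to *-interchange)
  open IntegerSolver R using (solve; _:=_; _:+_; _:*_; _:-_)

  *-cancelˡ-nonzero : ∀ {a b d} → ¬ a ≈ 0# → a * b ≈ a * d → b ≈ d
  *-cancelˡ-nonzero {a} {b} {d} a≉0 eq = begin
    b               ≈⟨ expand b ⟩
    a ⁻¹ * (a * b)  ≈⟨ *-congˡ eq ⟩
    a ⁻¹ * (a * d)  ≈⟨ expand d ⟨
    d               ∎
    where
    expand : ∀ e → e ≈ a ⁻¹ * (a * e)
    expand e = begin
      e               ≈⟨ *-identityˡ e ⟨
      1# * e          ≈⟨ *-congʳ (inverseʳ a a≉0) ⟨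
      (a * a ⁻¹) * e  ≈⟨ *-congʳ (*-comm a _) ⟩
      (a ⁻¹ * a) * e  ≈⟨ *-assoc _ _ _ ⟩
      a ⁻¹ * (a * e)  ∎

  *-nonzero : ∀ {a b} → ¬ a ≈ 0# → ¬ b ≈ 0# → ¬ a * b ≈ 0#
  *-nonzero {a} a≉0 b≉0 ab≈0 = b≉0 (*-cancelˡ-nonzero a≉0 (trans ab≈0 (sym (zeroʳ a))))

  ⁻¹-unique : ∀ {a b} → ¬ a ≈ 0# → a * b ≈ 1# → b ≈ a ⁻¹
  ⁻¹-unique a≉0 eq = *-cancelˡ-nonzero a≉0 (trans eq (sym (inverseʳ _ a≉0)))

  -- Derived from uniqueness of inverses, hence only for nonzero `a`. This is where the nonvanishing
  -- conditions carried through the proof originate.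
  ⁻¹-cong : ∀ {a b} → ¬ a ≈ 0# → a ≈ b → a ⁻¹ ≈ b ⁻¹
  ⁻¹-cong {a} {b} a≉0 a≈b = ⁻¹-unique (λ b≈0 → a≉0 (trans a≈b b≈0)) (trans (*-congʳ (sym a≈b)) (inverseʳ a a≉0))

  ⁻¹-distrib-* : ∀ {a b} → ¬ a ≈ 0# → ¬ b ≈ 0# → (a * b) ⁻¹ ≈ a ⁻¹ * b ⁻¹
  ⁻¹-distrib-* {a} {b} a≉0 b≉0 = sym (⁻¹-unique (*-nonzero a≉0 b≉0) (begin
    (a * b) * (a ⁻¹ * b ⁻¹)    ≈⟨ *-interchange a b _ _ ⟩
    (a * a ⁻¹) * (b * b ⁻¹)    ≈⟨ *-cong (inverseʳ a a≉0) (inverseʳ b b≉0) ⟩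
    1# * 1#                    ≈⟨ *-identityˡ 1# ⟩
    1#                         ∎))

  ⁻¹-nonzero : ∀ {a} → ¬ a ≈ 0# → ¬ a ⁻¹ ≈ 0#
  ⁻¹-nonzero {a} a≉0 a⁻¹≈0 = a≉0 (begin
    a               ≈⟨ *-identityʳ a ⟨
    a * 1#          ≈⟨ *-congˡ (inverseʳ a a≉0) ⟨
    a * (a * a ⁻¹)  ≈⟨ *-congˡ (trans (*-congˡ a⁻¹≈0) (zeroʳ a)) ⟩
    a * 0#          ≈⟨ zeroʳ a ⟩
    0#              ∎)

  ⁻¹-involutive : ∀ {a} → ¬ a ≈ 0# → (a ⁻¹) ⁻¹ ≈ a
  ⁻¹-involutive {a} a≉0 = sym (⁻¹-unique (⁻¹-nonzero a≉0) (trans (*-comm _ a) (inverseʳ a a≉0)))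

  1⁻¹≈1 : ¬ 1# ≈ 0# → 1# ⁻¹ ≈ 1#
  1⁻¹≈1 1≉0 = sym (⁻¹-unique 1≉0 (*-identityˡ 1#))

  a-b≉0 : ∀ {a b} → ¬ a ≈ b → ¬ a - b ≈ 0#
  a-b≉0 {a} {b} a≉b eq = a≉b (begin
    a            ≈⟨ solve 2 (λ a b → a := (a :- b) :+ b) refl a b ⟩
    (a - b) + b  ≈⟨ +-congʳ eq ⟩
    0# + b       ≈⟨ +-identityˡ b ⟩
    b            ∎)

  /-≈ : ∀ {a b d e} → ¬ b ≈ 0# → ¬ e ≈ 0# → a * e ≈ d * b → a * b ⁻¹ ≈ d * e ⁻¹
  /-≈ {a} {b} {d} {e} b≉0 e≉0 eq = *-cancelˡ-nonzero b≉0 (*-cancelˡ-nonzero e≉0 (begin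
    e * (b * (a * b ⁻¹))  ≈⟨ solve 4 (λ e b a b′ → e :* (b :* (a :* b′)) := (a :* e) :* (b :* b′)) refl e b a (b ⁻¹) ⟩
    (a * e) * (b * b ⁻¹)  ≈⟨ *-cong eq (trans (inverseʳ b b≉0) (sym (inverseʳ e e≉0))) ⟩
    (d * b) * (e * e ⁻¹)  ≈⟨ solve 4 (λ e b d e′ → (d :* b) :* (e :* e′) := e :* (b :* (d :* e′))) refl e b d (e ⁻¹) ⟩
    e * (b * (d * e ⁻¹))  ∎))

  /-cancelʳ : ∀ {a b} → ¬ b ≈ 0# → (a * b ⁻¹) * b ≈ a
  /-cancelʳ {a} {b} b≉0 = trans (*-assoc _ _ _) (trans (*-congˡ (trans (*-comm _ b) (inverseʳ b b≉0))) (*-identityʳ a))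

-- Products over the entries and pairs of a list, and their invariance under reordering.

AllPairs-resp-↭ : ∀ {a r} {A : Set a} {P : A → A → Set r} → (∀ {x y} → P x y → P y x) →
  ∀ {X Y} → X ↭ Y → AllPairs P X → AllPairs P Y
AllPairs-resp-↭ symm Perm.refl         ps                        = ps
AllPairs-resp-↭ symm (Perm.prep x p)   (x-X ∷ ps)                = All-resp-↭ p x-X ∷ AllPairs-resp-↭ symm p ps
AllPairs-resp-↭ symm (Perm.swap x y p) ((xy ∷ x-X) ∷ (y-X ∷ ps)) =
  (symm xy ∷ All-resp-↭ p y-X) ∷ (All-resp-↭ p x-X ∷ AllPairs-resp-↭ symm p ps)
AllPairs-resp-↭ symm (Perm.trans p q)  ps                        = AllPairs-resp-↭ symm q (AllPairs-resp-↭ symm p ps)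

module ListProducts {c ℓ : Level} (R : CommutativeRing c ℓ) where
  open CommutativeRing R
  open import Relation.Binary.Reasoning.Setoid setoid
  open import Algebra.Properties.CommutativeSemigroup *-commutativeSemigroup
    using () renaming (interchange to *-interchange; x∙yz≈y∙xz to x*[y*z]≈y*[x*z])

  private variable
    a : Level
    A : Set a

  prodOver : (A → Carrier) → List A → Carrier
  prodOver f []      = 1#
  prodOver f (x ∷ X) = f x * prodOver f X

  prodOver-cong : ∀ {f g : A → Carrier} {X} → All (λ x → f x ≈ g x) X → prodOver f X ≈ prodOver g X
  prodOver-cong []         = refl
  prodOver-cong (eq ∷ eqs) = *-cong eq (prodOver-cong eqs)

  prodOver-* : ∀ (f g : A → Carrier) X → prodOver (λ x → f x * g x) X ≈ prodOver f X * prodOver g X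
  prodOver-* f g []      = sym (*-identityˡ 1#)
  prodOver-* f g (x ∷ X) = trans (*-congˡ (prodOver-* f g X)) (*-interchange _ _ _ _)

  prodOver-1 : ∀ (X : List A) → prodOver (λ _ → 1#) X ≈ 1#
  prodOver-1 []      = refl
  prodOver-1 (x ∷ X) = trans (*-identityˡ _) (prodOver-1 X)

  prodOver-++ : ∀ (f : A → Carrier) X Y → prodOver f (X ++ Y) ≈ prodOver f X * prodOver f Y
  prodOver-++ f []      Y = sym (*-identityˡ _)
  prodOver-++ f (x ∷ X) Y = trans (*-congˡ (prodOver-++ f X Y)) (sym (*-assoc _ _ _))

  prodOver-↭ : ∀ (f : A → Carrier) {X Y} → X ↭ Y → prodOver f X ≈ prodOver f Y
  prodOver-↭ f Perm.refl         = refl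
  prodOver-↭ f (Perm.prep x p)   = *-congˡ (prodOver-↭ f p)
  prodOver-↭ f (Perm.swap x y p) = trans (x*[y*z]≈y*[x*z] _ _ _) (*-congˡ (*-congˡ (prodOver-↭ f p)))
  prodOver-↭ f (Perm.trans p q)  = trans (prodOver-↭ f p) (prodOver-↭ f q)

  prodOver-splits : ∀ (f : A → Carrier) {X} S T → X ↭ S ++ T → prodOver f X ≈ prodOver f S * prodOver f T
  prodOver-splits f S T p = trans (prodOver-↭ f p) (prodOver-++ f S T)

  pairProd : (A → A → Carrier) → List A → Carrier
  pairProd f []      = 1#
  pairProd f (x ∷ X) = prodOver (f x) X * pairProd f X

  pairProd-cong : ∀ {f g : A → A → Carrier} {X} → AllPairs (λ x y → f x y ≈ g x y) X → pairProd f X ≈ pairProd g X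
  pairProd-cong []         = refl
  pairProd-cong (eq ∷ eqs) = *-cong (prodOver-cong eq) (pairProd-cong eqs)

  pairProd-* : ∀ (f g : A → A → Carrier) X → pairProd (λ x y → f x y * g x y) X ≈ pairProd f X * pairProd g X
  pairProd-* f g []      = sym (*-identityˡ 1#)
  pairProd-* f g (x ∷ X) = trans (*-cong (prodOver-* (f x) (g x) X) (pairProd-* f g X)) (*-interchange _ _ _ _)

  -- Symmetry is asked only of the pairs occurring in `X`: the factor `B` to which this is applied
  -- is known to be symmetric only at nondegenerate pairs.
  pairProd-↭ : ∀ (f : A → A → Carrier) {X Y} → AllPairs (λ x y → f x y ≈ f y x) X → X ↭ Y → pairProd f X ≈ pairProd f Y
  pairProd-↭ f symm Perm.refl = refl
  pairProd-↭ f (_ ∷ symm) (Perm.prep x p) = *-cong (prodOver-↭ (f x) p) (pairProd-↭ f symm p)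
  pairProd-↭ f {_ ∷ _ ∷ X} {_ ∷ _ ∷ Y} ((xy ∷ _) ∷ _ ∷ symm) (Perm.swap x y p) = begin
    (f x y * prodOver (f x) X) * (prodOver (f y) X * pairProd f X)
      ≈⟨ *-cong (*-cong xy (prodOver-↭ (f x) p)) (*-cong (prodOver-↭ (f y) p) (pairProd-↭ f symm p)) ⟩
    (f y x * prodOver (f x) Y) * (prodOver (f y) Y * pairProd f Y)
      ≈⟨ *-interchange _ _ _ _ ⟩
    (f y x * prodOver (f y) Y) * (prodOver (f x) Y * pairProd f Y) ∎
  pairProd-↭ f symm (Perm.trans p q) = trans (pairProd-↭ f symm p) (pairProd-↭ f (AllPairs-resp-↭ sym p symm) q)

  prodOver-map : ∀ {b} {B : Set b} (f : B → Carrier) (g : A → B) X → prodOver f (map g X) ≈ prodOver (λ x → f (g x)) X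
  prodOver-map f g []      = refl
  prodOver-map f g (x ∷ X) = *-congˡ (prodOver-map f g X)

  cross : (A → A → Carrier) → List A → List A → Carrier
  cross f S T = prodOver (λ x → prodOver (f x) T) S

  cross-∷ʳ : ∀ (f : A → A → Carrier) S y T → cross f S (y ∷ T) ≈ prodOver (λ x → f x y) S * cross f S T
  cross-∷ʳ f S y T = prodOver-* (λ x → f x y) (λ x → prodOver (f x) T) S

  cross-[] : ∀ (f : A → A → Carrier) S → cross f S [] ≈ 1#
  cross-[] f S = prodOver-1 S

  cross-splitsˡ : ∀ (f : A → A → Carrier) {X} S T U → X ↭ S ++ T → cross f X U ≈ cross f S U * cross f T U
  cross-splitsˡ f S T U = prodOver-splits (λ x → prodOver (f x) U) S T

  cross-splitsʳ : ∀ (f : A → A → Carrier) {X} S T U → X ↭ S ++ T → cross f U X ≈ cross f U S * cross f U T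
  cross-splitsʳ f S T U p = trans
    (prodOver-cong (All.universal (λ x → prodOver-splits (f x) S T p) U))
    (prodOver-* _ _ U)

module FieldProducts {c ℓ : Level} (R : CommutativeRing c ℓ)
  (_⁻¹ : CommutativeRing.Carrier R → CommutativeRing.Carrier R)
  (inverseʳ : Alg.FieldInv R _⁻¹) where
  open CommutativeRing R
  open FieldLemmas R _⁻¹ inverseʳ
  open ListProducts R

  prodOver-cancel : ∀ {a} {A : Set a} (f : A → Carrier) {X b d} → All (λ x → ¬ f x ≈ 0#) X →
    prodOver f X * b ≈ prodOver f X * d → b ≈ d
  prodOver-cancel f []       eq = trans (sym (*-identityˡ _)) (trans eq (*-identityˡ _))
  prodOver-cancel f (h ∷ hs) eq =
    prodOver-cancel f hs (*-cancelˡ-nonzero h (trans (sym (*-assoc _ _ _)) (trans eq (*-assoc _ _ _))))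

-- Partial fractions for products of Hall-Littlewood kernels.

module PartialFractions {c ℓ : Level} (R : CommutativeRing c ℓ)
  (_⁻¹ : CommutativeRing.Carrier R → CommutativeRing.Carrier R)
  (inverseʳ : Alg.FieldInv R _⁻¹) (t : CommutativeRing.Carrier R)
  {a : Level} {A : Set a} (p q : A → CommutativeRing.Carrier R) (α : A → A → CommutativeRing.Carrier R) where
  open CommutativeRing R
  open import Relation.Binary.Reasoning.Setoid setoid
  open IntegerSolver R using (solve; _:=_; _:+_; _:*_; _:-_; con)
  open FieldLemmas R _⁻¹ inverseʳ
  open ListSums R
  open ListProducts R
  open FieldProducts R _⁻¹ inverseʳ

  -- An entry stands for the point (p : q) of the projective line. The choice (x : 1) yields rows of
  -- the kernel (x - t y)/(x - y), the choice (1 : x) its columns, so one induction serves both.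
  det : A → A → Carrier
  det x y = p x * q y - p y * q x

  Separated : A → A → Set _
  Separated x y = (¬ det x y ≈ 0#) × (α x y * det x y ≈ p x * q y - t * p y * q x)
                × (α y x * det y x ≈ p y * q x - t * p x * q y)

  σ : A → List A → Carrier
  σ y Y = prodOver (α y) Y * p y

  -- Value of partialFractions at the pole (u : v) = (q w : p w).
  kernelExpansion : ∀ {w X} → All (Separated w) X → AllPairs Separated X →
    prodOver (α w) X ≈ 1# + (1# - t) * q w * sumPicks X (λ y Y → σ y Y * det w y ⁻¹)

  -- The expansion of ∏ (q v - t u p)/(q v - u p) over its poles, with denominators cleared. When
  -- `w` is added, its residue is the value of the old product at that pole. This value is
  -- `kernelExpansion` for `X`, which is in turn the present identity for `X` at that point, hence
  -- the mutual recursion.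
  partialFractions : ∀ {X} → AllPairs Separated X → ∀ u v →
    prodOver (λ x → q x * v - t * u * p x) X ≈
      prodOver (λ x → q x * v - u * p x) X
      + (1# - t) * u * sumPicks X (λ y Y → σ y Y * prodOver (λ x → q x * v - u * p x) Y)
  partialFractions [] u v = solve 2 (λ t u → con (+ 1) := con (+ 1) :+ (con (+ 1) :- t) :* u :* con (+ 0)) refl t u
  partialFractions {w ∷ X} (w-X ∷ X-sep) u v = begin
    (q w * v - t * u * p w) * prodOver (λ x → q x * v - t * u * p x) X
      ≈⟨ *-congˡ (partialFractions X-sep u v) ⟩
    (q w * v - t * u * p w) * (P + (1# - t) * u * Σ₁)
      ≈⟨ solve 7 (λ qw v t u pw P Σ₁ → (qw :* v :- t :* u :* pw) :* (P :+ (con (+ 1) :- t) :* u :* Σ₁)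
           := (qw :* v :- t :* u :* pw) :* P :+ (con (+ 1) :- t) :* u :* ((qw :* v :- t :* u :* pw) :* Σ₁))
           refl (q w) v t u (p w) P Σ₁ ⟩
    (q w * v - t * u * p w) * P + (1# - t) * u * ((q w * v - t * u * p w) * Σ₁)
      ≈⟨ +-congˡ (*-congˡ sums) ⟩
    (q w * v - t * u * p w) * P + (1# - t) * u * ((1# - t) * q w * p w * P * Σ₂ + Σ₃)
      ≈⟨ solve 8 (λ qw v t u pw P Σ₂ Σ₃ → (qw :* v :- t :* u :* pw) :* P :+ (con (+ 1) :- t) :* u :* ((con (+ 1) :- t) :* qw :* pw :* P :* Σ₂ :+ Σ₃)
           := (qw :* v :- u :* pw) :* P :+ (con (+ 1) :- t) :* u :* (((con (+ 1) :+ (con (+ 1) :- t) :* qw :* Σ₂) :* pw) :* P :+ Σ₃))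
           refl (q w) v t u (p w) P Σ₂ Σ₃ ⟩
    (q w * v - u * p w) * P + (1# - t) * u * (((1# + (1# - t) * q w * Σ₂) * p w) * P + Σ₃)
      ≈⟨ +-congˡ (*-congˡ (+-congʳ (*-congʳ (*-congʳ (sym (kernelExpansion w-X X-sep)))))) ⟩
    (q w * v - u * p w) * P + (1# - t) * u * ((prodOver (α w) X * p w) * P + Σ₃) ∎
    where
    f : A → Carrier
    f x = q x * v - u * p x

    P Σ₁ Σ₂ Σ₃ : Carrier
    P  = prodOver f X
    Σ₁ = sumPicks X (λ y Y → σ y Y * prodOver f Y)
    Σ₂ = sumPicks X (λ y Y → σ y Y * det w y ⁻¹)
    Σ₃ = sumPicks X (λ y Y → (α y w * prodOver (α y) Y * p y) * (f w * prodOver f Y))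

    sums : (q w * v - t * u * p w) * Σ₁ ≈ (1# - t) * q w * p w * P * Σ₂ + Σ₃
    sums = begin
      (q w * v - t * u * p w) * Σ₁
        ≈⟨ sumPicks-*ˡ X _ ⟨
      sumPicks X (λ y Y → (q w * v - t * u * p w) * (σ y Y * prodOver f Y))
        ≈⟨ sumPicks-cong {X = X} termwise ⟩
      sumPicks X (λ y Y → (1# - t) * q w * p w * P * (σ y Y * det w y ⁻¹) + (α y w * prodOver (α y) Y * p y) * (f w * prodOver f Y))
        ≈⟨ sumPicks-+ X ⟩
      sumPicks X (λ y Y → (1# - t) * q w * p w * P * (σ y Y * det w y ⁻¹)) + Σ₃
        ≈⟨ +-congʳ (sumPicks-*ˡ X _) ⟩
      (1# - t) * q w * p w * P * Σ₂ + Σ₃ ∎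
      where
      -- Multiplying the term of the pole `y` by the factor of `w` produces two simple poles. The
      -- first summand, without `f w`, goes to the pole at `w`; the second stays at `y` and acquires
      -- the factor `α y w`.
      termwise : ∀ y Y → X ↭ y ∷ Y → (q w * v - t * u * p w) * (σ y Y * prodOver f Y)
        ≈ (1# - t) * q w * p w * P * (σ y Y * det w y ⁻¹) + (α y w * prodOver (α y) Y * p y) * (f w * prodOver f Y)
      termwise y Y X↭ = *-cancelˡ-nonzero d≉0 (begin
        d * ((q w * v - t * u * p w) * (σ y Y * F))
          ≈⟨ solve 9 (λ pw qw py qy t u v a F →
               let d = pw :* qy :- py :* qw in
               d :* ((qw :* v :- t :* u :* pw) :* (a :* py :* F)) :=
               (con (+ 1) :- t) :* qw :* pw :* ((qy :* v :- u :* py) :* F) :* (a :* py :* con (+ 1))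
               :- (py :* qw :- t :* pw :* qy) :* a :* py :* ((qw :* v :- u :* pw) :* F))
             refl (p w) (q w) (p y) (q y) t u v (prodOver (α y) Y) F ⟩
        (1# - t) * q w * p w * (f y * F) * (σ y Y * 1#) - (p y * q w - t * p w * q y) * prodOver (α y) Y * p y * (f w * F)
          ≈⟨ +-cong (*-cong (*-congˡ (sym (prodOver-↭ f X↭))) (*-congˡ (sym (inverseʳ d d≉0))))
               (-‿cong (*-congʳ (*-congʳ (*-congʳ (sym (proj₂ (proj₂ sep))))))) ⟩
        (1# - t) * q w * p w * P * (σ y Y * (d * d ⁻¹)) - (α y w * det y w) * prodOver (α y) Y * p y * (f w * F)
          ≈⟨ solve 12 (λ pw qw py qy t P a e b s F f →
               let d = pw :* qy :- py :* qw in
               (con (+ 1) :- t) :* qw :* pw :* P :* (s :* (d :* e)) :- (b :* (py :* qw :- pw :* qy)) :* a :* py :* (f :* F)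
               := d :* ((con (+ 1) :- t) :* qw :* pw :* P :* (s :* e) :+ (b :* a :* py) :* (f :* F)))
             refl (p w) (q w) (p y) (q y) t P (prodOver (α y) Y) (d ⁻¹) (α y w) (σ y Y) F (f w) ⟩
        d * ((1# - t) * q w * p w * P * (σ y Y * d ⁻¹) + (α y w * prodOver (α y) Y * p y) * (f w * F)) ∎)
        where
        d F : Carrier
        d = det w y
        F = prodOver f Y
        sep = All.head (All-resp-↭ X↭ w-X)
        d≉0 = proj₁ sep

  kernelExpansion {w} {X} w-X X-sep = prodOver-cancel (det w) (All.map proj₁ w-X) (begin
    prodOver (det w) X * prodOver (α w) X
      ≈⟨ *-comm _ _ ⟩
    prodOver (α w) X * prodOver (det w) X
      ≈⟨ prodOver-* (α w) (det w) X ⟨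
    prodOver (λ x → α w x * det w x) X
      ≈⟨ prodOver-cong (All.map (λ sep → trans (proj₁ (proj₂ sep)) (flipped t _ _)) w-X) ⟩
    prodOver (λ x → q x * p w - t * q w * p x) X
      ≈⟨ partialFractions X-sep (q w) (p w) ⟩
    prodOver (λ x → q x * p w - q w * p x) X + (1# - t) * q w * sumPicks X (λ y Y → σ y Y * prodOver (λ x → q x * p w - q w * p x) Y)
      ≈⟨ +-cong (flipped-det X) (*-congˡ (sumPicks-cong {X = X} λ y Y _ → *-congˡ (flipped-det Y))) ⟩
    D + (1# - t) * q w * sumPicks X (λ y Y → σ y Y * prodOver (det w) Y)
      ≈⟨ +-congˡ (*-congˡ (sumPicks-cong {X = X} clear)) ⟩
    D + (1# - t) * q w * sumPicks X (λ y Y → D * (σ y Y * det w y ⁻¹))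
      ≈⟨ +-congˡ (*-congˡ (sumPicks-*ˡ X D)) ⟩
    D + (1# - t) * q w * (D * Σ₂)
      ≈⟨ solve 4 (λ D t qw Σ₂ → D :+ (con (+ 1) :- t) :* qw :* (D :* Σ₂) := D :* (con (+ 1) :+ (con (+ 1) :- t) :* qw :* Σ₂)) refl D t (q w) Σ₂ ⟩
    D * (1# + (1# - t) * q w * Σ₂) ∎)
    where
    D Σ₂ : Carrier
    D  = prodOver (det w) X
    Σ₂ = sumPicks X (λ y Y → σ y Y * det w y ⁻¹)

    flipped : ∀ s x y → p x * q y - s * p y * q x ≈ q y * p x - s * q x * p y
    flipped s x y = solve 5 (λ s px qx py qy → px :* qy :- s :* py :* qx := qy :* px :- s :* qx :* py) refl s (p x) (q x) (p y) (q y)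

    flipped-det : ∀ Y → prodOver (λ x → q x * p w - q w * p x) Y ≈ prodOver (det w) Y
    flipped-det Y = prodOver-cong (All.universal (λ x → solve 4 (λ px qx pw qw → qx :* pw :- qw :* px := pw :* qx :- px :* qw) refl (p x) (q x) (p w) (q w)) Y)

    clear : ∀ y Y → X ↭ y ∷ Y → σ y Y * prodOver (det w) Y ≈ D * (σ y Y * det w y ⁻¹)
    clear y Y X↭ = begin
      σ y Y * prodOver (det w) Y
        ≈⟨ *-identityˡ _ ⟨
      1# * (σ y Y * prodOver (det w) Y)
        ≈⟨ *-congʳ (inverseʳ (det w y) (proj₁ (All.head (All-resp-↭ X↭ w-X)))) ⟨
      (det w y * det w y ⁻¹) * (σ y Y * prodOver (det w) Y)
        ≈⟨ solve 4 (λ d e s E → (d :* e) :* (s :* E) := (d :* E) :* (s :* e)) refl (det w y) (det w y ⁻¹) (σ y Y) (prodOver (det w) Y) ⟩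
      (det w y * prodOver (det w) Y) * (σ y Y * det w y ⁻¹)
        ≈⟨ *-congʳ (prodOver-↭ (det w) X↭) ⟨
      D * (σ y Y * det w y ⁻¹) ∎

  -- The expansion at (u : v) = (-1 : 0), where every linear factor reduces to a multiple of `p x`.
  -- Dividing by the product of all `p x` leaves only the products of `α`.
  sumPicks-prod : ∀ {X} → All (λ x → ¬ p x ≈ 0#) X → AllPairs Separated X →
    (1# - t) * sumPicks X (λ y Y → prodOver (α y) Y) ≈ 1# - prodOver (λ _ → t) X
  sumPicks-prod {X} p≉0 X-sep = prodOver-cancel p p≉0 (begin
    P * ((1# - t) * Σα)
      ≈⟨ solve 3 (λ P t S → P :* ((con (+ 1) :- t) :* S) := P :- (P :+ (con (+ 1) :- t) :* (con (+ 0) :- con (+ 1)) :* (P :* S))) refl P t Σα ⟩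
    P - (P + (1# - t) * (0# - 1#) * (P * Σα))
      ≈⟨ +-congˡ (-‿cong (+-congˡ (*-congˡ (sym (sumPicks-*ˡ X P))))) ⟩
    P - (P + (1# - t) * (0# - 1#) * sumPicks X (λ y Y → P * prodOver (α y) Y))
      ≈⟨ +-congˡ (-‿cong (+-cong (sym (at-∞ X)) (*-congˡ (sumPicks-cong {X = X} collect)))) ⟩
    P - (prodOver (λ x → q x * 0# - (0# - 1#) * p x) X + (1# - t) * (0# - 1#) * sumPicks X (λ y Y → σ y Y * prodOver (λ x → q x * 0# - (0# - 1#) * p x) Y))
      ≈⟨ +-congˡ (-‿cong (sym (partialFractions X-sep (0# - 1#) 0#))) ⟩
    P - prodOver (λ x → q x * 0# - t * (0# - 1#) * p x) X
      ≈⟨ +-congˡ (-‿cong (trans (prodOver-cong (All.universal (λ x → solve 3 (λ p q t → q :* con (+ 0) :- t :* (con (+ 0) :- con (+ 1)) :* p := t :* p) refl (p x) (q x) t) X)) (prodOver-* (λ _ → t) p X))) ⟩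
    P - prodOver (λ _ → t) X * P
      ≈⟨ solve 2 (λ P T → P :- T :* P := P :* (con (+ 1) :- T)) refl P (prodOver (λ _ → t) X) ⟩
    P * (1# - prodOver (λ _ → t) X) ∎)
    where
    P Σα : Carrier
    P  = prodOver p X
    Σα = sumPicks X (λ y Y → prodOver (α y) Y)

    at-∞ : ∀ Y → prodOver (λ x → q x * 0# - (0# - 1#) * p x) Y ≈ prodOver p Y
    at-∞ Y = prodOver-cong (All.universal (λ x → solve 2 (λ p q → q :* con (+ 0) :- (con (+ 0) :- con (+ 1)) :* p := p) refl (p x) (q x)) Y)

    collect : ∀ y Y → X ↭ y ∷ Y → P * prodOver (α y) Y ≈ σ y Y * prodOver (λ x → q x * 0# - (0# - 1#) * p x) Y
    collect y Y X↭ = begin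
      P * prodOver (α y) Y                 ≈⟨ *-congʳ (prodOver-↭ p X↭) ⟩
      (p y * prodOver p Y) * prodOver (α y) Y
        ≈⟨ solve 3 (λ p P a → (p :* P) :* a := (a :* p) :* P) refl (p y) (prodOver p Y) (prodOver (α y) Y) ⟩
      σ y Y * prodOver p Y                 ≈⟨ *-congˡ (at-∞ Y) ⟨
      σ y Y * prodOver (λ x → q x * 0# - (0# - 1#) * p x) Y ∎

-- The product `⊛`: unit, associativity, twists and cancellation.

module HallAlgebra {c ℓ : Level} (R : CommutativeRing c ℓ)
  (A : CommutativeRing.Carrier R → CommutativeRing.Carrier R → CommutativeRing.Carrier R) where
  open CommutativeRing R
  open import Relation.Binary.Reasoning.Setoid setoid
  open IntegerSolver R using (solve; _:=_; _:*_; con)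
  open ListSums R
  open ListProducts R

  infixr 7 _⊛_

  _⊛_ : (List Carrier → Carrier) → (List Carrier → Carrier) → List Carrier → Carrier
  (F ⊛ G) X = sumSplits X (λ S T → cross A S T * (F S * G T))

  δ : List Carrier → Carrier
  δ []      = 1#
  δ (_ ∷ _) = 0#

  ⊛-cong : ∀ X {F F′ G G′} → (∀ S T → X ↭ S ++ T → F S ≈ F′ S) → (∀ S T → X ↭ S ++ T → G T ≈ G′ T) →
           (F ⊛ G) X ≈ (F′ ⊛ G′) X
  ⊛-cong X f g = sumSplits-cong {X = X} λ S T p → *-congˡ (*-cong (f S T p) (g S T p))

  -- Since `cross` is multiplicative in each half, both bracketings are the sum over splittings into
  -- `U`, `V`, `T` with a kernel factor for each of the three pairs of blocks.
  ⊛-assoc : ∀ F G H X → ((F ⊛ G) ⊛ H) X ≈ (F ⊛ (G ⊛ H)) X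
  ⊛-assoc F G H X = begin
    sumSplits X (λ S T → cross A S T * ((F ⊛ G) S * H T))
      ≈⟨ sumSplits-cong {X = X} (λ S T _ → pullˡ S T) ⟩
    sumSplits X (λ S T → sumSplits S (λ U V → φ U V T))
      ≈⟨ sumSplits-assoc X φ ⟩
    sumSplits X (λ U W → sumSplits W (λ V T → φ U V T))
      ≈⟨ sumSplits-cong {X = X} (λ U W _ → pullʳ U W) ⟨
    sumSplits X (λ U W → cross A U W * (F U * (G ⊛ H) W)) ∎
    where
    φ : List Carrier → List Carrier → List Carrier → Carrier
    φ U V T = (cross A U T * cross A V T * cross A U V) * (F U * G V * H T)

    pullˡ : ∀ S T → cross A S T * ((F ⊛ G) S * H T) ≈ sumSplits S (λ U V → φ U V T)
    pullˡ S T = begin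
      cross A S T * ((F ⊛ G) S * H T)
        ≈⟨ solve 3 (λ a s h → a :* (s :* h) := (a :* h) :* s) refl (cross A S T) ((F ⊛ G) S) (H T) ⟩
      (cross A S T * H T) * (F ⊛ G) S
        ≈⟨ sumSplits-*ˡ S _ ⟨
      sumSplits S (λ U V → (cross A S T * H T) * (cross A U V * (F U * G V)))
        ≈⟨ sumSplits-cong {X = S} (λ U V p → trans (*-congʳ (*-congʳ (cross-splitsˡ A U V T p)))
             (solve 5 (λ a b f g h → (a :* h) :* (b :* (f :* g)) := (a :* b) :* (f :* g :* h)) refl
               (cross A U T * cross A V T) (cross A U V) (F U) (G V) (H T))) ⟩
      sumSplits S (λ U V → φ U V T) ∎

    pullʳ : ∀ U W → cross A U W * (F U * (G ⊛ H) W) ≈ sumSplits W (λ V T → φ U V T)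
    pullʳ U W = begin
      cross A U W * (F U * (G ⊛ H) W)
        ≈⟨ *-assoc _ _ _ ⟨
      (cross A U W * F U) * (G ⊛ H) W
        ≈⟨ sumSplits-*ˡ W _ ⟨
      sumSplits W (λ V T → (cross A U W * F U) * (cross A V T * (G V * H T)))
        ≈⟨ sumSplits-cong {X = W} (λ V T p → trans (*-congʳ (*-congʳ (cross-splitsʳ A V T U p)))
             (solve 6 (λ a b d f g h → ((a :* d) :* f) :* (b :* (g :* h)) := (d :* b :* a) :* (f :* g :* h)) refl
               (cross A U V) (cross A V T) (cross A U T) (F U) (G V) (H T))) ⟩
      sumSplits W (λ V T → φ U V T) ∎

  ⊛-identityʳ : ∀ F X → (F ⊛ δ) X ≈ F X
  ⊛-identityʳ F []      = solve 1 (λ f → con (+ 1) :* (f :* con (+ 1)) := f) refl (F [])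
  ⊛-identityʳ F (x ∷ X) = begin
    sumSplits X (λ S T → (prodOver (A x) T * cross A S T) * (F (x ∷ S) * δ T))
      + sumSplits X (λ S T → cross A S (x ∷ T) * (F S * 0#))
      ≈⟨ +-cong (sumSplits-cong {X = X} drop)
           (trans (sumSplits-cong {X = X} (λ S T _ → trans (*-congˡ (zeroʳ _)) (zeroʳ _))) (sumSplits-0 X)) ⟩
    ((λ S → F (x ∷ S)) ⊛ δ) X + 0#
      ≈⟨ +-identityʳ _ ⟩
    ((λ S → F (x ∷ S)) ⊛ δ) X
      ≈⟨ ⊛-identityʳ (λ S → F (x ∷ S)) X ⟩
    F (x ∷ X) ∎
    where
    drop : ∀ S T → X ↭ S ++ T → (prodOver (A x) T * cross A S T) * (F (x ∷ S) * δ T) ≈ cross A S T * (F (x ∷ S) * δ T)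
    drop S []      _ = *-congʳ (*-identityˡ _)
    drop S (y ∷ T) _ = solve 3 (λ a b f → (a :* b) :* (f :* con (+ 0)) := b :* (f :* con (+ 0))) refl
                         (prodOver (A x) (y ∷ T)) (cross A S (y ∷ T)) (F (x ∷ S))

  ⊛-identityˡ : ∀ G X → (δ ⊛ G) X ≈ G X
  ⊛-identityˡ G []      = solve 1 (λ f → con (+ 1) :* (con (+ 1) :* f) := f) refl (G [])
  ⊛-identityˡ G (x ∷ X) = begin
    sumSplits X (λ S T → cross A (x ∷ S) T * (0# * G T)) + sumSplits X (λ S T → cross A S (x ∷ T) * (δ S * G (x ∷ T)))
      ≈⟨ +-cong (trans (sumSplits-cong {X = X} (λ S T _ → trans (*-congˡ (zeroˡ _)) (zeroʳ _))) (sumSplits-0 X))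
           (sumSplits-cong {X = X} drop) ⟩
    0# + (δ ⊛ (λ T → G (x ∷ T))) X
      ≈⟨ +-identityˡ _ ⟩
    (δ ⊛ (λ T → G (x ∷ T))) X
      ≈⟨ ⊛-identityˡ (λ T → G (x ∷ T)) X ⟩
    G (x ∷ X) ∎
    where
    drop : ∀ S T → X ↭ S ++ T → cross A S (x ∷ T) * (δ S * G (x ∷ T)) ≈ cross A S T * (δ S * G (x ∷ T))
    drop []      T _ = refl
    drop (s ∷ S) T _ = solve 3 (λ a b g → a :* (con (+ 0) :* g) := b :* (con (+ 0) :* g)) refl
                         (cross A (s ∷ S) (x ∷ T)) (cross A (s ∷ S) T) (G (x ∷ T))

  twist : (Carrier → Carrier) → (List Carrier → Carrier) → List Carrier → Carrier
  twist f F X = prodOver f X * F X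

  -- A product over entries factors along every splitting, so twisting is an endomorphism of `⊛`.
  -- Powers of τ and the factors x - t₂ pass through products in this way.
  twist-⊛ : ∀ f F G X → twist f (F ⊛ G) X ≈ (twist f F ⊛ twist f G) X
  twist-⊛ f F G X = begin
    prodOver f X * (F ⊛ G) X
      ≈⟨ sumSplits-*ˡ X _ ⟨
    sumSplits X (λ S T → prodOver f X * (cross A S T * (F S * G T)))
      ≈⟨ sumSplits-cong {X = X} (λ S T p → trans (*-congʳ (prodOver-splits f S T p))
           (solve 5 (λ a b f g h → (a :* b) :* (f :* (g :* h)) := f :* ((a :* g) :* (b :* h))) refl
             (prodOver f S) (prodOver f T) (cross A S T) (F S) (G T))) ⟩
    (twist f F ⊛ twist f G) X ∎

  -- Because `K [] ≈ 1#`, the splitting with empty `T` contributes `F X` itself; all others involve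
  -- `F` on shorter lists, which induction on the length handles. The class `P` lets the equation be
  -- assumed only for nondegenerate lists.
  ⊛-cancelʳ : ∀ {p} {F G K : List Carrier → Carrier} (P : List Carrier → Set p) →
    (∀ {X} S {T} → X ↭ S ++ T → P X → P S) → K [] ≈ 1# →
    (∀ X → P X → (F ⊛ K) X ≈ (G ⊛ K) X) → ∀ X → P X → F X ≈ G X
  ⊛-cancelʳ {F = F} {G} {K} P P-sub K[]≈1 eq X = bounded (length X) X ℕ.≤-refl
    where
    top : ∀ F X → cross A X [] * (F X * K []) ≈ F X
    top F X = trans (*-cong (cross-[] A X) (*-congˡ K[]≈1)) (trans (*-identityˡ _) (*-identityʳ _))

    bounded : ∀ n X → length X ℕ.≤ n → P X → F X ≈ G X
    smaller : ∀ n X S y T → length X ℕ.≤ n → P X → X ↭ S ++ y ∷ T → F S ≈ G S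

    bounded n X X≤n PX = trans (sym (top F X)) (trans
      (sumSplits-trailing X {λ S T → cross A S T * (F S * K T)} {λ S T → cross A S T * (G S * K T)}
        (λ S y T p → *-congˡ (*-congʳ (smaller n X S y T X≤n PX p))) (eq X PX)) (top G X))

    smaller zero X S y T X≤n PX p with ℕ.≤-trans (ℕ.≤-reflexive (≡.trans (≡.sym (length-++ S)) (≡.sym (↭-length p)))) X≤n
    ... | q with ℕ.m+n≤o⇒n≤o (length S) q
    ... | ()
    smaller (suc n) X S y T X≤n PX p = bounded n S
      (ℕ.≤-pred (ℕ.≤-trans (ℕ.≤-trans (ℕ.≤-trans (s≤s (ℕ.m≤m+n (length S) (length T))) (ℕ.≤-reflexive (≡.sym (ℕ.+-suc _ _))))
        (ℕ.≤-reflexive (≡.trans (≡.sym (length-++ S)) (≡.sym (↭-length p))))) X≤n))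
      (P-sub S p PX)

AllPairs-++⁻ˡ : ∀ {a r} {A : Set a} {P : A → A → Set r} (S : List A) {T} → AllPairs P (S ++ T) → AllPairs P S
AllPairs-++⁻ˡ []      ps         = []
AllPairs-++⁻ˡ (x ∷ S) (x-X ∷ ps) = All.++⁻ˡ S x-X ∷ AllPairs-++⁻ˡ S ps

AllPairs-++⁻ʳ : ∀ {a r} {A : Set a} {P : A → A → Set r} (S : List A) {T} → AllPairs P (S ++ T) → AllPairs P T
AllPairs-++⁻ʳ []      ps         = ps
AllPairs-++⁻ʳ (x ∷ S) (x-X ∷ ps) = AllPairs-++⁻ʳ S ps

-- The kernel `A`: expansions of its rows and columns, and the product giving ∏ (x + z).

module HallLittlewoodKernel {c ℓ : Level} (R : CommutativeRing c ℓ)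
  (_⁻¹ : CommutativeRing.Carrier R → CommutativeRing.Carrier R)
  (inverseʳ : Alg.FieldInv R _⁻¹) (t : CommutativeRing.Carrier R) where
  open CommutativeRing R
  open import Relation.Binary.Reasoning.Setoid setoid
  open IntegerSolver R using (solve; _:=_; _:+_; _:*_; _:-_; :-_; con)
  open FieldLemmas R _⁻¹ inverseʳ
  open ListSums R
  open ListProducts R

  ≉-sym : ∀ {x y} → x ≉ y → y ≉ x
  ≉-sym x≉y y≈x = x≉y (sym y≈x)

  A : Carrier → Carrier → Carrier
  A x y = (x - t * y) * (x - y) ⁻¹

  open HallAlgebra R A public

  A-cong : ∀ {x x′ y y′} → x ≉ y → x ≈ x′ → y ≈ y′ → A x y ≈ A x′ y′
  A-cong x≉y x≈x′ y≈y′ = *-cong (+-cong x≈x′ (-‿cong (*-congˡ y≈y′)))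
    (⁻¹-cong (a-b≉0 x≉y) (+-cong x≈x′ (-‿cong y≈y′)))

  reciprocal-neg : ∀ {x y} → x ≉ y → (y - x) ⁻¹ ≈ - ((x - y) ⁻¹)
  reciprocal-neg {x} {y} x≉y = sym (⁻¹-unique (a-b≉0 (≉-sym x≉y)) (begin
    (y - x) * - ((x - y) ⁻¹)  ≈⟨ solve 3 (λ x y d → (y :- x) :* :- d := (x :- y) :* d) refl x y ((x - y) ⁻¹) ⟩
    (x - y) * (x - y) ⁻¹      ≈⟨ inverseʳ _ (a-b≉0 x≉y) ⟩
    1#                        ∎))

  private
    module Row    = PartialFractions R _⁻¹ inverseʳ t (λ x → x) (λ _ → 1#) A
    module Column = PartialFractions R _⁻¹ inverseʳ t (λ _ → 1#) (λ x → x) (λ x y → A y x)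

    row-det : ∀ x y → Row.det x y ≈ x - y
    row-det = solve 2 (λ x y → x :* con (+ 1) :- y :* con (+ 1) := x :- y) refl

    column-det : ∀ x y → Column.det x y ≈ y - x
    column-det = solve 2 (λ x y → con (+ 1) :* y :- con (+ 1) :* x := y :- x) refl

    row-separated : ∀ {x y} → x ≉ y → Row.Separated x y
    row-separated x≉y =
      (λ eq → a-b≉0 x≉y (trans (sym (row-det _ _)) eq)) , clear x≉y , clear (≉-sym x≉y)
      where
      clear : ∀ {x y} → x ≉ y → A x y * Row.det x y ≈ x * 1# - t * y * 1#
      clear {x} {y} x≉y = begin
        A x y * Row.det x y    ≈⟨ *-congˡ (row-det x y) ⟩
        A x y * (x - y)        ≈⟨ /-cancelʳ (a-b≉0 x≉y) ⟩
        x - t * y              ≈⟨ solve 3 (λ x t y → x :- t :* y := x :* con (+ 1) :- t :* y :* con (+ 1)) refl x t y ⟩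
        x * 1# - t * y * 1#    ∎

    column-separated : ∀ {x y} → x ≉ y → Column.Separated x y
    column-separated x≉y =
      (λ eq → a-b≉0 (≉-sym x≉y) (trans (sym (column-det _ _)) eq)) , clear x≉y , clear (≉-sym x≉y)
      where
      clear : ∀ {x y} → x ≉ y → A y x * Column.det x y ≈ 1# * y - t * 1# * x
      clear {x} {y} x≉y = begin
        A y x * Column.det x y  ≈⟨ *-congˡ (column-det x y) ⟩
        A y x * (y - x)         ≈⟨ /-cancelʳ (a-b≉0 (≉-sym x≉y)) ⟩
        y - t * x               ≈⟨ solve 3 (λ x t y → y :- t :* x := con (+ 1) :* y :- t :* con (+ 1) :* x) refl x t y ⟩
        1# * y - t * 1# * x     ∎

  row-expansion : ∀ {w X} → All (w ≉_) X → AllPairs _≉_ X →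
    prodOver (A w) X ≈ 1# + (1# - t) * sumPicks X (λ y Y → (prodOver (A y) Y * y) * (w - y) ⁻¹)
  row-expansion {w} {X} w≉X X≉ = begin
    prodOver (A w) X
      ≈⟨ Row.kernelExpansion (All.map row-separated w≉X) (AllPairs.map row-separated X≉) ⟩
    1# + (1# - t) * 1# * sumPicks X (λ y Y → (prodOver (A y) Y * y) * Row.det w y ⁻¹)
      ≈⟨ +-congˡ (*-cong (*-identityʳ _) (sumPicks-cong {X = X} λ y Y p → *-congˡ
           (sym (⁻¹-cong (a-b≉0 (All.head (All-resp-↭ p w≉X))) (sym (row-det w y)))))) ⟩
    1# + (1# - t) * sumPicks X (λ y Y → (prodOver (A y) Y * y) * (w - y) ⁻¹) ∎

  column-expansion : ∀ {w X} → All (w ≉_) X → AllPairs _≉_ X →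
    prodOver (λ x → A x w) X ≈ 1# - (1# - t) * w * sumPicks X (λ y Y → prodOver (λ x → A x y) Y * (w - y) ⁻¹)
  column-expansion {w} {X} w≉X X≉ = begin
    prodOver (λ x → A x w) X
      ≈⟨ Column.kernelExpansion (All.map column-separated w≉X) (AllPairs.map column-separated X≉) ⟩
    1# + (1# - t) * w * sumPicks X (λ y Y → (prodOver (λ x → A x y) Y * 1#) * Column.det w y ⁻¹)
      ≈⟨ +-congˡ (*-congˡ (sumPicks-cong {X = X} λ y Y p → termwise y Y (All.head (All-resp-↭ p w≉X)))) ⟩
    1# + (1# - t) * w * sumPicks X (λ y Y → - 1# * (prodOver (λ x → A x y) Y * (w - y) ⁻¹))
      ≈⟨ +-congˡ (*-congˡ (sumPicks-*ˡ X (- 1#))) ⟩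
    1# + (1# - t) * w * (- 1# * Σ)
      ≈⟨ solve 3 (λ t w S → con (+ 1) :+ (con (+ 1) :- t) :* w :* (:- con (+ 1) :* S)
           := con (+ 1) :- (con (+ 1) :- t) :* w :* S) refl t w Σ ⟩
    1# - (1# - t) * w * Σ ∎
    where
    Σ : Carrier
    Σ = sumPicks X (λ y Y → prodOver (λ x → A x y) Y * (w - y) ⁻¹)

    termwise : ∀ y Y → w ≉ y → (prodOver (λ x → A x y) Y * 1#) * Column.det w y ⁻¹ ≈ - 1# * (prodOver (λ x → A x y) Y * (w - y) ⁻¹)
    termwise y Y w≉y = trans
      (*-congˡ (trans (sym (⁻¹-cong (a-b≉0 (≉-sym w≉y)) (sym (column-det w y)))) (reciprocal-neg w≉y)))
      (solve 2 (λ P d → (P :* con (+ 1)) :* :- d := :- con (+ 1) :* (P :* d)) refl (prodOver (λ x → A x y) Y) ((w - y) ⁻¹))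

  -- The classical evaluation of Σ ∏ (x_i - t x_j)/(x_i - x_j) as the t-integer (1 - t^n)/(1 - t).
  -- It supplies the factors of v_λ and the constant term in `signedSum-step`.
  row-sum : ∀ {X} → All (_≉ 0#) X → AllPairs _≉_ X →
    (1# - t) * sumPicks X (λ y Y → prodOver (A y) Y) ≈ 1# - prodOver (λ _ → t) X
  row-sum X≉0 X≉ = Row.sumPicks-prod X≉0 (AllPairs.map row-separated X≉)

  column-sum : 1# ≉ 0# → ∀ {X} → AllPairs _≉_ X →
    (1# - t) * sumPicks X (λ y Y → prodOver (λ x → A x y) Y) ≈ 1# - prodOver (λ _ → t) X
  column-sum 1≉0 {X} X≉ = Column.sumPicks-prod (All.universal (λ _ → 1≉0) X) (AllPairs.map column-separated X≉)

  -- The degree-k part in S is the identity P_(1^k) = e_k.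
  elementary : ∀ z {X} → AllPairs _≉_ X →
    (prodOver (λ x → x) ⊛ prodOver (λ _ → z)) X ≈ prodOver (λ x → x + z) X
  elementary z [] = solve 0 (con (+ 1) :* (con (+ 1) :* con (+ 1)) := con (+ 1)) refl
  elementary z {u ∷ X} (u≉X ∷ X≉) = begin
    sumSplits X (λ S T → (prodOver (A u) T * cross A S T) * ((u * M S) * Z T)) + sumSplits X (λ S T → cross A S (u ∷ T) * (M S * (z * Z T)))
      ≈⟨ sumSplits-+ X ⟨
    sumSplits X (λ S T → (prodOver (A u) T * cross A S T) * ((u * M S) * Z T) + cross A S (u ∷ T) * (M S * (z * Z T)))
      ≈⟨ sumSplits-cong {X = X} expand ⟩
    sumSplits X (λ S T → (u + z) * (cross A S T * (M S * Z T)) + (1# - t) * u * (residueʳ S T + - 1# * residueˡ S T))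
      ≈⟨ trans (sumSplits-+ X) (+-cong (sumSplits-*ˡ X _) (sumSplits-*ˡ X _)) ⟩
    (u + z) * (M ⊛ Z) X + (1# - t) * u * sumSplits X (λ S T → residueʳ S T + - 1# * residueˡ S T)
      ≈⟨ +-cong (*-congˡ (elementary z X≉)) (*-congˡ residues-cancel) ⟩
    (u + z) * prodOver (λ x → x + z) X + (1# - t) * u * 0#
      ≈⟨ trans (+-congˡ (zeroʳ _)) (+-identityʳ _) ⟩
    (u + z) * prodOver (λ x → x + z) X ∎
    where
    M Z : List Carrier → Carrier
    M = prodOver (λ x → x)
    Z = prodOver (λ _ → z)

    -- The contribution of the pole u = y after `y` has been taken out of the list. It does not
    -- record which half `y` came from, so the two origins differ only by a sign and cancel.
    θ : Carrier → List Carrier → List Carrier → Carrier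
    θ y S T = (prodOver (λ x → A x y) S * cross A S T * prodOver (A y) T) * (M S * y * z * Z T) * (u - y) ⁻¹

    residueˡ residueʳ : List Carrier → List Carrier → Carrier
    residueˡ S T = sumPicks S (λ y S′ → θ y S′ T)
    residueʳ S T = sumPicks T (λ y T′ → θ y S T′)

    residues-cancel : sumSplits X (λ S T → residueʳ S T + - 1# * residueˡ S T) ≈ 0#
    residues-cancel = begin
      sumSplits X (λ S T → residueʳ S T + - 1# * residueˡ S T)
        ≈⟨ trans (sumSplits-+ X) (+-congˡ (sumSplits-*ˡ X _)) ⟩
      sumSplits X residueʳ + - 1# * sumSplits X residueˡ
        ≈⟨ +-cong (sym (sumPicks-splitsʳ X θ)) (*-congˡ (sym (sumPicks-splitsˡ X θ))) ⟩
      Θ + - 1# * Θ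
        ≈⟨ solve 1 (λ a → a :+ :- con (+ 1) :* a := con (+ 0)) refl Θ ⟩
      0# ∎
      where
      Θ : Carrier
      Θ = sumPicks X (λ y Y → sumSplits Y (θ y))

    expand : ∀ S T → X ↭ S ++ T →
      (prodOver (A u) T * cross A S T) * ((u * M S) * Z T) + cross A S (u ∷ T) * (M S * (z * Z T))
      ≈ (u + z) * (cross A S T * (M S * Z T)) + (1# - t) * u * (residueʳ S T + - 1# * residueˡ S T)
    expand S T X↭ = begin
      (prodOver (A u) T * cross A S T) * ((u * M S) * Z T) + cross A S (u ∷ T) * (M S * (z * Z T))
        -- With `u` in the left half its kernel factors form a row over `T`, with `u` in the right
        -- half a column over `S`. The constant terms of the two expansions add up to the factor u +
        -- z.
        ≈⟨ +-cong (*-congʳ (*-congʳ (row-expansion u≉T T≉)))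
             (*-congʳ (trans (cross-∷ʳ A S u T) (*-congʳ (column-expansion u≉S S≉)))) ⟩
      ((1# + (1# - t) * ΣT) * cross A S T) * ((u * M S) * Z T) + ((1# - (1# - t) * u * ΣS) * cross A S T) * (M S * (z * Z T))
        ≈⟨ solve 8 (λ t u z a m ζ ΣT ΣS →
             ((con (+ 1) :+ (con (+ 1) :- t) :* ΣT) :* a) :* ((u :* m) :* ζ) :+ ((con (+ 1) :- (con (+ 1) :- t) :* u :* ΣS) :* a) :* (m :* (z :* ζ))
             := (u :+ z) :* (a :* (m :* ζ)) :+ (con (+ 1) :- t) :* u :* ((a :* m :* ζ) :* ΣT :+ :- con (+ 1) :* ((a :* m :* z :* ζ) :* ΣS)))
             refl t u z (cross A S T) (M S) (Z T) ΣT ΣS ⟩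
      (u + z) * (cross A S T * (M S * Z T)) + (1# - t) * u * ((cross A S T * M S * Z T) * ΣT + - 1# * ((cross A S T * M S * z * Z T) * ΣS))
        ≈⟨ +-congˡ (*-congˡ (+-cong (trans (sym (sumPicks-*ˡ T _)) (sumPicks-cong {X = T} into-T))
             (*-congˡ (trans (sym (sumPicks-*ˡ S _)) (sumPicks-cong {X = S} into-S))))) ⟩
      (u + z) * (cross A S T * (M S * Z T)) + (1# - t) * u * (residueʳ S T + - 1# * residueˡ S T) ∎
      where
      u≉S = All.++⁻ˡ S (All-resp-↭ X↭ u≉X)
      u≉T = All.++⁻ʳ S (All-resp-↭ X↭ u≉X)
      S≉  = AllPairs-++⁻ˡ S (AllPairs-resp-↭ ≉-sym X↭ X≉)
      T≉  = AllPairs-++⁻ʳ S (AllPairs-resp-↭ ≉-sym X↭ X≉)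

      ΣT ΣS : Carrier
      ΣT = sumPicks T (λ y Y → (prodOver (A y) Y * y) * (u - y) ⁻¹)
      ΣS = sumPicks S (λ y Y → prodOver (λ x → A x y) Y * (u - y) ⁻¹)

      into-T : ∀ y T′ → T ↭ y ∷ T′ → (cross A S T * M S * Z T) * ((prodOver (A y) T′ * y) * (u - y) ⁻¹) ≈ θ y S T′
      into-T y T′ p = begin
        (cross A S T * M S * Z T) * ((prodOver (A y) T′ * y) * (u - y) ⁻¹)
          ≈⟨ *-congʳ (*-cong (*-congʳ (trans (cross-splitsʳ A (y ∷ []) T′ S p) (*-congʳ single))) (prodOver-↭ (λ _ → z) p)) ⟩
        ((prodOver (λ x → A x y) S * cross A S T′) * M S * (z * Z T′)) * ((prodOver (A y) T′ * y) * (u - y) ⁻¹)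
          ≈⟨ solve 8 (λ Ay a m z ζ r y d → ((Ay :* a) :* m :* (z :* ζ)) :* ((r :* y) :* d) := (Ay :* a :* r) :* (m :* y :* z :* ζ) :* d) refl
               (prodOver (λ x → A x y) S) (cross A S T′) (M S) z (Z T′) (prodOver (A y) T′) y ((u - y) ⁻¹) ⟩
        θ y S T′ ∎
        where
        single : cross A S (y ∷ []) ≈ prodOver (λ x → A x y) S
        single = prodOver-cong (All.universal (λ x → *-identityʳ (A x y)) S)

      into-S : ∀ y S′ → S ↭ y ∷ S′ → (cross A S T * M S * z * Z T) * (prodOver (λ x → A x y) S′ * (u - y) ⁻¹) ≈ θ y S′ T
      into-S y S′ p = begin
        (cross A S T * M S * z * Z T) * (prodOver (λ x → A x y) S′ * (u - y) ⁻¹)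
          ≈⟨ *-congʳ (*-congʳ (*-congʳ (*-cong (prodOver-↭ (λ x → prodOver (A x) T) p) (prodOver-↭ (λ x → x) p)))) ⟩
        ((prodOver (A y) T * cross A S′ T) * (y * M S′) * z * Z T) * (prodOver (λ x → A x y) S′ * (u - y) ⁻¹)
          ≈⟨ solve 8 (λ Ay a m z ζ r y d → ((r :* a) :* (y :* m) :* z :* ζ) :* (Ay :* d) := (Ay :* a :* r) :* (m :* y :* z :* ζ) :* d) refl
               (prodOver (λ x → A x y) S′) (cross A S′ T) (M S′) z (Z T) (prodOver (A y) T) y ((u - y) ⁻¹) ⟩
        θ y S′ T ∎

-- Weighted sums over sign changes of the variables.

module SignedSums {c ℓ : Level} (R : CommutativeRing c ℓ)
  (_⁻¹ : CommutativeRing.Carrier R → CommutativeRing.Carrier R)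
  (inverseʳ : Alg.FieldInv R _⁻¹) (t : CommutativeRing.Carrier R) where
  open CommutativeRing R
  open import Relation.Binary.Reasoning.Setoid setoid
  open import Algebra.Properties.CommutativeSemigroup (CommutativeRing.+-commutativeSemigroup R)
    using () renaming (interchange to +-interchange)
  open IntegerSolver R using (solve; _:=_; _:+_; _:*_; _:-_; :-_; con)
  open FieldLemmas R _⁻¹ inverseʳ
  open ListSums R
  open ListProducts R
  open HallLittlewoodKernel R _⁻¹ inverseʳ t

  Generic : Carrier → Set ℓ
  Generic x = (x ≉ 0#) × (x ≉ 1#)

  Distinct : Carrier → Carrier → Set ℓ
  Distinct x y = (x ≉ y) × (x * y ≉ 1#)

  -- Keeps x, 1 - x, x - y and 1 - x y away from zero, and is stable under reordering, passing to
  -- halves, and inverting entries.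
  Regular : List Carrier → Set _
  Regular X = All Generic X × AllPairs Distinct X

  distinct-sym : ∀ {x y} → Distinct x y → Distinct y x
  distinct-sym (x≉y , xy≉1) = ≉-sym x≉y , λ yx≈1 → xy≉1 (trans (*-comm _ _) yx≈1)

  generic-inverse : ∀ {x} → Generic x → Generic (x ⁻¹)
  generic-inverse {x} (x≉0 , x≉1) = ⁻¹-nonzero x≉0 , λ x⁻¹≈1 →
    x≉1 (trans (sym (*-identityʳ x)) (trans (*-congˡ (sym x⁻¹≈1)) (inverseʳ x x≉0)))

  distinct-inverse : ∀ {x y} → Generic x → Distinct x y → Distinct (x ⁻¹) y
  distinct-inverse {x} {y} (x≉0 , _) (x≉y , xy≉1) =
    (λ x⁻¹≈y → xy≉1 (trans (*-congˡ (sym x⁻¹≈y)) (inverseʳ x x≉0))) ,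
    (λ x⁻¹y≈1 → x≉y (sym (*-cancelˡ-nonzero (⁻¹-nonzero x≉0) (trans x⁻¹y≈1 (trans (sym (inverseʳ x x≉0)) (*-comm _ _))))))

  distinct-inverseʳ : ∀ {x y} → Generic y → Distinct x y → Distinct x (y ⁻¹)
  distinct-inverseʳ gy d = distinct-sym (distinct-inverse gy (distinct-sym d))

  regular-↭ : ∀ {X Y} → X ↭ Y → Regular X → Regular Y
  regular-↭ p (gX , dX) = All-resp-↭ p gX , AllPairs-resp-↭ distinct-sym p dX

  regular-splitˡ : ∀ {X} S {T} → X ↭ S ++ T → Regular X → Regular S
  regular-splitˡ S p X-reg with regular-↭ p X-reg
  ... | g , d = All.++⁻ˡ S g , AllPairs-++⁻ˡ S d

  regular-splitʳ : ∀ {X} S {T} → X ↭ S ++ T → Regular X → Regular T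
  regular-splitʳ S p X-reg with regular-↭ p X-reg
  ... | g , d = All.++⁻ʳ S g , AllPairs-++⁻ʳ S d

  regular-tail : ∀ {x X} → Regular (x ∷ X) → Regular X
  regular-tail (_ ∷ g , _ ∷ d) = g , d

  regular-≉ : ∀ {X} → Regular X → AllPairs _≉_ X
  regular-≉ (_ , d) = AllPairs.map proj₁ d

  -- A witness that the second list arises by inverting entries of the first. Through it the terms
  -- of a sum over signs are known to be regular.
  data Signed : List Carrier → List Carrier → Set c where
    []   : Signed [] []
    keep : ∀ {x X Z} → Signed X Z → Signed (x ∷ X) (x ∷ Z)
    flip : ∀ {x X Z} → Signed X Z → Signed (x ∷ X) (x ⁻¹ ∷ Z)

  distinct-signed : ∀ {x X Z} → Signed X Z → All Generic X → All (Distinct x) X → All (Distinct x) Z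
  distinct-signed []       g        d        = []
  distinct-signed (keep s) (_ ∷ g)  (dx ∷ d) = dx ∷ distinct-signed s g d
  distinct-signed (flip s) (gx ∷ g) (dx ∷ d) = distinct-inverseʳ gx dx ∷ distinct-signed s g d

  regular-signed : ∀ {X Z} → Signed X Z → Regular X → Regular Z
  regular-signed []       reg                  = reg
  regular-signed (keep s) (gx ∷ g , dx ∷ d) with regular-signed s (g , d)
  ... | g′ , d′ = gx ∷ g′ , distinct-signed s g dx ∷ d′
  regular-signed (flip s) (gx ∷ g , dx ∷ d) with regular-signed s (g , d)
  ... | g′ , d′ = generic-inverse gx ∷ g′ , All.map (distinct-inverse gx) (distinct-signed s g dx) ∷ d′

  signed-constant : ∀ {X Z} k → Signed X Z → prodOver (λ _ → k) Z ≡ prodOver (λ _ → k) X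
  signed-constant k []       = ≡.refl
  signed-constant k (keep s) = ≡.cong (k *_) (signed-constant k s)
  signed-constant k (flip s) = ≡.cong (k *_) (signed-constant k s)

  sumSigns : (w₀ w₁ : Carrier → Carrier) → List Carrier → (List Carrier → Carrier) → Carrier
  sumSigns w₀ w₁ []      φ = φ []
  sumSigns w₀ w₁ (x ∷ X) φ = w₀ x * sumSigns w₀ w₁ X (λ Z → φ (x ∷ Z)) + w₁ x * sumSigns w₀ w₁ X (λ Z → φ (x ⁻¹ ∷ Z))

  sumSigns-cong : ∀ {w₀ w₁ X φ ψ} → (∀ Z → Signed X Z → φ Z ≈ ψ Z) → sumSigns w₀ w₁ X φ ≈ sumSigns w₀ w₁ X ψ
  sumSigns-cong {X = []}    h = h [] []
  sumSigns-cong {X = x ∷ X} h = +-cong (*-congˡ (sumSigns-cong λ Z s → h _ (keep s))) (*-congˡ (sumSigns-cong λ Z s → h _ (flip s)))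

  sumSigns-+ : ∀ {w₀ w₁} X {φ ψ} → sumSigns w₀ w₁ X (λ Z → φ Z + ψ Z) ≈ sumSigns w₀ w₁ X φ + sumSigns w₀ w₁ X ψ
  sumSigns-+ []      = refl
  sumSigns-+ (x ∷ X) = trans
    (+-cong (trans (*-congˡ (sumSigns-+ X)) (distribˡ _ _ _)) (trans (*-congˡ (sumSigns-+ X)) (distribˡ _ _ _)))
    (+-interchange _ _ _ _)

  sumSigns-*ˡ : ∀ {w₀ w₁} X {φ} k → sumSigns w₀ w₁ X (λ Z → k * φ Z) ≈ k * sumSigns w₀ w₁ X φ
  sumSigns-*ˡ []      k = refl
  sumSigns-*ˡ {w₀} {w₁} (x ∷ X) k = trans
    (+-cong (*-congˡ (sumSigns-*ˡ X k)) (*-congˡ (sumSigns-*ˡ X k)))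
    (solve 5 (λ w v k a b → w :* (k :* a) :+ v :* (k :* b) := k :* (w :* a :+ v :* b)) refl (w₀ x) (w₁ x) k _ _)

  sumSigns-0 : ∀ {w₀ w₁} X → sumSigns w₀ w₁ X (λ _ → 0#) ≈ 0#
  sumSigns-0 []      = refl
  sumSigns-0 (x ∷ X) = trans (+-cong (trans (*-congˡ (sumSigns-0 X)) (zeroʳ _)) (trans (*-congˡ (sumSigns-0 X)) (zeroʳ _))) (+-identityˡ 0#)

  -- A factor that is multiplicative over the entries moves into the weights and changes them.
  -- Inductions that use this must therefore allow arbitrary weights.
  sumSigns-absorb : ∀ {w₀ w₁} (g : Carrier → Carrier) X {φ} →
    sumSigns w₀ w₁ X (λ Z → prodOver g Z * φ Z) ≈ sumSigns (λ x → w₀ x * g x) (λ x → w₁ x * g (x ⁻¹)) X φ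
  sumSigns-absorb g []      = *-identityˡ _
  sumSigns-absorb {w₀} {w₁} g (x ∷ X) {φ} = +-cong (pull x (w₀ x)) (pull (x ⁻¹) (w₁ x))
    where
    pull : ∀ y w → w * sumSigns w₀ w₁ X (λ Z → (g y * prodOver g Z) * φ (y ∷ Z))
                 ≈ (w * g y) * sumSigns (λ x → w₀ x * g x) (λ x → w₁ x * g (x ⁻¹)) X (λ Z → φ (y ∷ Z))
    pull y w = trans
      (*-congˡ (trans (sumSigns-cong {X = X} (λ Z _ → *-assoc _ _ _)) (trans (sumSigns-*ˡ X (g y)) (*-congˡ (sumSigns-absorb g X)))))
      (sym (*-assoc _ _ _))

  -- Brings the contributions of x and x⁻¹ side by side, which is where poles cancel. It also lets
  -- sums over signs and over permutations be interchanged.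
  sumSigns-picks : ∀ {w₀ w₁} X (φ : Carrier → List Carrier → Carrier) →
    sumSigns w₀ w₁ X (λ Z → sumPicks Z φ) ≈
    sumPicks X (λ x Y → w₀ x * sumSigns w₀ w₁ Y (φ x) + w₁ x * sumSigns w₀ w₁ Y (φ (x ⁻¹)))
  sumSigns-picks []      φ = refl
  sumSigns-picks {w₀} {w₁} (x ∷ X) φ = begin
    w₀ x * sumSigns w₀ w₁ X (λ Z → φ x Z + sumPicks Z (λ y Y → φ y (x ∷ Y)))
      + w₁ x * sumSigns w₀ w₁ X (λ Z → φ (x ⁻¹) Z + sumPicks Z (λ y Y → φ y (x ⁻¹ ∷ Y)))
      ≈⟨ +-cong (branch x (w₀ x)) (branch (x ⁻¹) (w₁ x)) ⟩
    (w₀ x * sumSigns w₀ w₁ X (φ x) + sumPicks X (λ y Y → w₀ x * inner x y Y))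
      + (w₁ x * sumSigns w₀ w₁ X (φ (x ⁻¹)) + sumPicks X (λ y Y → w₁ x * inner (x ⁻¹) y Y))
      ≈⟨ +-interchange _ _ _ _ ⟩
    (w₀ x * sumSigns w₀ w₁ X (φ x) + w₁ x * sumSigns w₀ w₁ X (φ (x ⁻¹)))
      + (sumPicks X (λ y Y → w₀ x * inner x y Y) + sumPicks X (λ y Y → w₁ x * inner (x ⁻¹) y Y))
      ≈⟨ +-congˡ (trans (sym (sumPicks-+ X)) (sumPicks-cong {X = X} λ y Y _ →
           solve 8 (λ a b v w A B C D → a :* (v :* A :+ w :* B) :+ b :* (v :* C :+ w :* D) := v :* (a :* A :+ b :* C) :+ w :* (a :* B :+ b :* D))
             refl (w₀ x) (w₁ x) (w₀ y) (w₁ y) _ _ _ _)) ⟩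
    _ ∎
    where
    inner : Carrier → Carrier → List Carrier → Carrier
    inner z y Y = w₀ y * sumSigns w₀ w₁ Y (λ Z → φ y (z ∷ Z)) + w₁ y * sumSigns w₀ w₁ Y (λ Z → φ (y ⁻¹) (z ∷ Z))

    branch : ∀ z w → w * sumSigns w₀ w₁ X (λ Z → φ z Z + sumPicks Z (λ y Y → φ y (z ∷ Y)))
                   ≈ w * sumSigns w₀ w₁ X (φ z) + sumPicks X (λ y Y → w * inner z y Y)
    branch z w = begin
      w * sumSigns w₀ w₁ X (λ Z → φ z Z + sumPicks Z (λ y Y → φ y (z ∷ Y)))
        ≈⟨ *-congˡ (trans (sumSigns-+ X) (+-congˡ (sumSigns-picks X (λ y Y → φ y (z ∷ Y))))) ⟩
      w * (sumSigns w₀ w₁ X (φ z) + sumPicks X (inner z))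
        ≈⟨ distribˡ _ _ _ ⟩
      w * sumSigns w₀ w₁ X (φ z) + w * sumPicks X (inner z)
        ≈⟨ +-congˡ (sym (sumPicks-*ˡ X w)) ⟩
      w * sumSigns w₀ w₁ X (φ z) + sumPicks X (λ y Y → w * inner z y Y) ∎

  -- B x y = (1 - t x y) / (1 - x y), in a form that makes B x the row of A through the pole x⁻¹.
  B : Carrier → Carrier → Carrier
  B x y = A (x ⁻¹) y

  Ψ Ψ̄ : List Carrier → Carrier
  Ψ   = pairProd B
  Ψ̄ S = Ψ (map _⁻¹ S)

  A-inverses : ∀ {x y} → x ≉ 0# → y ≉ 0# → x ≉ y → A (x ⁻¹) (y ⁻¹) ≈ A y x
  A-inverses {x} {y} x≉0 y≉0 x≉y = /-≈ (a-b≉0 x⁻¹≉y⁻¹) (a-b≉0 (≉-sym x≉y)) (begin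
    (x ⁻¹ - t * y ⁻¹) * (y - x)
      ≈⟨ solve 5 (λ x y x′ y′ t → (x′ :- t :* y′) :* (y :- x) := x′ :* y :+ t :* y′ :* x :- (x :* x′) :- t :* (y :* y′)) refl x y (x ⁻¹) (y ⁻¹) t ⟩
    x ⁻¹ * y + t * y ⁻¹ * x - (x * x ⁻¹) - t * (y * y ⁻¹)
      ≈⟨ +-cong (+-congˡ (-‿cong x≡y)) (-‿cong (*-congˡ (sym x≡y))) ⟩
    x ⁻¹ * y + t * y ⁻¹ * x - (y * y ⁻¹) - t * (x * x ⁻¹)
      ≈⟨ solve 5 (λ x y x′ y′ t → (y :- t :* x) :* (x′ :- y′) := x′ :* y :+ t :* y′ :* x :- (y :* y′) :- t :* (x :* x′)) refl x y (x ⁻¹) (y ⁻¹) t ⟨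
    (y - t * x) * (x ⁻¹ - y ⁻¹) ∎)
    where
    x≡y : x * x ⁻¹ ≈ y * y ⁻¹
    x≡y = trans (inverseʳ x x≉0) (sym (inverseʳ y y≉0))

    x⁻¹≉y⁻¹ : x ⁻¹ ≉ y ⁻¹
    x⁻¹≉y⁻¹ eq = x≉y (trans (sym (⁻¹-involutive x≉0)) (trans (⁻¹-cong (⁻¹-nonzero x≉0) eq) (⁻¹-involutive y≉0)))

  B-sym : ∀ {x y} → Generic x → Generic y → Distinct x y → B x y ≈ B y x
  B-sym {x} {y} gx gy d = trans
    (A-cong (proj₁ (distinct-inverse gx d)) refl (sym (⁻¹-involutive (proj₁ gy))))
    (A-inverses (proj₁ gx) (proj₁ (generic-inverse gy)) (proj₁ (distinct-inverseʳ gy d)))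

  A-⁻¹⁻¹ : ∀ {x X} → x ≉ 0# → All (x ≉_) X → prodOver (A ((x ⁻¹) ⁻¹)) X ≈ prodOver (A x) X
  A-⁻¹⁻¹ x≉0 x≉X = prodOver-cong (All.map (λ x≉y → sym (A-cong x≉y (sym (⁻¹-involutive x≉0)) refl)) x≉X)

  regular-B-sym : ∀ {X} → Regular X → AllPairs (λ x y → B x y ≈ B y x) X
  regular-B-sym ([] , [])              = []
  regular-B-sym (gx ∷ g , dx ∷ d) = All.zipWith (λ (gy , dy) → B-sym gx gy dy) (g , dx) ∷ regular-B-sym (g , d)

  Ψ-pick : ∀ {X y Y} → Regular X → X ↭ y ∷ Y → Ψ X ≈ prodOver (B y) Y * Ψ Y
  Ψ-pick X-reg p = pairProd-↭ B (regular-B-sym X-reg) p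

  signedSum : (w₀ w₁ : Carrier → Carrier) → List Carrier → Carrier
  signedSum w₀ w₁ X = sumSigns w₀ w₁ X Ψ

  -- The left half collects the inverted variables, the right half the others. A mixed pair
  -- contributes `B (s ⁻¹) y`, which is `A s y`, and pairs inside one half make up `Ψ̄` or `Ψ`. The
  -- induction absorbs the factors of the head into the weights.
  signedSum-splits : ∀ w₀ w₁ {X} → Regular X → signedSum w₀ w₁ X ≈ (twist w₁ Ψ̄ ⊛ twist w₀ Ψ) X
  signedSum-splits w₀ w₁ {[]}    reg = solve 0 (con (+ 1) := con (+ 1) :* ((con (+ 1) :* con (+ 1)) :* (con (+ 1) :* con (+ 1)))) refl
  signedSum-splits w₀ w₁ {x ∷ X} reg@(gx ∷ gX , dx ∷ dX) = begin
    w₀ x * sumSigns w₀ w₁ X (λ Z → prodOver (B x) Z * Ψ Z) + w₁ x * sumSigns w₀ w₁ X (λ Z → prodOver (B (x ⁻¹)) Z * Ψ Z)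
      ≈⟨ +-cong (branch x (w₀ x)) (branch (x ⁻¹) (w₁ x)) ⟩
    sumSplits X (summand x (w₀ x)) + sumSplits X (summand (x ⁻¹) (w₁ x))
      ≈⟨ +-comm _ _ ⟩
    sumSplits X (summand (x ⁻¹) (w₁ x)) + sumSplits X (summand x (w₀ x))
      ≈⟨ +-cong (sumSplits-cong {X = X} inverted) (sumSplits-cong {X = X} kept) ⟩
    (twist w₁ Ψ̄ ⊛ twist w₀ Ψ) (x ∷ X) ∎
    where
    summand : Carrier → Carrier → List Carrier → List Carrier → Carrier
    summand y w S T = w * (cross A S T * (((prodOver w₁ S * prodOver (λ s → B y (s ⁻¹)) S) * Ψ̄ S) * ((prodOver w₀ T * prodOver (B y) T) * Ψ T)))

    branch : ∀ y w → w * sumSigns w₀ w₁ X (λ Z → prodOver (B y) Z * Ψ Z) ≈ sumSplits X (summand y w)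
    branch y w = begin
      w * sumSigns w₀ w₁ X (λ Z → prodOver (B y) Z * Ψ Z)
        ≈⟨ *-congˡ (trans (sumSigns-absorb (B y) X) (signedSum-splits _ _ (gX , dX))) ⟩
      w * (twist (λ s → w₁ s * B y (s ⁻¹)) Ψ̄ ⊛ twist (λ s → w₀ s * B y s) Ψ) X
        ≈⟨ sumSplits-*ˡ X w ⟨
      _
        ≈⟨ sumSplits-cong {X = X} (λ S T _ → *-congˡ (*-congˡ (*-cong (*-congʳ (prodOver-* w₁ _ S)) (*-congʳ (prodOver-* w₀ _ T))))) ⟩
      sumSplits X (summand y w) ∎

    inverted : ∀ S T → X ↭ S ++ T → summand (x ⁻¹) (w₁ x) S T ≈
      (prodOver (A x) T * cross A S T) * (((w₁ x * prodOver w₁ S) * (prodOver (B (x ⁻¹)) (map _⁻¹ S) * Ψ̄ S)) * (prodOver w₀ T * Ψ T))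
    inverted S T p = trans
      (solve 8 (λ w a m b ψ̄ n β ψ → w :* (a :* (((m :* b) :* ψ̄) :* ((n :* β) :* ψ))) := (β :* a) :* (((w :* m) :* (b :* ψ̄)) :* (n :* ψ)))
        refl (w₁ x) (cross A S T) (prodOver w₁ S) _ (Ψ̄ S) (prodOver w₀ T) (prodOver (B (x ⁻¹)) T) (Ψ T))
      (*-cong (*-congʳ (A-⁻¹⁻¹ (proj₁ gx) (All.map proj₁ (All.++⁻ʳ S (All-resp-↭ p dx)))))
        (*-congʳ (*-congˡ (*-congʳ (sym (prodOver-map (B (x ⁻¹)) _⁻¹ S))))))

    kept : ∀ S T → X ↭ S ++ T → summand x (w₀ x) S T ≈
      cross A S (x ∷ T) * ((prodOver w₁ S * Ψ̄ S) * ((w₀ x * prodOver w₀ T) * (prodOver (B x) T * Ψ T)))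
    kept S T p = trans
      (solve 8 (λ w a m b ψ̄ n β ψ → w :* (a :* (((m :* b) :* ψ̄) :* ((n :* β) :* ψ))) := (b :* a) :* ((m :* ψ̄) :* ((w :* n) :* (β :* ψ))))
        refl (w₀ x) (cross A S T) (prodOver w₁ S) _ (Ψ̄ S) (prodOver w₀ T) (prodOver (B x) T) (Ψ T))
      (*-congʳ (trans (*-congʳ (prodOver-cong (All.zipWith (λ (gs , ds) → A-inverses (proj₁ gx) (proj₁ gs) (proj₁ ds))
          (All.++⁻ˡ S (All-resp-↭ p gX) , All.++⁻ˡ S (All-resp-↭ p dx)))))
        (sym (cross-∷ʳ A S x T))))

  -- The coefficient of the pole at y, summed over the sign of u, without the factor 1 - t and the
  -- kernel products common to both signs.
  κ : (w₀ w₁ : Carrier → Carrier) → Carrier → Carrier → Carrier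
  κ w₀ w₁ u y = w₀ u * (y * (u ⁻¹ - y) ⁻¹) + w₁ u * (y * (u - y) ⁻¹)

  -- The factors involving u are expanded in partial fractions; by the hypothesis the contributions
  -- of the poles at x and x⁻¹ cancel in pairs.
  signedSum-step : ∀ {w₀ w₁ u X} k → Regular (u ∷ X) →
    (∀ {x} → Generic x → Distinct u x → w₀ x * κ w₀ w₁ u x + w₁ x * κ w₀ w₁ u (x ⁻¹) ≈ k * (w₀ x + w₁ x)) →
    signedSum w₀ w₁ (u ∷ X) ≈ (w₀ u + w₁ u + (1# - prodOver (λ _ → t) X) * k) * signedSum w₀ w₁ X
  signedSum-step {w₀} {w₁} {u} {X} k reg@(gu ∷ gX , du ∷ dX) balanced = begin
    w₀ u * sumSigns w₀ w₁ X (λ Z → prodOver (B u) Z * Ψ Z) + w₁ u * sumSigns w₀ w₁ X (λ Z → prodOver (B (u ⁻¹)) Z * Ψ Z)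
      ≈⟨ +-cong (sumSigns-*ˡ X _) (sumSigns-*ˡ X _) ⟨
    sumSigns w₀ w₁ X (λ Z → w₀ u * (prodOver (B u) Z * Ψ Z)) + sumSigns w₀ w₁ X (λ Z → w₁ u * (prodOver (B (u ⁻¹)) Z * Ψ Z))
      ≈⟨ sumSigns-+ X ⟨
    sumSigns w₀ w₁ X (λ Z → w₀ u * (prodOver (B u) Z * Ψ Z) + w₁ u * (prodOver (B (u ⁻¹)) Z * Ψ Z))
      ≈⟨ sumSigns-cong {X = X} (λ Z s → expand Z s) ⟩
    sumSigns w₀ w₁ X (λ Z → C * Ψ Z + (1# - t) * sumPicks Z ρ)
      ≈⟨ trans (sumSigns-+ X) (+-cong (sumSigns-*ˡ X C) (sumSigns-*ˡ X _)) ⟩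
    C * signedSum w₀ w₁ X + (1# - t) * sumSigns w₀ w₁ X (λ Z → sumPicks Z ρ)
      ≈⟨ +-congˡ (*-congˡ (trans (sumSigns-picks X ρ) (sumPicks-cong {X = X} residues-cancel))) ⟩
    C * signedSum w₀ w₁ X + (1# - t) * sumPicks X (λ _ _ → 0# * 0#)
      ≈⟨ +-congˡ (*-congˡ (trans (sumPicks-*ˡ X 0#) (zeroˡ _))) ⟩
    C * signedSum w₀ w₁ X + (1# - t) * 0#
      ≈⟨ trans (+-congˡ (zeroʳ _)) (+-identityʳ _) ⟩
    C * signedSum w₀ w₁ X ∎
    where
    C : Carrier
    C = w₀ u + w₁ u + (1# - prodOver (λ _ → t) X) * k

    -- Subtracting `k` from the coefficient of every pole is compensated by `k` times the sum of all
    -- `prodOver (A y) Y`. By `row-sum` this adds the term with 1 - t^|X| to `C`.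
    ρ : Carrier → List Carrier → Carrier
    ρ y Y = (Ψ Y * (prodOver (A y) Y * prodOver (B y) Y)) * (κ w₀ w₁ u y - k)

    expand : ∀ Z → Signed X Z →
      w₀ u * (prodOver (B u) Z * Ψ Z) + w₁ u * (prodOver (B (u ⁻¹)) Z * Ψ Z) ≈ C * Ψ Z + (1# - t) * sumPicks Z ρ
    expand Z s = begin
      w₀ u * (prodOver (B u) Z * Ψ Z) + w₁ u * (prodOver (B (u ⁻¹)) Z * Ψ Z)
        ≈⟨ +-cong (*-congˡ (*-congʳ (row-expansion (All.map (λ d → proj₁ (distinct-inverse gu d)) duZ) (regular-≉ Z-reg))))
             (*-congˡ (*-congʳ (trans (A-⁻¹⁻¹ (proj₁ gu) (All.map proj₁ duZ)) (row-expansion (All.map proj₁ duZ) (regular-≉ Z-reg))))) ⟩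
      w₀ u * ((1# + (1# - t) * Σ₀) * Ψ Z) + w₁ u * ((1# + (1# - t) * Σ₁) * Ψ Z)
        ≈⟨ solve 8 (λ w v t a b ψ s k → w :* ((con (+ 1) :+ (con (+ 1) :- t) :* a) :* ψ) :+ v :* ((con (+ 1) :+ (con (+ 1) :- t) :* b) :* ψ)
             := (w :+ v :+ ((con (+ 1) :- t) :* s) :* k) :* ψ :+ (con (+ 1) :- t) :* ((ψ :* w) :* a :+ (ψ :* v) :* b :- (ψ :* k) :* s))
             refl (w₀ u) (w₁ u) t Σ₀ Σ₁ (Ψ Z) ΣA k ⟩
      (w₀ u + w₁ u + ((1# - t) * ΣA) * k) * Ψ Z + (1# - t) * ((Ψ Z * w₀ u) * Σ₀ + (Ψ Z * w₁ u) * Σ₁ - (Ψ Z * k) * ΣA)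
        ≈⟨ +-cong (*-congʳ (+-congˡ (*-congʳ (trans (row-sum (All.map proj₁ (proj₁ Z-reg)) (regular-≉ Z-reg))
             (+-congˡ (-‿cong (reflexive (signed-constant t s)))))))) (*-congˡ (sym collect)) ⟩
      C * Ψ Z + (1# - t) * sumPicks Z ρ ∎
      where
      Z-reg = regular-signed s (gX , dX)
      duZ   = distinct-signed s gX du

      a₀ a₁ : Carrier → List Carrier → Carrier
      a₀ y Y = (prodOver (A y) Y * y) * (u ⁻¹ - y) ⁻¹
      a₁ y Y = (prodOver (A y) Y * y) * (u - y) ⁻¹

      Σ₀ Σ₁ ΣA : Carrier
      Σ₀ = sumPicks Z a₀
      Σ₁ = sumPicks Z a₁
      ΣA = sumPicks Z (λ y Y → prodOver (A y) Y)

      collect : sumPicks Z ρ ≈ (Ψ Z * w₀ u) * Σ₀ + (Ψ Z * w₁ u) * Σ₁ - (Ψ Z * k) * ΣA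
      collect = begin
        sumPicks Z ρ
          ≈⟨ sumPicks-cong {X = Z} termwise ⟩
        sumPicks Z (λ y Y → ((Ψ Z * w₀ u) * a₀ y Y + (Ψ Z * w₁ u) * a₁ y Y) + (- (Ψ Z * k)) * prodOver (A y) Y)
          ≈⟨ trans (sumPicks-+ Z) (+-cong (trans (sumPicks-+ Z) (+-cong (sumPicks-*ˡ Z _) (sumPicks-*ˡ Z _))) (sumPicks-*ˡ Z _)) ⟩
        ((Ψ Z * w₀ u) * Σ₀ + (Ψ Z * w₁ u) * Σ₁) + (- (Ψ Z * k)) * ΣA
          ≈⟨ solve 3 (λ a b d → a :+ (:- b) :* d := a :- b :* d) refl _ (Ψ Z * k) ΣA ⟩
        (Ψ Z * w₀ u) * Σ₀ + (Ψ Z * w₁ u) * Σ₁ - (Ψ Z * k) * ΣA ∎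
        where
        termwise : ∀ y Y → Z ↭ y ∷ Y → ρ y Y ≈ ((Ψ Z * w₀ u) * a₀ y Y + (Ψ Z * w₁ u) * a₁ y Y) + (- (Ψ Z * k)) * prodOver (A y) Y
        termwise y Y p = begin
          ρ y Y
            ≈⟨ solve 9 (λ ψ a β w v y d e k → (ψ :* (a :* β)) :* ((w :* (y :* d) :+ v :* (y :* e)) :- k)
                 := ((β :* ψ) :* w :* ((a :* y) :* d) :+ (β :* ψ) :* v :* ((a :* y) :* e)) :+ (:- ((β :* ψ) :* k)) :* a)
                 refl (Ψ Y) (prodOver (A y) Y) (prodOver (B y) Y) (w₀ u) (w₁ u) y ((u ⁻¹ - y) ⁻¹) ((u - y) ⁻¹) k ⟩
          ((prodOver (B y) Y * Ψ Y) * w₀ u * a₀ y Y + (prodOver (B y) Y * Ψ Y) * w₁ u * a₁ y Y) + (- ((prodOver (B y) Y * Ψ Y) * k)) * prodOver (A y) Y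
            ≈⟨ +-cong (+-cong (*-congʳ (*-congʳ (sym (Ψ-pick Z-reg p)))) (*-congʳ (*-congʳ (sym (Ψ-pick Z-reg p)))))
                 (*-congʳ (-‿cong (*-congʳ (sym (Ψ-pick Z-reg p))))) ⟩
          _ ∎

    residues-cancel : ∀ x Y → X ↭ x ∷ Y → w₀ x * sumSigns w₀ w₁ Y (ρ x) + w₁ x * sumSigns w₀ w₁ Y (ρ (x ⁻¹)) ≈ 0# * 0#
    residues-cancel x Y p = begin
      w₀ x * sumSigns w₀ w₁ Y (ρ x) + w₁ x * sumSigns w₀ w₁ Y (ρ (x ⁻¹))
        ≈⟨ trans (sumSigns-+ Y) (+-cong (sumSigns-*ˡ Y _) (sumSigns-*ˡ Y _)) ⟨
      sumSigns w₀ w₁ Y (λ Z → w₀ x * ρ x Z + w₁ x * ρ (x ⁻¹) Z)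
        ≈⟨ sumSigns-cong {X = Y} termwise ⟩
      sumSigns w₀ w₁ Y (λ Z → 0# * 0#)
        ≈⟨ sumSigns-*ˡ Y 0# ⟩
      0# * sumSigns w₀ w₁ Y (λ Z → 0#)
        ≈⟨ *-congˡ (sumSigns-0 Y) ⟩
      0# * 0# ∎
      where
      Y-reg = regular-↭ p (gX , dX)
      gx    = All.head (proj₁ Y-reg)

      -- Replacing x by x⁻¹ exchanges the rows of `A` and `B`, so both terms share the same product
      -- and only the combination governed by `balanced` remains.
      termwise : ∀ Z → Signed Y Z → w₀ x * ρ x Z + w₁ x * ρ (x ⁻¹) Z ≈ 0# * 0#
      termwise Z s = begin
        w₀ x * ρ x Z + w₁ x * ρ (x ⁻¹) Z
          ≈⟨ +-congˡ (*-congˡ (*-congʳ (*-congˡ (*-congˡ (A-⁻¹⁻¹ (proj₁ gx)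
               (All.map proj₁ (distinct-signed s (All.tail (proj₁ Y-reg)) (AllPairs.head (proj₂ Y-reg))))))))) ⟩
        w₀ x * ((Ψ Z * (prodOver (A x) Z * prodOver (B x) Z)) * (κ w₀ w₁ u x - k))
          + w₁ x * ((Ψ Z * (prodOver (B x) Z * prodOver (A x) Z)) * (κ w₀ w₁ u (x ⁻¹) - k))
          ≈⟨ solve 8 (λ w v ψ a b κ κ′ k → w :* ((ψ :* (a :* b)) :* (κ :- k)) :+ v :* ((ψ :* (b :* a)) :* (κ′ :- k))
               := (ψ :* a :* b) :* ((w :* κ :+ v :* κ′) :- k :* (w :+ v)))
               refl (w₀ x) (w₁ x) (Ψ Z) (prodOver (A x) Z) (prodOver (B x) Z) (κ w₀ w₁ u x) (κ w₀ w₁ u (x ⁻¹)) k ⟩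
        (Ψ Z * prodOver (A x) Z * prodOver (B x) Z) * ((w₀ x * κ w₀ w₁ u x + w₁ x * κ w₀ w₁ u (x ⁻¹)) - k * (w₀ x + w₁ x))
          ≈⟨ *-congˡ (+-congʳ (balanced gx (All.head (All-resp-↭ p du)))) ⟩
        (Ψ Z * prodOver (A x) Z * prodOver (B x) Z) * (k * (w₀ x + w₁ x) - k * (w₀ x + w₁ x))
          ≈⟨ solve 2 (λ a b → a :* (b :- b) := con (+ 0) :* con (+ 0)) refl _ _ ⟩
        0# * 0# ∎

-- Four evaluations of sums over signs, and the recursion in m for the right side.

module BoundedLittlewood {c ℓ : Level} (R : CommutativeRing c ℓ)
  (_⁻¹ : CommutativeRing.Carrier R → CommutativeRing.Carrier R)
  (inverseʳ : Alg.FieldInv R _⁻¹) (t : CommutativeRing.Carrier R) where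
  open CommutativeRing R
  open Alg R _⁻¹ using (_^_; poch)
  open import Relation.Binary.Reasoning.Setoid setoid
  open IntegerSolver R using (solve; _:=_; _:+_; _:*_; _:-_; :-_; con)
  open FieldLemmas R _⁻¹ inverseʳ
  open ListProducts R
  open HallLittlewoodKernel R _⁻¹ inverseʳ t
  open SignedSums R _⁻¹ inverseʳ t

  b : Carrier → Carrier
  b x = (1# - x) ⁻¹

  [1-x]b≈1 : ∀ {x} → Generic x → (1# - x) * b x ≈ 1#
  [1-x]b≈1 (_ , x≉1) = inverseʳ _ (a-b≉0 (≉-sym x≉1))

  -- For weights n₀/(1 - x) and n₁/(1 - x), both sides of the hypothesis of signedSum-step
  -- have partial fractions with denominators 1 - u x and u - x.
  balance : ∀ (n₀ n₁ : Carrier → Carrier) {u x} k Q₁ Q₂ → Generic u → Generic x → Distinct u x →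
    u * x * (n₀ u * n₀ x) - n₁ u * n₁ x ≈ (1# - u * x) * Q₁ →
    x * (n₀ x * n₁ u) - u * (n₁ x * n₀ u) ≈ (u - x) * Q₂ →
    Q₁ + Q₂ ≈ k * (1# - u) * (n₀ x + n₁ x) →
    let w₀ y = n₀ y * b y
        w₁ y = n₁ y * b y
    in w₀ x * κ w₀ w₁ u x + w₁ x * κ w₀ w₁ u (x ⁻¹) ≈ k * (w₀ x + w₁ x)
  balance n₀ n₁ {u} {x} k Q₁ Q₂ gu gx d eq₁ eq₂ eq₃ = begin
    n₀ x * b x * (n₀ u * b u * (x * (u ⁻¹ - x) ⁻¹) + n₁ u * b u * (x * D))
      + n₁ x * b x * (n₀ u * b u * (x ⁻¹ * (u ⁻¹ - x ⁻¹) ⁻¹) + n₁ u * b u * (x ⁻¹ * (u - x ⁻¹) ⁻¹))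
      ≈⟨ +-cong (*-congˡ (+-congʳ (*-congˡ (*-congˡ (sym pole₁))))) (*-congˡ (+-cong (*-congˡ pole₂) (*-congˡ pole₃))) ⟩
    n₀ x * b x * (n₀ u * b u * (x * (u * P)) + n₁ u * b u * (x * D))
      + n₁ x * b x * (n₀ u * b u * (- (u * D)) + n₁ u * b u * (- P))
      ≈⟨ solve 10 (λ n₀x n₁x n₀u n₁u bu bx u x P D →
           n₀x :* bx :* (n₀u :* bu :* (x :* (u :* P)) :+ n₁u :* bu :* (x :* D)) :+ n₁x :* bx :* (n₀u :* bu :* (:- (u :* D)) :+ n₁u :* bu :* (:- P))
           := bu :* bx :* ((u :* x :* (n₀u :* n₀x) :- n₁u :* n₁x) :* P :+ (x :* (n₀x :* n₁u) :- u :* (n₁x :* n₀u)) :* D))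
           refl (n₀ x) (n₁ x) (n₀ u) (n₁ u) (b u) (b x) u x P D ⟩
    b u * b x * ((u * x * (n₀ u * n₀ x) - n₁ u * n₁ x) * P + (x * (n₀ x * n₁ u) - u * (n₁ x * n₀ u)) * D)
      ≈⟨ *-congˡ (+-cong (*-congʳ eq₁) (*-congʳ eq₂)) ⟩
    b u * b x * ((1# - u * x) * Q₁ * P + (u - x) * Q₂ * D)
      ≈⟨ solve 8 (λ bu bx u x Q₁ Q₂ P D → bu :* bx :* ((con (+ 1) :- u :* x) :* Q₁ :* P :+ (u :- x) :* Q₂ :* D)
           := bu :* bx :* (((con (+ 1) :- u :* x) :* P) :* Q₁ :+ ((u :- x) :* D) :* Q₂)) refl (b u) (b x) u x Q₁ Q₂ P D ⟩
    b u * b x * (((1# - u * x) * P) * Q₁ + ((u - x) * D) * Q₂)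
      ≈⟨ *-congˡ (trans (+-cong (trans (*-congʳ P-inv) (*-identityˡ _)) (trans (*-congʳ D-inv) (*-identityˡ _))) eq₃) ⟩
    b u * b x * (k * (1# - u) * (n₀ x + n₁ x))
      ≈⟨ solve 6 (λ bu bx k u m n → bu :* bx :* (k :* (con (+ 1) :- u) :* (m :+ n)) := ((con (+ 1) :- u) :* bu) :* (k :* (m :* bx :+ n :* bx)))
           refl (b u) (b x) k u (n₀ x) (n₁ x) ⟩
    ((1# - u) * b u) * (k * (n₀ x * b x + n₁ x * b x))
      ≈⟨ trans (*-congʳ ([1-x]b≈1 gu)) (*-identityˡ _) ⟩
    k * (n₀ x * b x + n₁ x * b x) ∎
    where
    P D : Carrier
    P = (1# - u * x) ⁻¹
    D = (u - x) ⁻¹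
    P-inv = inverseʳ (1# - u * x) (a-b≉0 (≉-sym (proj₂ d)))
    D-inv = inverseʳ (u - x) (a-b≉0 (proj₁ d))
    uu⁻¹  = inverseʳ u (proj₁ gu)
    xx⁻¹  = inverseʳ x (proj₁ gx)

    pole₁ : u * P ≈ (u ⁻¹ - x) ⁻¹
    pole₁ = ⁻¹-unique (a-b≉0 (proj₁ (distinct-inverse gu d))) (begin
      (u ⁻¹ - x) * (u * P)     ≈⟨ solve 4 (λ u u′ x P → (u′ :- x) :* (u :* P) := (u :* u′ :- u :* x) :* P) refl u (u ⁻¹) x P ⟩
      (u * u ⁻¹ - u * x) * P   ≈⟨ *-congʳ (+-congʳ uu⁻¹) ⟩
      (1# - u * x) * P         ≈⟨ P-inv ⟩
      1#                       ∎)

    pole₂ : x ⁻¹ * (u ⁻¹ - x ⁻¹) ⁻¹ ≈ - (u * D)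
    pole₂ = begin
      x ⁻¹ * (u ⁻¹ - x ⁻¹) ⁻¹
        ≈⟨ *-congˡ (sym (⁻¹-unique (a-b≉0 (proj₁ (distinct-inverse gu (distinct-inverseʳ gx d)))) (begin
             (u ⁻¹ - x ⁻¹) * - (u * x * D)          ≈⟨ solve 5 (λ u u′ x x′ D → (u′ :- x′) :* :- (u :* x :* D) := (u :* (x :* x′) :- x :* (u :* u′)) :* D) refl u (u ⁻¹) x (x ⁻¹) D ⟩
             (u * (x * x ⁻¹) - x * (u * u ⁻¹)) * D  ≈⟨ *-congʳ (+-cong (trans (*-congˡ xx⁻¹) (*-identityʳ u)) (-‿cong (trans (*-congˡ uu⁻¹) (*-identityʳ x)))) ⟩
             (u - x) * D                            ≈⟨ D-inv ⟩
             1#                                     ∎))) ⟩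
      x ⁻¹ * - (u * x * D)
        ≈⟨ solve 4 (λ u x x′ D → x′ :* :- (u :* x :* D) := (x :* x′) :* :- (u :* D)) refl u x (x ⁻¹) D ⟩
      (x * x ⁻¹) * - (u * D)
        ≈⟨ trans (*-congʳ xx⁻¹) (*-identityˡ _) ⟩
      - (u * D) ∎

    pole₃ : x ⁻¹ * (u - x ⁻¹) ⁻¹ ≈ - P
    pole₃ = begin
      x ⁻¹ * (u - x ⁻¹) ⁻¹
        ≈⟨ *-congˡ (sym (⁻¹-unique (a-b≉0 (proj₁ (distinct-inverseʳ gx d))) (begin
             (u - x ⁻¹) * - (x * P)     ≈⟨ solve 4 (λ u x x′ P → (u :- x′) :* :- (x :* P) := (x :* x′ :- u :* x) :* P) refl u x (x ⁻¹) P ⟩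
             (x * x ⁻¹ - u * x) * P     ≈⟨ *-congʳ (+-congʳ xx⁻¹) ⟩
             (1# - u * x) * P           ≈⟨ P-inv ⟩
             1#                         ∎))) ⟩
      x ⁻¹ * - (x * P)      ≈⟨ solve 3 (λ x x′ P → x′ :* :- (x :* P) := (x :* x′) :* :- P) refl x (x ⁻¹) P ⟩
      (x * x ⁻¹) * - P      ≈⟨ trans (*-congʳ xx⁻¹) (*-identityˡ _) ⟩
      - P                   ∎

  ones : List Carrier → Carrier
  ones _ = 1#

  -- The second weight -x/(1 - x) is 1/(1 - x) taken at x⁻¹. The numerators balance with `k` zero,
  -- and the two weights of u add up to 1.
  signedSum-ones : ∀ {X} → Regular X → signedSum (λ x → 1# * b x) (λ x → - x * b x) X ≈ 1#
  signedSum-ones {[]}    reg = refl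
  signedSum-ones {u ∷ X} reg@(gu ∷ _ , _) = begin
    _ ≈⟨ signedSum-step 0# reg (λ {x} gx d → balance (λ _ → 1#) (λ x → - x) 0# 0# 0# gu gx d
           (solve 2 (λ u x → u :* x :* (con (+ 1) :* con (+ 1)) :- :- u :* :- x := (con (+ 1) :- u :* x) :* con (+ 0)) refl u x)
           (solve 2 (λ u x → x :* (con (+ 1) :* :- u) :- u :* (:- x :* con (+ 1)) := (u :- x) :* con (+ 0)) refl u x)
           (solve 2 (λ u x → con (+ 0) :+ con (+ 0) := con (+ 0) :* (con (+ 1) :- u) :* (con (+ 1) :+ :- x)) refl u x)) ⟩
    (1# * b u + - u * b u + (1# - prodOver (λ _ → t) X) * 0#) * signedSum _ _ X
      ≈⟨ *-cong (trans (solve 3 (λ u b T → con (+ 1) :* b :+ :- u :* b :+ T :* con (+ 0) := (con (+ 1) :- u) :* b) refl u (b u) _) ([1-x]b≈1 gu))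
           (signedSum-ones (regular-tail reg)) ⟩
    1# * 1# ≈⟨ *-identityˡ 1# ⟩
    1# ∎

  -- Here the two weights of u cancel, so only the empty list survives. Read through
  -- `signedSum-splits`, this exhibits a left inverse under `⊛` of `Ψ` twisted by 1/(1 - x).
  signedSum-δ : ∀ {X} → Regular X → signedSum (λ x → 1# * b x) (λ x → - 1# * b x) X ≈ δ X
  signedSum-δ {[]}    reg = refl
  signedSum-δ {u ∷ X} reg@(gu ∷ _ , _) = begin
    _ ≈⟨ signedSum-step 0# reg (λ {x} gx d → balance (λ _ → 1#) (λ _ → - 1#) 0# (- 1#) 1# gu gx d
           (solve 2 (λ u x → u :* x :* (con (+ 1) :* con (+ 1)) :- :- con (+ 1) :* :- con (+ 1) := (con (+ 1) :- u :* x) :* :- con (+ 1)) refl u x)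
           (solve 2 (λ u x → x :* (con (+ 1) :* :- con (+ 1)) :- u :* (:- con (+ 1) :* con (+ 1)) := (u :- x) :* con (+ 1)) refl u x)
           (solve 1 (λ u → :- con (+ 1) :+ con (+ 1) := con (+ 0) :* (con (+ 1) :- u) :* (con (+ 1) :+ :- con (+ 1))) refl u)) ⟩
    (1# * b u + - 1# * b u + (1# - prodOver (λ _ → t) X) * 0#) * signedSum _ _ X
      ≈⟨ solve 3 (λ b T s → (con (+ 1) :* b :+ :- con (+ 1) :* b :+ T :* con (+ 0)) :* s := con (+ 0)) refl (b u) _ _ ⟩
    0# ∎

  w w̄ : Carrier → Carrier → Carrier
  w a x = (1# - a * x) * b x
  w̄ a x = (a - x) * b x

  -- The one evaluation with a nonzero balancing constant. The weights of u add up to 1 + a, and k =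
  -- -a corrects this to 1 + a t^|X|, the next factor of (-a; t).
  signedSum-poch : ∀ a {X} → Regular X → signedSum (w a) (w̄ a) X ≈ poch (- a) t (length X)
  signedSum-poch a {[]}    reg = refl
  signedSum-poch a {u ∷ X} reg@(gu ∷ _ , _) = begin
    _ ≈⟨ signedSum-step (- a) reg (λ {x} gx d → balance (λ x → 1# - a * x) (λ x → a - x) (- a)
             (a * (u + x) - a * a * (1# + u * x)) (a * a * (u + x) - a * (1# + u * x)) gu gx d
           (solve 3 (λ a u x → u :* x :* ((con (+ 1) :- a :* u) :* (con (+ 1) :- a :* x)) :- (a :- u) :* (a :- x)
             := (con (+ 1) :- u :* x) :* (a :* (u :+ x) :- a :* a :* (con (+ 1) :+ u :* x))) refl a u x)
           (solve 3 (λ a u x → x :* ((con (+ 1) :- a :* x) :* (a :- u)) :- u :* ((a :- x) :* (con (+ 1) :- a :* u))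
             := (u :- x) :* (a :* a :* (u :+ x) :- a :* (con (+ 1) :+ u :* x))) refl a u x)
           (solve 3 (λ a u x → (a :* (u :+ x) :- a :* a :* (con (+ 1) :+ u :* x)) :+ (a :* a :* (u :+ x) :- a :* (con (+ 1) :+ u :* x))
             := :- a :* (con (+ 1) :- u) :* ((con (+ 1) :- a :* x) :+ (a :- x))) refl a u x)) ⟩
    (w a u + w̄ a u + (1# - prodOver (λ _ → t) X) * - a) * signedSum (w a) (w̄ a) X
      ≈⟨ *-cong (begin
           w a u + w̄ a u + (1# - prodOver (λ _ → t) X) * - a
             ≈⟨ solve 4 (λ a u b T → (con (+ 1) :- a :* u) :* b :+ (a :- u) :* b :+ (con (+ 1) :- T) :* :- a
                  := (con (+ 1) :+ a) :* ((con (+ 1) :- u) :* b) :- a :+ a :* T) refl a u (b u) _ ⟩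
           (1# + a) * ((1# - u) * b u) - a + a * prodOver (λ _ → t) X
             ≈⟨ +-cong (+-congʳ (*-congˡ ([1-x]b≈1 gu))) (*-congˡ (prodOver-const X)) ⟩
           (1# + a) * 1# - a + a * t ^ length X
             ≈⟨ solve 2 (λ a T → (con (+ 1) :+ a) :* con (+ 1) :- a :+ a :* T := con (+ 1) :- :- a :* T) refl a _ ⟩
           1# - - a * t ^ length X ∎)
         (signedSum-poch a (regular-tail reg)) ⟩
    (1# - - a * t ^ length X) * poch (- a) t (length X) ≈⟨ *-comm _ _ ⟩
    poch (- a) t (length X) * (1# - - a * t ^ length X) ∎
    where
    prodOver-const : ∀ X → prodOver (λ _ → t) X ≈ t ^ length X
    prodOver-const []      = refl
    prodOver-const (_ ∷ X) = *-congˡ (prodOver-const X)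

  -- The weights of u add up to 1 + u and a drops out, in agreement with the empty product h^(1) on
  -- the other side.
  signedSum-1+x : ∀ a {X} → Regular X → signedSum (w a) (λ x → x * (a - x) * b x) X ≈ prodOver (λ x → x + 1#) X
  signedSum-1+x a {[]}    reg = refl
  signedSum-1+x a {u ∷ X} reg@(gu ∷ _ , _) = begin
    _ ≈⟨ signedSum-step 0# reg (λ {x} gx d → balance (λ x → 1# - a * x) (λ x → x * (a - x)) 0#
             (u * x * (1# - a * a)) (- (u * x * (1# - a * a))) gu gx d
           (solve 3 (λ a u x → u :* x :* ((con (+ 1) :- a :* u) :* (con (+ 1) :- a :* x)) :- u :* (a :- u) :* (x :* (a :- x))
             := (con (+ 1) :- u :* x) :* (u :* x :* (con (+ 1) :- a :* a))) refl a u x)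
           (solve 3 (λ a u x → x :* ((con (+ 1) :- a :* x) :* (u :* (a :- u))) :- u :* (x :* (a :- x) :* (con (+ 1) :- a :* u))
             := (u :- x) :* :- (u :* x :* (con (+ 1) :- a :* a))) refl a u x)
           (solve 3 (λ a u x → u :* x :* (con (+ 1) :- a :* a) :+ :- (u :* x :* (con (+ 1) :- a :* a))
             := con (+ 0) :* (con (+ 1) :- u) :* ((con (+ 1) :- a :* x) :+ x :* (a :- x))) refl a u x)) ⟩
    (w a u + u * (a - u) * b u + (1# - prodOver (λ _ → t) X) * 0#) * signedSum (w a) (λ x → x * (a - x) * b x) X
      ≈⟨ *-cong (trans (solve 4 (λ a u b T → (con (+ 1) :- a :* u) :* b :+ u :* (a :- u) :* b :+ T :* con (+ 0)
                   := (u :+ con (+ 1)) :* ((con (+ 1) :- u) :* b)) refl a u (b u) _) (trans (*-congˡ ([1-x]b≈1 gu)) (*-identityʳ _)))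
           (signedSum-1+x a (regular-tail reg)) ⟩
    (u + 1#) * prodOver (λ x → x + 1#) X ∎

  -- Right multiplication by `K` turns the left side into `ones` by `signedSum-ones`, and the second
  -- factor on the right into `δ` by `signedSum-δ`.
  inverted-recursion : ∀ X → Regular X → twist (λ x → - x * b x) Ψ̄ X ≈ (ones ⊛ twist (λ x → - 1# * b x) Ψ̄) X
  inverted-recursion = ⊛-cancelʳ {K = K} Regular regular-splitˡ (*-identityˡ 1#) λ X reg → begin
    (twist (λ x → - x * b x) Ψ̄ ⊛ K) X
      ≈⟨ signedSum-splits _ _ reg ⟨
    signedSum (λ x → 1# * b x) (λ x → - x * b x) X
      ≈⟨ signedSum-ones reg ⟩
    ones X
      ≈⟨ ⊛-identityʳ ones X ⟨
    (ones ⊛ δ) X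
      ≈⟨ ⊛-cong X (λ _ _ _ → refl) (λ S T p → trans (sym (signedSum-δ (regular-splitʳ S p reg))) (signedSum-splits _ _ (regular-splitʳ S p reg))) ⟩
    (ones ⊛ (twist (λ x → - 1# * b x) Ψ̄ ⊛ K)) X
      ≈⟨ ⊛-assoc ones _ K X ⟨
    ((ones ⊛ twist (λ x → - 1# * b x) Ψ̄) ⊛ K) X ∎
    where
    K : List Carrier → Carrier
    K = twist (λ x → 1# * b x) Ψ

  module _ (a : Carrier) where

    Φ Φ̄ : List Carrier → Carrier
    Φ = twist (w a) Ψ
    Φ̄ = twist (w̄ a) Ψ̄

    -- Since x(a - x) = (x - a)(-x) and a - x = (x - a)(-1), this is `inverted-recursion` twisted by
    -- x - a. The twist turns `ones` into ∏ (x - a), which `elementary` factors.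
    Φ̄-recursion : ∀ {X} → Regular X →
      twist (λ x → x) Φ̄ X ≈ ((prodOver (λ x → x) ⊛ prodOver (λ _ → - a)) ⊛ Φ̄) X
    Φ̄-recursion {X} reg = begin
      M (λ x → x) X * (M (w̄ a) X * Ψ̄ X)
        ≈⟨ trans (sym (*-assoc _ _ _)) (*-congʳ (sym (prodOver-* _ _ X))) ⟩
      M (λ x → x * ((a - x) * b x)) X * Ψ̄ X
        ≈⟨ *-congʳ (M-cong X (λ x → solve 3 (λ a x b → x :* ((a :- x) :* b) := (x :+ :- a) :* (:- x :* b)) refl a x (b x))) ⟩
      M (λ x → (x + - a) * (- x * b x)) X * Ψ̄ X
        ≈⟨ trans (*-congʳ (prodOver-* _ _ X)) (*-assoc _ _ _) ⟩
      M (λ x → x + - a) X * twist (λ x → - x * b x) Ψ̄ X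
        ≈⟨ *-congˡ (inverted-recursion X reg) ⟩
      M (λ x → x + - a) X * (ones ⊛ twist (λ x → - 1# * b x) Ψ̄) X
        ≈⟨ twist-⊛ (λ x → x + - a) ones _ X ⟩
      (twist (λ x → x + - a) ones ⊛ twist (λ x → x + - a) (twist (λ x → - 1# * b x) Ψ̄)) X
        ≈⟨ ⊛-cong X (λ S T p → trans (*-identityʳ _) (sym (elementary (- a) (regular-≉ (regular-splitˡ S p reg)))))
             (λ S T p → trans (sym (*-assoc _ _ _)) (*-congʳ (trans (sym (prodOver-* _ _ T))
               (M-cong T (λ x → solve 3 (λ a x b → (x :+ :- a) :* (:- con (+ 1) :* b) := (a :- x) :* b) refl a x (b x)))))) ⟩
      ((prodOver (λ x → x) ⊛ prodOver (λ _ → - a)) ⊛ Φ̄) X ∎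
      where
      M : (Carrier → Carrier) → List Carrier → Carrier
      M = prodOver

      M-cong : ∀ X {f g : Carrier → Carrier} → (∀ x → f x ≈ g x) → prodOver f X ≈ prodOver g X
      M-cong X h = prodOver-cong (All.universal h X)

    bounded : ℕ → List Carrier → Carrier
    bounded m = twist (_^ m) Φ̄ ⊛ Φ

    bounded-0 : ∀ {X} → Regular X → bounded 0 X ≈ poch (- a) t (length X)
    bounded-0 {X} reg = begin
      (twist (λ _ → 1#) Φ̄ ⊛ Φ) X
        ≈⟨ ⊛-cong X (λ S T p → trans (*-congʳ (prodOver-1 S)) (*-identityˡ _)) (λ _ _ _ → refl) ⟩
      (Φ̄ ⊛ Φ) X
        ≈⟨ signedSum-splits _ _ reg ⟨
      signedSum (w a) (w̄ a) X
        ≈⟨ signedSum-poch a reg ⟩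
      poch (- a) t (length X) ∎

    bounded-1 : ∀ {X} → Regular X → bounded 1 X ≈ (prodOver (_^ 1) ⊛ ones) X
    bounded-1 {X} reg = begin
      (twist (_^ 1) Φ̄ ⊛ Φ) X
        ≈⟨ ⊛-cong X (λ S _ _ → weights S) (λ _ _ _ → refl) ⟩
      (twist (λ x → x * (a - x) * b x) Ψ̄ ⊛ Φ) X
        ≈⟨ signedSum-splits _ _ reg ⟨
      signedSum (w a) (λ x → x * (a - x) * b x) X
        ≈⟨ signedSum-1+x a reg ⟩
      prodOver (λ x → x + 1#) X
        ≈⟨ elementary 1# (regular-≉ reg) ⟨
      (prodOver (λ x → x) ⊛ prodOver (λ _ → 1#)) X
        ≈⟨ ⊛-cong X (λ S _ _ → prodOver-cong (All.universal (λ x → sym (*-identityʳ x)) S)) (λ _ T _ → prodOver-1 T) ⟩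
      (prodOver (_^ 1) ⊛ ones) X ∎
      where
      weights : ∀ S → twist (_^ 1) Φ̄ S ≈ twist (λ x → x * (a - x) * b x) Ψ̄ S
      weights S = begin
        prodOver (_^ 1) S * (prodOver (w̄ a) S * Ψ̄ S)      ≈⟨ *-assoc _ _ _ ⟨
        prodOver (_^ 1) S * prodOver (w̄ a) S * Ψ̄ S        ≈⟨ *-congʳ (prodOver-* (_^ 1) (w̄ a) S) ⟨
        prodOver (λ x → x ^ 1 * w̄ a x) S * Ψ̄ S            ≈⟨ *-congʳ (prodOver-cong (All.universal (λ x →
          solve 3 (λ a x b → (x :* con (+ 1)) :* ((a :- x) :* b) := x :* (a :- x) :* b) refl a x (b x)) S)) ⟩
        prodOver (λ x → x * (a - x) * b x) S * Ψ̄ S        ∎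

    -- Twisting `Φ̄-recursion` by x^m suffices, because the right factor `Φ` does not depend on m.
    bounded-suc : ∀ m {X} → Regular X →
      bounded (suc m) X ≈ ((prodOver (_^ suc m) ⊛ twist (_^ m) (prodOver (λ _ → - a))) ⊛ bounded m) X
    bounded-suc m {X} reg = begin
      (twist (_^ suc m) Φ̄ ⊛ Φ) X
        ≈⟨ ⊛-cong X (λ S T p → step S (regular-splitˡ S p reg)) (λ _ _ _ → refl) ⟩
      (((prodOver (_^ suc m) ⊛ twist (_^ m) (prodOver (λ _ → - a))) ⊛ twist (_^ m) Φ̄) ⊛ Φ) X
        ≈⟨ ⊛-assoc _ _ Φ X ⟩
      ((prodOver (_^ suc m) ⊛ twist (_^ m) (prodOver (λ _ → - a))) ⊛ bounded m) X ∎
      where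
      step : ∀ X → Regular X → twist (_^ suc m) Φ̄ X ≈ ((prodOver (_^ suc m) ⊛ twist (_^ m) (prodOver (λ _ → - a))) ⊛ twist (_^ m) Φ̄) X
      step X reg = begin
        prodOver (_^ suc m) X * Φ̄ X
          ≈⟨ trans (*-congʳ (trans (prodOver-* (λ x → x) (_^ m) X) (*-comm _ _))) (*-assoc _ _ _) ⟩
        prodOver (_^ m) X * twist (λ x → x) Φ̄ X
          ≈⟨ *-congˡ (Φ̄-recursion reg) ⟩
        prodOver (_^ m) X * ((prodOver (λ x → x) ⊛ prodOver (λ _ → - a)) ⊛ Φ̄) X
          ≈⟨ twist-⊛ (_^ m) _ Φ̄ X ⟩
        (twist (_^ m) (prodOver (λ x → x) ⊛ prodOver (λ _ → - a)) ⊛ twist (_^ m) Φ̄) X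
          ≈⟨ ⊛-cong X {F′ = prodOver (_^ suc m) ⊛ twist (_^ m) (prodOver (λ _ → - a))} (λ S T p → trans (twist-⊛ (_^ m) _ _ S)
               (⊛-cong S (λ U V q → trans (*-comm _ _) (sym (prodOver-* (λ x → x) (_^ m) U))) (λ _ _ _ → refl))) (λ _ _ _ → refl) ⟩
        ((prodOver (_^ suc m) ⊛ twist (_^ m) (prodOver (λ _ → - a))) ⊛ twist (_^ m) Φ̄) X ∎

-- Sums over partitions, grouped by the multiplicity of the largest part.

module PartitionSums {c ℓ : Level} (R : CommutativeRing c ℓ) where
  open CommutativeRing R hiding (zero)
  open import Relation.Binary.Reasoning.Setoid setoid
  open ListSums R

  sumAntidiagonal : ℕ → (ℕ → ℕ → Carrier) → Carrier
  sumAntidiagonal zero    ψ = ψ 0 0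
  sumAntidiagonal (suc n) ψ = ψ 0 (suc n) + sumAntidiagonal n (λ k l → ψ (suc k) l)

  sumAntidiagonal-cong : ∀ n {φ ψ} → (∀ k l → k ℕ.+ l ≡ n → φ k l ≈ ψ k l) → sumAntidiagonal n φ ≈ sumAntidiagonal n ψ
  sumAntidiagonal-cong zero    h = h 0 0 ≡.refl
  sumAntidiagonal-cong (suc n) h = +-cong (h 0 (suc n) ≡.refl) (sumAntidiagonal-cong n λ k l eq → h (suc k) l (≡.cong suc eq))

  sumAntidiagonal-0 : ∀ n {ψ} → (∀ k l → ψ k l ≈ 0#) → sumAntidiagonal n ψ ≈ 0#
  sumAntidiagonal-0 zero    h = h 0 0
  sumAntidiagonal-0 (suc n) h = trans (+-cong (h 0 (suc n)) (sumAntidiagonal-0 n λ k l → h (suc k) l)) (+-identityˡ 0#)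

  sumAntidiagonal-single : ∀ i j {ψ} → (∀ k l → k ≢ i → ψ k l ≈ 0#) → sumAntidiagonal (i ℕ.+ j) ψ ≈ ψ i j
  sumAntidiagonal-single zero    zero    h = refl
  sumAntidiagonal-single zero    (suc j) h = trans (+-congˡ (sumAntidiagonal-0 j λ k l → h (suc k) l λ ())) (+-identityʳ _)
  sumAntidiagonal-single (suc i) j       h = trans
    (+-cong (h 0 _ λ ()) (sumAntidiagonal-single i j λ k l k≢i → h (suc k) l (k≢i ∘ ℕ.suc-injective))) (+-identityˡ _)

  sumAntidiagonal-splits : ∀ {a} {A : Set a} n (X : List A) (φ : ℕ → ℕ → List A → List A → Carrier) →
    sumAntidiagonal n (λ k l → sumSplits X (φ k l)) ≈ sumSplits X (λ S T → sumAntidiagonal n (λ k l → φ k l S T))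
  sumAntidiagonal-splits zero    X φ = refl
  sumAntidiagonal-splits (suc n) X φ = trans (+-congˡ (sumAntidiagonal-splits n X _)) (sym (sumSplits-+ X))

  -- `partitionsLE` chooses the first part; here one asks whether it equals the bound, so that all
  -- copies of the largest part can be peeled off together.
  sumParts : ℕ → ℕ → (List ℕ → Carrier) → Carrier
  sumParts zero    b       φ = φ []
  sumParts (suc n) zero    φ = sumParts n zero (λ μ → φ (0 ∷ μ))
  sumParts (suc n) (suc b) φ = sumParts (suc n) b φ + sumParts n (suc b) (λ μ → φ (suc b ∷ μ))

  sumParts-cong : ∀ n b {φ ψ} → (∀ μ → length μ ≡ n → All (ℕ._≤ b) μ → φ μ ≈ ψ μ) → sumParts n b φ ≈ sumParts n b ψ
  sumParts-cong zero    b       h = h [] ≡.refl []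
  sumParts-cong (suc n) zero    h = sumParts-cong n zero λ μ eq μ≤ → h (0 ∷ μ) (≡.cong suc eq) (z≤n ∷ μ≤)
  sumParts-cong (suc n) (suc b) h = +-cong
    (sumParts-cong (suc n) b λ μ eq μ≤ → h μ eq (All.map ℕ.m≤n⇒m≤1+n μ≤))
    (sumParts-cong n (suc b) λ μ eq μ≤ → h (suc b ∷ μ) (≡.cong suc eq) (ℕ.≤-refl ∷ μ≤))

  sumParts-*ˡ : ∀ n b {φ} k → sumParts n b (λ μ → k * φ μ) ≈ k * sumParts n b φ
  sumParts-*ˡ zero    b       k = refl
  sumParts-*ˡ (suc n) zero    k = sumParts-*ˡ n zero k
  sumParts-*ˡ (suc n) (suc b) k = trans (+-cong (sumParts-*ˡ (suc n) b k) (sumParts-*ˡ n (suc b) k)) (sym (distribˡ k _ _))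

  sumParts-splits : ∀ {a} {A : Set a} n b (X : List A) (φ : List ℕ → List A → List A → Carrier) →
    sumParts n b (λ μ → sumSplits X (φ μ)) ≈ sumSplits X (λ S T → sumParts n b (λ μ → φ μ S T))
  sumParts-splits zero    b       X φ = refl
  sumParts-splits (suc n) zero    X φ = sumParts-splits n zero X _
  sumParts-splits (suc n) (suc b) X φ = trans (+-cong (sumParts-splits (suc n) b X _) (sumParts-splits n (suc b) X _)) (sym (sumSplits-+ X))

  sumParts-zero : ∀ n φ → sumParts n 0 φ ≡ φ (replicate n 0)
  sumParts-zero zero    φ = ≡.refl
  sumParts-zero (suc n) φ = sumParts-zero n _

  sumParts-suc : ∀ n b φ →
    sumParts n (suc b) φ ≈ sumAntidiagonal n (λ k l → sumParts l b (λ μ → φ (replicate k (suc b) ++ μ)))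
  sumParts-suc zero    b φ = refl
  sumParts-suc (suc n) b φ = +-congˡ (sumParts-suc n b _)

  count : ℕ → List ℕ → ℕ
  count i []       = 0
  count i (a ∷ as) = (if a ≡ᵇ i then 1 else 0) ℕ.+ count i as

  ≡ᵇ-refl : ∀ i → (i ≡ᵇ i) ≡ true
  ≡ᵇ-refl zero    = ≡.refl
  ≡ᵇ-refl (suc i) = ≡ᵇ-refl i

  ≢⇒≡ᵇ-false : ∀ i j → i ≢ j → (i ≡ᵇ j) ≡ false
  ≢⇒≡ᵇ-false zero    zero    i≢j = contradiction ≡.refl i≢j
  ≢⇒≡ᵇ-false zero    (suc j) i≢j = ≡.refl
  ≢⇒≡ᵇ-false (suc i) zero    i≢j = ≡.refl
  ≢⇒≡ᵇ-false (suc i) (suc j) i≢j = ≢⇒≡ᵇ-false i j (i≢j ∘ ≡.cong suc)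

  count-replicate : ∀ k i μ → count i (replicate k i ++ μ) ≡ k ℕ.+ count i μ
  count-replicate zero    i μ = ≡.refl
  count-replicate (suc k) i μ rewrite ≡ᵇ-refl i = ≡.cong suc (count-replicate k i μ)

  count-replicate-≢ : ∀ k {i j} μ → j ≢ i → count i (replicate k j ++ μ) ≡ count i μ
  count-replicate-≢ zero    μ j≢i = ≡.refl
  count-replicate-≢ (suc k) {i} {j} μ j≢i rewrite ≢⇒≡ᵇ-false j i j≢i = count-replicate-≢ k μ j≢i

  count-absent : ∀ {i μ} → All (_≢ i) μ → count i μ ≡ 0
  count-absent []                       = ≡.refl
  count-absent {i} {a ∷ μ} (a≢i ∷ μ≢i) rewrite ≢⇒≡ᵇ-false a i a≢i = count-absent μ≢i

  weight : (ℕ → ℕ → Carrier) → ℕ → List ℕ → Carrier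
  weight g zero    μ = g 0 (count 0 μ)
  weight g (suc b) μ = weight g b μ * g (suc b) (count (suc b) μ)

  weight-replicate : ∀ g f b k {μ} → All (ℕ._≤ b) μ →
    weight g b (replicate k (suc b) ++ μ) * f (count (suc b) (replicate k (suc b) ++ μ)) ≡ weight g b μ * f k
  weight-replicate g f b k {μ} μ≤b = ≡.cong₂ _*_ (lower b ℕ.≤-refl)
    (≡.cong f (≡.trans (count-replicate k (suc b) μ)
      (≡.trans (≡.cong (k ℕ.+_) (count-absent (All.map (λ a≤b a≡ → ℕ.1+n≰n (ℕ.≤-trans (ℕ.≤-reflexive (≡.sym a≡)) a≤b)) μ≤b))) (ℕ.+-identityʳ k))))
    where
    lower : ∀ i → i ℕ.≤ b → weight g i (replicate k (suc b) ++ μ) ≡ weight g i μ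
    lower zero    i≤b = ≡.cong (g 0) (count-replicate-≢ k μ λ ())
    lower (suc i) i≤b = ≡.cong₂ _*_ (lower i (ℕ.<⇒≤ i≤b))
      (≡.cong (g (suc i)) (count-replicate-≢ k μ λ eq → ℕ.1+n≰n (ℕ.≤-trans (ℕ.≤-reflexive eq) i≤b)))

-- Hall-Littlewood symmetrizations and Rogers-Szegő polynomials as products under `⊛`.

module HallLittlewoodSums {c ℓ : Level} (R : CommutativeRing c ℓ)
  (_⁻¹ : CommutativeRing.Carrier R → CommutativeRing.Carrier R)
  (inverseʳ : Alg.FieldInv R _⁻¹) (t : CommutativeRing.Carrier R)
  (t≉1 : ¬ CommutativeRing._≈_ R t (CommutativeRing.1# R)) where
  open CommutativeRing R hiding (zero)
  open Alg R _⁻¹ using (_^_; poch; rogersSzego; sumL)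
  open import Relation.Binary.Reasoning.Setoid setoid
  open IntegerSolver R using (solve; _:=_; _:*_; con)
  open FieldLemmas R _⁻¹ inverseʳ
  open ListSums R
  open ListProducts R
  open PartitionSums R
  open HallLittlewoodKernel R _⁻¹ inverseʳ t
  open SignedSums R _⁻¹ inverseʳ t
  open BoundedLittlewood R _⁻¹ inverseʳ t

  1-t≉0 : 1# - t ≉ 0#
  1-t≉0 = a-b≉0 (≉-sym t≉1)

  1≉0 : 1# ≉ 0#
  1≉0 1≈0 = 1-t≉0 (trans (sym (*-identityʳ _)) (trans (*-congˡ 1≈0) (zeroʳ _)))

  ^-nonzero : ∀ {x} k → x ≉ 0# → x ^ k ≉ 0#
  ^-nonzero zero    x≉0 = 1≉0
  ^-nonzero (suc k) x≉0 = *-nonzero x≉0 (^-nonzero k x≉0)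

  ^-+ : ∀ x k l → x ^ (k ℕ.+ l) ≈ x ^ k * x ^ l
  ^-+ x zero    l = sym (*-identityˡ _)
  ^-+ x (suc k) l = trans (*-congˡ (^-+ x k l)) (sym (*-assoc _ _ _))

  -- The t-factorial, which is the factor of v_λ for a part of multiplicity k.
  v : ℕ → Carrier
  v k = poch t t k * ((1# - t) ^ k) ⁻¹

  v-zero : v 0 ≈ 1#
  v-zero = trans (*-identityˡ _) (1⁻¹≈1 1≉0)

  v-suc : ∀ k → v (suc k) * (1# - t) ≈ v k * (1# - t * t ^ k)
  v-suc k = begin
    (poch t t k * (1# - t * t ^ k)) * ((1# - t) * (1# - t) ^ k) ⁻¹ * (1# - t)
      ≈⟨ *-congʳ (*-congˡ (⁻¹-distrib-* 1-t≉0 (^-nonzero k 1-t≉0))) ⟩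
    (poch t t k * (1# - t * t ^ k)) * ((1# - t) ⁻¹ * ((1# - t) ^ k) ⁻¹) * (1# - t)
      ≈⟨ solve 5 (λ p q s s′ r → (p :* q) :* (s′ :* r) :* s := (s :* s′) :* ((p :* r) :* q)) refl
           (poch t t k) (1# - t * t ^ k) (1# - t) ((1# - t) ⁻¹) (((1# - t) ^ k) ⁻¹) ⟩
    ((1# - t) * (1# - t) ⁻¹) * (v k * (1# - t * t ^ k))
      ≈⟨ trans (*-congʳ (inverseʳ _ 1-t≉0)) (*-identityˡ _) ⟩
    v k * (1# - t * t ^ k) ∎

  v-nonzero : ∀ k → poch t t k ≉ 0# → v k ≉ 0#
  v-nonzero k p≉0 = *-nonzero p≉0 (⁻¹-nonzero (^-nonzero k 1-t≉0))

  prodOver-const : ∀ {a} {A : Set a} z (X : List A) → prodOver (λ _ → z) X ≡ z ^ length X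
  prodOver-const z []      = ≡.refl
  prodOver-const z (_ ∷ X) = ≡.cong (z *_) (prodOver-const z X)

  -- v_λ(t) P_λ(X; t), or 0 when λ does not have one (possibly zero) part for every variable.
  sym-HL : List ℕ → List Carrier → Carrier
  sym-HL []       = δ
  sym-HL (a ∷ as) X = sumPicks X (λ y Y → (y ^ a * prodOver (A y) Y) * sym-HL as Y)

  -- The variables carrying the exponents `as` form the left half. They precede the others in the
  -- symmetrized product, so each mixed pair contributes the kernel from left to right.
  sym-HL-++ : ∀ as bs X → sym-HL (as ++ bs) X ≈ (sym-HL as ⊛ sym-HL bs) X
  sym-HL-++ []       bs X = sym (⊛-identityˡ _ X)
  sym-HL-++ (a ∷ as) bs X = begin
    sumPicks X (λ y Y → (y ^ a * prodOver (A y) Y) * sym-HL (as ++ bs) Y)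
      ≈⟨ sumPicks-cong {X = X} (λ y Y _ → trans (*-congˡ (sym-HL-++ as bs Y)) (sym (sumSplits-*ˡ Y _))) ⟩
    sumPicks X (λ y Y → sumSplits Y (λ S T → (y ^ a * prodOver (A y) Y) * (cross A S T * (sym-HL as S * sym-HL bs T))))
      ≈⟨ sumPicks-cong {X = X} (λ y Y _ → sumSplits-cong {X = Y} λ S T p → *-congʳ (*-congˡ (prodOver-splits (A y) S T p))) ⟩
    sumPicks X (λ y Y → sumSplits Y (φ y))
      ≈⟨ sumPicks-splitsˡ X φ ⟩
    sumSplits X (λ S T → sumPicks S (λ y S′ → φ y S′ T))
      ≈⟨ sumSplits-cong {X = X} (λ S T _ → collect S T) ⟩
    (sym-HL (a ∷ as) ⊛ sym-HL bs) X ∎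
    where
    φ : Carrier → List Carrier → List Carrier → Carrier
    φ y S T = (y ^ a * (prodOver (A y) S * prodOver (A y) T)) * (cross A S T * (sym-HL as S * sym-HL bs T))

    collect : ∀ S T → sumPicks S (λ y S′ → φ y S′ T) ≈ cross A S T * (sym-HL (a ∷ as) S * sym-HL bs T)
    collect S T = begin
      sumPicks S (λ y S′ → φ y S′ T)
        ≈⟨ sumPicks-cong {X = S} (λ y S′ p → trans
             (solve 6 (λ ya aS aT c s1 s2 → (ya :* (aS :* aT)) :* (c :* (s1 :* s2)) := ((aT :* c) :* s2) :* ((ya :* aS) :* s1)) refl
               (y ^ a) (prodOver (A y) S′) (prodOver (A y) T) (cross A S′ T) (sym-HL as S′) (sym-HL bs T))
             (*-congʳ (*-congʳ (sym (prodOver-↭ (λ x → prodOver (A x) T) p))))) ⟩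
      sumPicks S (λ y S′ → (cross A S T * sym-HL bs T) * ((y ^ a * prodOver (A y) S′) * sym-HL as S′))
        ≈⟨ sumPicks-*ˡ S _ ⟩
      (cross A S T * sym-HL bs T) * sym-HL (a ∷ as) S
        ≈⟨ solve 3 (λ c s1 s2 → (c :* s2) :* s1 := c :* (s1 :* s2)) refl (cross A S T) (sym-HL (a ∷ as) S) (sym-HL bs T) ⟩
      cross A S T * (sym-HL (a ∷ as) S * sym-HL bs T) ∎

  sym-HL-length : ∀ as X → length as ≢ length X → sym-HL as X ≈ 0#
  sym-HL-length []       []      ≢ = contradiction ≡.refl ≢
  sym-HL-length []       (x ∷ X) ≢ = refl
  sym-HL-length (a ∷ as) X       ≢ = begin
    sumPicks X (λ y Y → (y ^ a * prodOver (A y) Y) * sym-HL as Y)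
      ≈⟨ sumPicks-cong {X = X} (λ y Y p → trans
           (*-congˡ (sym-HL-length as Y λ eq → ≢ (≡.trans (≡.cong suc eq) (≡.sym (↭-length p))))) (trans (zeroʳ _) (sym (zeroʳ 0#)))) ⟩
    sumPicks X (λ y Y → 0# * 0#)
      ≈⟨ trans (sumPicks-*ˡ X 0#) (zeroˡ _) ⟩
    0# ∎

  -- With equal exponents the monomial is symmetric and comes out. The kernel sum that remains gains
  -- one t-integer per picked variable, by `row-sum`.
  sym-HL-replicate : ∀ a {n X} → length X ≡ n → Regular X → sym-HL (replicate n a) X ≈ prodOver (_^ a) X * v n
  sym-HL-replicate a {zero}  {[]} eq reg = sym (trans (*-identityˡ _) v-zero)
  sym-HL-replicate a {suc n} {X}  eq reg = begin
    sumPicks X (λ y Y → (y ^ a * prodOver (A y) Y) * sym-HL (replicate n a) Y)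
      ≈⟨ sumPicks-cong {X = X} (λ y Y p → begin
           (y ^ a * prodOver (A y) Y) * sym-HL (replicate n a) Y
             ≈⟨ *-congˡ (sym-HL-replicate a (ℕ.suc-injective (≡.trans (≡.sym (↭-length p)) eq)) (regular-tail (regular-↭ p reg))) ⟩
           (y ^ a * prodOver (A y) Y) * (prodOver (_^ a) Y * v n)
             ≈⟨ solve 4 (λ ya α m v → (ya :* α) :* (m :* v) := ((ya :* m) :* v) :* α) refl (y ^ a) (prodOver (A y) Y) (prodOver (_^ a) Y) (v n) ⟩
           ((y ^ a * prodOver (_^ a) Y) * v n) * prodOver (A y) Y
             ≈⟨ *-congʳ (*-congʳ (prodOver-↭ (_^ a) p)) ⟨
           (prodOver (_^ a) X * v n) * prodOver (A y) Y ∎) ⟩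
    sumPicks X (λ y Y → (prodOver (_^ a) X * v n) * prodOver (A y) Y)
      ≈⟨ sumPicks-*ˡ X _ ⟩
    (prodOver (_^ a) X * v n) * ΣA
      ≈⟨ *-cancelˡ-nonzero 1-t≉0 (begin
           (1# - t) * ((prodOver (_^ a) X * v n) * ΣA)
             ≈⟨ solve 4 (λ s m v S → s :* ((m :* v) :* S) := m :* (v :* (s :* S))) refl (1# - t) (prodOver (_^ a) X) (v n) ΣA ⟩
           prodOver (_^ a) X * (v n * ((1# - t) * ΣA))
             ≈⟨ *-congˡ (*-congˡ (row-sum (All.map proj₁ (proj₁ reg)) (regular-≉ reg))) ⟩
           prodOver (_^ a) X * (v n * (1# - prodOver (λ _ → t) X))
             ≈⟨ *-congˡ (*-congˡ (+-congˡ (-‿cong (reflexive (≡.trans (prodOver-const t X) (≡.cong (t ^_) eq)))))) ⟩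
           prodOver (_^ a) X * (v n * (1# - t * t ^ n))
             ≈⟨ *-congˡ (v-suc n) ⟨
           prodOver (_^ a) X * (v (suc n) * (1# - t))
             ≈⟨ solve 3 (λ s m v → m :* (v :* s) := s :* (m :* v)) refl (1# - t) (prodOver (_^ a) X) (v (suc n)) ⟩
           (1# - t) * (prodOver (_^ a) X * v (suc n)) ∎) ⟩
    prodOver (_^ a) X * v (suc n) ∎
    where
    ΣA : Carrier
    ΣA = sumPicks X (λ y Y → prodOver (A y) Y)

  level : (ℕ → Carrier) → ℕ → List Carrier → Carrier
  level f i S = f (length S) * sym-HL (replicate (length S) i) S

  weightedSum : (ℕ → ℕ → Carrier) → ℕ → List Carrier → Carrier
  weightedSum g b X = sumParts (length X) b (λ μ → weight g b μ * sym-HL μ X)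

  count-replicate-self : ∀ k i → count i (replicate k i) ≡ k
  count-replicate-self zero    i = ≡.refl
  count-replicate-self (suc k) i rewrite ≡ᵇ-refl i = ≡.cong suc (count-replicate-self k i)

  weightedSum-zero : ∀ g X → weightedSum g 0 X ≡ level (g 0) 0 X
  weightedSum-zero g X = ≡.trans (sumParts-zero (length X) _)
    (≡.cong (λ k → g 0 k * sym-HL (replicate (length X) 0) X) (count-replicate-self (length X) 0))

  -- Only the splittings in which S receives the parts equal to b + 1 contribute.
  weightedSum-top : ∀ g b f X →
    sumParts (length X) (suc b) (λ μ → (weight g b μ * f (count (suc b) μ)) * sym-HL μ X)
      ≈ (level f (suc b) ⊛ weightedSum g b) X
  weightedSum-top g b f X = begin
    sumParts (length X) (suc b) (λ μ → (weight g b μ * f (count (suc b) μ)) * sym-HL μ X)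
      ≈⟨ sumParts-suc (length X) b _ ⟩
    sumAntidiagonal (length X) (λ k l → sumParts l b (λ μ → (weight g b (top k ++ μ) * f (count (suc b) (top k ++ μ))) * sym-HL (top k ++ μ) X))
      ≈⟨ sumAntidiagonal-cong (length X) (λ k l _ → factor k l) ⟩
    sumAntidiagonal (length X) (λ k l → sumSplits X (φ k l))
      ≈⟨ sumAntidiagonal-splits (length X) X φ ⟩
    sumSplits X (λ S T → sumAntidiagonal (length X) (λ k l → φ k l S T))
      ≈⟨ sumSplits-cong {X = X} (λ S T p → trans
           (reflexive (≡.cong (λ n → sumAntidiagonal n (λ k l → φ k l S T)) (≡.trans (↭-length p) (length-++ S))))
           (sumAntidiagonal-single (length S) (length T) (λ k l k≢ → vanish k l S T k≢))) ⟩
    (level f (suc b) ⊛ weightedSum g b) X ∎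
    where
    top : ℕ → List ℕ
    top k = replicate k (suc b)

    φ : ℕ → ℕ → List Carrier → List Carrier → Carrier
    φ k l S T = cross A S T * ((f k * sym-HL (top k) S) * sumParts l b (λ μ → weight g b μ * sym-HL μ T))

    vanish : ∀ k l S T → k ≢ length S → φ k l S T ≈ 0#
    vanish k l S T k≢ = trans (*-congˡ (trans (*-congʳ (trans
      (*-congˡ (sym-HL-length (top k) S (λ eq → k≢ (≡.trans (≡.sym (length-replicate k)) eq)))) (zeroʳ _))) (zeroˡ _))) (zeroʳ _)

    factor : ∀ k l → sumParts l b (λ μ → (weight g b (top k ++ μ) * f (count (suc b) (top k ++ μ))) * sym-HL (top k ++ μ) X) ≈ sumSplits X (φ k l)
    factor k l = begin
      sumParts l b (λ μ → (weight g b (top k ++ μ) * f (count (suc b) (top k ++ μ))) * sym-HL (top k ++ μ) X)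
        ≈⟨ sumParts-cong l b (λ μ _ μ≤b → trans
             (*-cong (reflexive (weight-replicate g f b k μ≤b)) (sym-HL-++ (top k) μ X)) (sym (sumSplits-*ˡ X _))) ⟩
      sumParts l b (λ μ → sumSplits X (λ S T → (weight g b μ * f k) * (cross A S T * (sym-HL (top k) S * sym-HL μ T))))
        ≈⟨ sumParts-splits l b X _ ⟩
      sumSplits X (λ S T → sumParts l b (λ μ → (weight g b μ * f k) * (cross A S T * (sym-HL (top k) S * sym-HL μ T))))
        ≈⟨ sumSplits-cong {X = X} (λ S T _ → begin
             sumParts l b (λ μ → (weight g b μ * f k) * (cross A S T * (sym-HL (top k) S * sym-HL μ T)))
               ≈⟨ sumParts-cong l b (λ μ _ _ → solve 5 (λ w f c s s′ → (w :* f) :* (c :* (s :* s′)) := (c :* (f :* s)) :* (w :* s′)) refl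
                    (weight g b μ) (f k) (cross A S T) (sym-HL (top k) S) (sym-HL μ T)) ⟩
             sumParts l b (λ μ → (cross A S T * (f k * sym-HL (top k) S)) * (weight g b μ * sym-HL μ T))
               ≈⟨ trans (sumParts-*ˡ l b _) (*-assoc _ _ _) ⟩
             φ k l S T ∎) ⟩
      sumSplits X (φ k l) ∎

  sumL-upTo : ∀ n (ψ : ℕ → ℕ → Carrier) → sumL (map (λ j → ψ j (n ℕ.∸ j)) (upTo (suc n))) ≈ sumAntidiagonal n ψ
  sumL-upTo n ψ = trans (reflexive (≡.cong sumL (map-upTo _ (suc n)))) (go n ψ)
    where
    go : ∀ n (ψ : ℕ → ℕ → Carrier) → sumL (applyUpTo (λ j → ψ j (n ℕ.∸ j)) (suc n)) ≈ sumAntidiagonal n ψ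
    go zero    ψ = +-identityʳ _
    go (suc n) ψ = +-congˡ (go n (λ k l → ψ (suc k) l))

  PochNonzero : ℕ → Set ℓ
  PochNonzero n = ∀ k → k ℕ.≤ n → poch t t k ≉ 0#

  -- Splitting the exponent vector 0^n into 0^j and 0^l shows that the kernels of all splittings
  -- with j variables on the left add up to v_n/(v_j v_l), a t-binomial coefficient. Hence the right
  -- side depends on `X` only through its length.
  rogersSzego-⊛ : ∀ z {n X} → length X ≡ n → PochNonzero n → Regular X →
    rogersSzego n z t ≈ (prodOver (λ _ → z) ⊛ ones) X
  rogersSzego-⊛ z {n} {X} eq p≉0 reg = begin
    rogersSzego n z t
      ≈⟨ sumL-upTo n (λ j l → z ^ j * (poch t t n * (poch t t j * poch t t l) ⁻¹)) ⟩
    sumAntidiagonal n (λ j l → z ^ j * (poch t t n * (poch t t j * poch t t l) ⁻¹))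
      ≈⟨ sumAntidiagonal-cong n term ⟩
    sumAntidiagonal n (λ j l → sumSplits X (φ j l))
      ≈⟨ sumAntidiagonal-splits n X φ ⟩
    sumSplits X (λ S T → sumAntidiagonal n (λ j l → φ j l S T))
      ≈⟨ sumSplits-cong {X = X} single ⟩
    (prodOver (λ _ → z) ⊛ ones) X ∎
    where
    φ : ℕ → ℕ → List Carrier → List Carrier → Carrier
    φ j l S T = (z ^ j * (v j * v l) ⁻¹) * (cross A S T * (sym-HL (replicate j 0) S * sym-HL (replicate l 0) T))

    v≉0 : ∀ k → k ℕ.≤ n → v k ≉ 0#
    v≉0 k k≤n = v-nonzero k (p≉0 k k≤n)

    -- The powers of 1 - t in the three factors `v` cancel because j + l = n.
    quotient : ∀ j l → j ℕ.+ l ≡ n → poch t t n * (poch t t j * poch t t l) ⁻¹ ≈ v n * (v j * v l) ⁻¹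
    quotient j l ≡.refl = /-≈ (*-nonzero (p≉0 j j≤) (p≉0 l l≤)) (*-nonzero (v≉0 j j≤) (v≉0 l l≤)) (begin
      poch t t (j ℕ.+ l) * (v j * v l)
        ≈⟨ solve 5 (λ p q r a b → p :* ((q :* a) :* (r :* b)) := p :* (a :* b) :* (q :* r)) refl
             (poch t t (j ℕ.+ l)) (poch t t j) (poch t t l) (((1# - t) ^ j) ⁻¹) (((1# - t) ^ l) ⁻¹) ⟩
      poch t t (j ℕ.+ l) * (((1# - t) ^ j) ⁻¹ * ((1# - t) ^ l) ⁻¹) * (poch t t j * poch t t l)
        ≈⟨ *-congʳ (*-congˡ (trans (sym (⁻¹-distrib-* (^-nonzero j 1-t≉0) (^-nonzero l 1-t≉0)))
             (sym (⁻¹-cong (^-nonzero (j ℕ.+ l) 1-t≉0) (^-+ _ j l))))) ⟩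
      v (j ℕ.+ l) * (poch t t j * poch t t l) ∎)
      where
      j≤ = ℕ.m≤m+n j l
      l≤ = ℕ.m≤n+m l j

    replicate-++ : ∀ j l → replicate j 0 ++ replicate l 0 ≡ replicate (j ℕ.+ l) 0
    replicate-++ zero    l = ≡.refl
    replicate-++ (suc j) l = ≡.cong (0 ∷_) (replicate-++ j l)

    term : ∀ j l → j ℕ.+ l ≡ n → z ^ j * (poch t t n * (poch t t j * poch t t l) ⁻¹) ≈ sumSplits X (φ j l)
    term j l j+l≡n = begin
      z ^ j * (poch t t n * (poch t t j * poch t t l) ⁻¹)
        ≈⟨ *-congˡ (quotient j l j+l≡n) ⟩
      z ^ j * (v n * (v j * v l) ⁻¹)
        ≈⟨ solve 3 (λ z v w → z :* (v :* w) := (z :* w) :* v) refl (z ^ j) (v n) ((v j * v l) ⁻¹) ⟩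
      (z ^ j * (v j * v l) ⁻¹) * v n
        ≈⟨ *-congˡ (begin
             v n                                          ≈⟨ trans (*-congʳ (prodOver-1 X)) (*-identityˡ _) ⟨
             prodOver (_^ 0) X * v n                      ≈⟨ sym-HL-replicate 0 eq reg ⟨
             sym-HL (replicate n 0) X                     ≡⟨ ≡.cong (λ μ → sym-HL μ X) (≡.sym (≡.trans (replicate-++ j l) (≡.cong (λ k → replicate k 0) j+l≡n))) ⟩
             sym-HL (replicate j 0 ++ replicate l 0) X    ≈⟨ sym-HL-++ (replicate j 0) (replicate l 0) X ⟩
             (sym-HL (replicate j 0) ⊛ sym-HL (replicate l 0)) X ∎) ⟩
      (z ^ j * (v j * v l) ⁻¹) * (sym-HL (replicate j 0) ⊛ sym-HL (replicate l 0)) X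
        ≈⟨ sumSplits-*ˡ X _ ⟨
      sumSplits X (φ j l) ∎

    single : ∀ S T → X ↭ S ++ T → sumAntidiagonal n (λ j l → φ j l S T) ≈ cross A S T * (prodOver (λ _ → z) S * 1#)
    single S T p = begin
      sumAntidiagonal n (λ j l → φ j l S T)
        ≡⟨ ≡.cong (λ k → sumAntidiagonal k (λ j l → φ j l S T)) (≡.sym s+t≡n) ⟩
      sumAntidiagonal (length S ℕ.+ length T) (λ j l → φ j l S T)
        ≈⟨ sumAntidiagonal-single (length S) (length T) (λ j l j≢ → trans (*-congˡ (trans (*-congˡ (trans (*-congʳ
             (sym-HL-length (replicate j 0) S (λ e → j≢ (≡.trans (≡.sym (length-replicate j)) e)))) (zeroˡ _))) (zeroʳ _))) (zeroʳ _)) ⟩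
      (z ^ s * (v s * v u) ⁻¹) * (cross A S T * (sym-HL (replicate s 0) S * sym-HL (replicate u 0) T))
        ≈⟨ *-congˡ (*-congˡ (*-cong (only-v S (regular-splitˡ S p reg)) (only-v T (regular-splitʳ S p reg)))) ⟩
      (z ^ s * (v s * v u) ⁻¹) * (cross A S T * (v s * v u))
        ≈⟨ solve 4 (λ z w′ c w → (z :* w′) :* (c :* w) := (w :* w′) :* (c :* (z :* con (+ 1)))) refl (z ^ s) ((v s * v u) ⁻¹) (cross A S T) (v s * v u) ⟩
      ((v s * v u) * (v s * v u) ⁻¹) * (cross A S T * (z ^ s * 1#))
        ≈⟨ trans (*-congʳ (inverseʳ _ (*-nonzero (v≉0 s s≤n) (v≉0 u u≤n)))) (*-identityˡ _) ⟩
      cross A S T * (z ^ s * 1#)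
        ≡⟨ ≡.cong (λ k → cross A S T * (k * 1#)) (prodOver-const z S) ⟨
      cross A S T * (prodOver (λ _ → z) S * 1#) ∎
      where
      s = length S
      u = length T
      s+t≡n : s ℕ.+ u ≡ n
      s+t≡n = ≡.trans (≡.sym (≡.trans (↭-length p) (length-++ S))) eq
      s≤n : s ℕ.≤ n
      s≤n = ℕ.≤-trans (ℕ.m≤m+n s u) (ℕ.≤-reflexive s+t≡n)
      u≤n : u ℕ.≤ n
      u≤n = ℕ.≤-trans (ℕ.m≤n+m u s) (ℕ.≤-reflexive s+t≡n)

      only-v : ∀ S → Regular S → sym-HL (replicate (length S) 0) S ≈ v (length S)
      only-v S S-reg = trans (sym-HL-replicate 0 ≡.refl S-reg) (trans (*-congʳ (prodOver-1 S)) (*-identityˡ _))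

-- The defining sums and products rewritten over lists.

module DefinitionUnfolding {c ℓ : Level} (R : CommutativeRing c ℓ)
  (_⁻¹ : CommutativeRing.Carrier R → CommutativeRing.Carrier R) where
  open CommutativeRing R hiding (zero)
  open Alg R _⁻¹
  open import Relation.Binary.Reasoning.Setoid setoid
  open ListSums R
  open ListProducts R
  open PartitionSums R

  private variable
    i j : Level
    I : Set i
    J : Set j

  sumL-++ : ∀ xs ys → sumL (xs ++ ys) ≈ sumL xs + sumL ys
  sumL-++ []       ys = sym (+-identityˡ _)
  sumL-++ (x ∷ xs) ys = trans (+-congˡ (sumL-++ xs ys)) (sym (+-assoc _ _ _))

  sumL-cong : ∀ {f g : I → Carrier} → (∀ x → f x ≈ g x) → ∀ xs → sumL (map f xs) ≈ sumL (map g xs)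
  sumL-cong h []       = refl
  sumL-cong h (x ∷ xs) = +-cong (h x) (sumL-cong h xs)

  sumL-concatMap : ∀ (f : J → Carrier) (g : I → List J) xs →
    sumL (map f (concatMap g xs)) ≈ sumL (map (λ x → sumL (map f (g x))) xs)
  sumL-concatMap f g []       = refl
  sumL-concatMap f g (x ∷ xs) = begin
    sumL (map f (g x ++ concatMap g xs))              ≡⟨ ≡.cong sumL (map-++ f (g x) _) ⟩
    sumL (map f (g x) ++ map f (concatMap g xs))      ≈⟨ sumL-++ (map f (g x)) _ ⟩
    sumL (map f (g x)) + sumL (map f (concatMap g xs)) ≈⟨ +-congˡ (sumL-concatMap f g xs) ⟩
    _                                                  ∎

  sumL-map-map : ∀ (f : J → Carrier) (g : I → J) xs → sumL (map f (map g xs)) ≡ sumL (map (λ x → f (g x)) xs)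
  sumL-map-map f g xs = ≡.cong sumL (≡.sym (map-∘ xs))

  sumL-partitions : ∀ n b (φ : List ℕ → Carrier) → sumL (map (λ μ → φ (toList μ)) (partitionsLE n b)) ≈ sumParts n b φ
  sumL-partitions zero    b φ = +-identityʳ _
  sumL-partitions (suc n) b φ = begin
    sumL (map (λ μ → φ (toList μ)) (partitionsLE (suc n) b))
      ≈⟨ sumL-concatMap (λ μ → φ (toList μ)) (λ a → map (a ∷_) (partitionsLE n a)) (upTo (suc b)) ⟩
    sumL (map (λ a → sumL (map (λ μ → φ (toList μ)) (map (a ∷_) (partitionsLE n a)))) (upTo (suc b)))
      ≈⟨ sumL-cong (λ a → trans (reflexive (sumL-map-map (λ μ → φ (toList μ)) (a ∷_) (partitionsLE n a))) (sumL-partitions n a (λ μ → φ (a ∷ μ)))) (upTo (suc b)) ⟩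
    sumL (map first (upTo (suc b)))
      ≈⟨ by-first-part b ⟩
    sumParts (suc n) b φ ∎
    where
    first : ℕ → Carrier
    first a = sumParts n a (λ μ → φ (a ∷ μ))

    by-first-part : ∀ b → sumL (map first (upTo (suc b))) ≈ sumParts (suc n) b φ
    by-first-part zero    = +-identityʳ _
    by-first-part (suc b) = begin
      sumL (map first (upTo (suc (suc b))))           ≡⟨ ≡.cong (sumL ∘ map first) (upTo-∷ʳ (suc b)) ⟨
      sumL (map first (upTo (suc b) ++ suc b ∷ []))   ≡⟨ ≡.cong sumL (map-++ first (upTo (suc b)) _) ⟩
      sumL (map first (upTo (suc b)) ++ first (suc b) ∷ []) ≈⟨ sumL-++ (map first (upTo (suc b))) _ ⟩
      sumL (map first (upTo (suc b))) + (first (suc b) + 0#) ≈⟨ +-cong (by-first-part b) (+-identityʳ _) ⟩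
      sumParts (suc n) (suc b) φ                      ∎

  prodFin-tabulate : ∀ {n} (f : I → Carrier) (x : Fin n → I) → prodFin (λ i → f (x i)) ≈ prodOver f (tabulate x)
  prodFin-tabulate f x = trans (reflexive (≡.cong prodL (map-tabulate (λ i → i) (λ i → f (x i))))) (go x)
    where
    go : ∀ {n} (x : Fin n → _) → prodL (tabulate (λ i → f (x i))) ≈ prodOver f (tabulate x)
    go {zero}  x = refl
    go {suc n} x = *-congˡ (go (λ i → x (Fin.suc i)))

  prodFin-suc : ∀ {n} (f : Fin (suc n) → Carrier) → prodFin f ≡ f Fin.zero * prodFin (λ i → f (Fin.suc i))
  prodFin-suc f = ≡.trans (≡.cong prodL (map-tabulate (λ i → i) f))
    (≡.cong (λ z → f Fin.zero * prodL z) (≡.sym (map-tabulate (λ i → i) (λ i → f (Fin.suc i)))))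

  prodFin-cong : ∀ {n} {f g : Fin n → Carrier} → (∀ i → f i ≈ g i) → prodFin f ≈ prodFin g
  prodFin-cong {zero}  h = refl
  prodFin-cong {suc n} {f} {g} h = trans (reflexive (prodFin-suc f))
    (trans (*-cong (h Fin.zero) (prodFin-cong (λ i → h (Fin.suc i)))) (reflexive (≡.sym (prodFin-suc g))))

  prodPairs-tabulate : ∀ {n} (f : I → I → Carrier) (x : Fin n → I) →
    prodPairs (λ i j → f (x i) (x j)) ≈ pairProd f (tabulate x)
  prodPairs-tabulate {n = zero}  f x = refl
  prodPairs-tabulate {n = suc n} f x = begin
    prodFin (λ i → prodFin (λ j → if toℕ i <ᵇ toℕ j then f (x i) (x j) else 1#))
      ≡⟨ prodFin-suc (λ i → prodFin (λ j → if toℕ i <ᵇ toℕ j then f (x i) (x j) else 1#)) ⟩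
    prodFin (λ j → if 0 <ᵇ toℕ j then f (x Fin.zero) (x j) else 1#)
      * prodFin (λ i → prodFin (λ j → if suc (toℕ i) <ᵇ toℕ j then f (x (Fin.suc i)) (x j) else 1#))
      ≈⟨ *-cong
           (trans (reflexive (prodFin-suc (λ j → if 0 <ᵇ toℕ j then f (x Fin.zero) (x j) else 1#)))
             (trans (*-identityˡ _) (prodFin-tabulate (f (x Fin.zero)) (λ j → x (Fin.suc j)))))
           (prodFin-cong (λ i → trans (reflexive (prodFin-suc (λ j → if suc (toℕ i) <ᵇ toℕ j then f (x (Fin.suc i)) (x j) else 1#))) (*-identityˡ _))) ⟩
    prodOver (f (x Fin.zero)) (tabulate (λ j → x (Fin.suc j)))
      * prodPairs (λ i j → f (x (Fin.suc i)) (x (Fin.suc j)))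
      ≈⟨ *-congˡ (prodPairs-tabulate f (λ j → x (Fin.suc j))) ⟩
    pairProd f (tabulate x) ∎

  sumPerms : ℕ → List I → (List I → Carrier) → Carrier
  sumPerms zero    X φ = φ []
  sumPerms (suc n) X φ = sumPicks X (λ y Y → sumPerms n Y (λ Z → φ (y ∷ Z)))

  -- `punchIn k` runs in order through the positions other than k, so it tabulates exactly what is
  -- left after picking entry k.
  sumPicks-tabulate : ∀ {n} (x : Fin (suc n) → I) (ψ : I → List I → Carrier) →
    sumL (map (λ k → ψ (x k) (tabulate (λ i → x (punchIn k i)))) (allFin (suc n))) ≈ sumPicks (tabulate x) ψ
  sumPicks-tabulate {n = n} x ψ = trans
    (reflexive (≡.cong sumL (map-tabulate (λ i → i) (λ k → ψ (x k) (tabulate (λ i → x (punchIn k i))))))) (go n x ψ)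
    where
    go : ∀ n (x : Fin (suc n) → _) (ψ : _ → List _ → Carrier) →
      sumL (tabulate (λ k → ψ (x k) (tabulate (λ i → x (punchIn k i))))) ≈ sumPicks (tabulate x) ψ
    go zero    x ψ = refl
    go (suc n) x ψ = +-congˡ (go n (λ i → x (Fin.suc i)) (λ y Y → ψ y (x Fin.zero ∷ Y)))

  -- The equation, proved by `refl`, lets `h` be inferred: the extension of a permutation inside
  -- `perms` is an anonymous function that cannot be written down again.
  sumL-concatMap-map : ∀ {k} {K : Set k} (f : K → Carrier) {h : I → J → K} {xs ys zs} →
    zs ≡ concatMap (λ x → map (h x) ys) xs → sumL (map f zs) ≈ sumL (map (λ x → sumL (map (λ y → f (h x y)) ys)) xs)
  sumL-concatMap-map f {h} {xs} {ys} ≡.refl = trans (sumL-concatMap f (λ x → map (h x) ys) xs)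
    (sumL-cong (λ x → reflexive (sumL-map-map f (h x) ys)) xs)

  sumL-perms : ∀ {n} (x : Fin n → I) (φ : List I → Carrier) →
    sumL (map (λ σ → φ (tabulate (λ i → x (σ i)))) (perms n)) ≈ sumPerms n (tabulate x) φ
  sumL-perms {n = zero}  x φ = +-identityʳ _
  sumL-perms {n = suc n} x φ = trans
    (sumL-concatMap-map (λ σ → φ (tabulate (λ i → x (σ i)))) {xs = allFin (suc n)} {perms n} ≡.refl)
    (trans
      (sumL-cong (λ k → sumL-perms (λ i → x (punchIn k i)) (λ Z → φ (x k ∷ Z))) (allFin (suc n)))
      (sumPicks-tabulate x (λ y Y → sumPerms n Y (λ Z → φ (y ∷ Z)))))

  sumPerms-cong : ∀ n {X : List I} {φ ψ} → length X ≡ n → (∀ Z → X ↭ Z → φ Z ≈ ψ Z) → sumPerms n X φ ≈ sumPerms n X ψ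
  sumPerms-cong zero    {[]} eq h = h [] Perm.↭-refl
  sumPerms-cong (suc n) {X}  eq h = sumPicks-cong λ y Y p →
    sumPerms-cong n (ℕ.suc-injective (≡.trans (≡.sym (↭-length p)) eq)) λ Z q → h (y ∷ Z) (Perm.↭-trans p (Perm.prep y q))

  sumPerms-+ : ∀ n (X : List I) {φ ψ} → sumPerms n X (λ Z → φ Z + ψ Z) ≈ sumPerms n X φ + sumPerms n X ψ
  sumPerms-+ zero    X = refl
  sumPerms-+ (suc n) X = trans (sumPicks-cong {X = X} λ y Y _ → sumPerms-+ n Y) (sumPicks-+ X)

  sumPerms-*ˡ : ∀ n (X : List I) {φ} k → sumPerms n X (λ Z → k * φ Z) ≈ k * sumPerms n X φ
  sumPerms-*ˡ zero    X k = refl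
  sumPerms-*ˡ (suc n) X k = trans (sumPicks-cong {X = X} λ y Y _ → sumPerms-*ˡ n Y k) (sumPicks-*ˡ X k)

  sumPicks-map : ∀ (g : I → J) X ψ → sumPicks (map g X) ψ ≡ sumPicks X (λ y Y → ψ (g y) (map g Y))
  sumPicks-map g []      ψ = ≡.refl
  sumPicks-map g (x ∷ X) ψ = ≡.cong (λ s → ψ (g x) (map g X) + s) (sumPicks-map g X _)

  sumPerms-map : ∀ n (g : I → J) X φ → sumPerms n (map g X) φ ≈ sumPerms n X (λ Z → φ (map g Z))
  sumPerms-map zero    g X φ = refl
  sumPerms-map (suc n) g X φ = trans (reflexive (sumPicks-map g X _)) (sumPicks-cong {X = X} λ y Y _ → sumPerms-map n g Y _)

  prodRange-cong : ∀ {f g : ℕ → Carrier} k → (∀ i → f i ≈ g i) → prodRange f k ≈ prodRange g k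
  prodRange-cong zero    h = refl
  prodRange-cong (suc k) h = *-cong (prodRange-cong k h) (h (suc k))

  mult-toList : ∀ {n} i (μ : Vec ℕ n) → mult i μ ≡ count i (toList μ)
  mult-toList i []      = ≡.refl
  mult-toList i (a ∷ μ) = ≡.cong ((if a ≡ᵇ i then 1 else 0) ℕ.+_) (mult-toList i μ)

  count≤length : ∀ i μ → count i μ ℕ.≤ length μ
  count≤length i []      = z≤n
  count≤length i (a ∷ μ) = ℕ.+-mono-≤ (bit (a ≡ᵇ i)) (count≤length i μ)
    where
    bit : ∀ b → (if b then 1 else 0) ℕ.≤ 1
    bit true  = ℕ.≤-refl
    bit false = z≤n

  monomial : List ℕ → List Carrier → Carrier
  monomial (a ∷ as) (z ∷ Z) = z ^ a * monomial as Z
  monomial _        _       = 1#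

  mono-monomial : ∀ {n} (y : Fin n → Carrier) (μ : Vec ℕ n) → mono y μ ≈ monomial (toList μ) (tabulate y)
  mono-monomial y []      = refl
  mono-monomial y (a ∷ μ) = trans (reflexive (prodFin-suc (λ i → y i ^ lookup (a ∷ μ) i)))
    (*-congˡ (mono-monomial (λ i → y (Fin.suc i)) μ))

-- The left side as an iterated product.

module LeftSide {c ℓ : Level} (R : CommutativeRing c ℓ)
  (_⁻¹ : CommutativeRing.Carrier R → CommutativeRing.Carrier R)
  (inverseʳ : Alg.FieldInv R _⁻¹) (t : CommutativeRing.Carrier R)
  (t≉1 : ¬ CommutativeRing._≈_ R t (CommutativeRing.1# R)) where
  open CommutativeRing R hiding (zero)
  open Alg R _⁻¹
  open import Relation.Binary.Reasoning.Setoid setoid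
  open import Algebra.Properties.CommutativeSemigroup *-commutativeSemigroup
    using () renaming (interchange to *-interchange)
  open IntegerSolver R using (solve; _:=_; _:*_)
  open FieldLemmas R _⁻¹ inverseʳ
  open ListSums R
  open ListProducts R
  open PartitionSums R
  open HallLittlewoodKernel R _⁻¹ inverseʳ t
  open SignedSums R _⁻¹ inverseʳ t
  open BoundedLittlewood R _⁻¹ inverseʳ t
  open HallLittlewoodSums R _⁻¹ inverseʳ t t≉1
  open DefinitionUnfolding R _⁻¹

  level-v⁻¹ : ∀ i S → PochNonzero (length S) → Regular S → level (λ k → v k ⁻¹) i S ≈ prodOver (_^ i) S
  level-v⁻¹ i S p≉0 reg = begin
    v n ⁻¹ * sym-HL (replicate n i) S     ≈⟨ *-congˡ (sym-HL-replicate i ≡.refl reg) ⟩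
    v n ⁻¹ * (prodOver (_^ i) S * v n)    ≈⟨ solve 3 (λ w m v → w :* (m :* v) := (v :* w) :* m) refl (v n ⁻¹) (prodOver (_^ i) S) (v n) ⟩
    (v n * v n ⁻¹) * prodOver (_^ i) S    ≈⟨ trans (*-congʳ (inverseʳ _ (v-nonzero n (p≉0 n ℕ.≤-refl)))) (*-identityˡ _) ⟩
    prodOver (_^ i) S                     ∎
    where n = length S

  pochNonzero-≤ : ∀ {k n} → k ℕ.≤ n → PochNonzero n → PochNonzero k
  pochNonzero-≤ k≤n p≉0 j j≤k = p≉0 j (ℕ.≤-trans j≤k k≤n)

  splitˡ-≤ : ∀ {X : List Carrier} S {T} → X ↭ S ++ T → length S ℕ.≤ length X
  splitˡ-≤ S p = ℕ.≤-trans (ℕ.m≤m+n _ _) (ℕ.≤-reflexive (≡.sym (≡.trans (↭-length p) (length-++ S))))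

  splitʳ-≤ : ∀ {X : List Carrier} S {T} → X ↭ S ++ T → length T ℕ.≤ length X
  splitʳ-≤ S p = ℕ.≤-trans (ℕ.m≤n+m _ _) (ℕ.≤-reflexive (≡.sym (≡.trans (↭-length p) (length-++ S))))

  module _ (z : Carrier) where

    -- The part 0 gets no Rogers-Szegő factor because h^(m) starts at i = 1. The part m, which has
    -- none either, is treated separately.
    g : ℕ → ℕ → Carrier
    g zero    k = v k ⁻¹
    g (suc i) k = rogersSzego k z t * v k ⁻¹

    -- The left side for m = b + 1 without its leftmost factor, the one belonging to the parts equal
    -- to m.
    chain : ℕ → List Carrier → Carrier
    chain zero    = ones
    chain (suc b) = twist (_^ suc b) (λ S → rogersSzego (length S) z t) ⊛ chain b

    weightedSum-chain : ∀ b X → PochNonzero (length X) → Regular X → weightedSum g b X ≈ chain b X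
    weightedSum-chain zero    X p≉0 reg = trans (reflexive (weightedSum-zero g X)) (trans (level-v⁻¹ 0 X p≉0 reg) (prodOver-1 X))
    weightedSum-chain (suc b) X p≉0 reg = trans (weightedSum-top g b (g (suc b)) X) (⊛-cong X
      (λ S T p → begin
        (rogersSzego (length S) z t * v (length S) ⁻¹) * sym-HL (replicate (length S) (suc b)) S
          ≈⟨ *-assoc _ _ _ ⟩
        rogersSzego (length S) z t * level (λ k → v k ⁻¹) (suc b) S
          ≈⟨ *-congˡ (level-v⁻¹ (suc b) S (pochNonzero-≤ (splitˡ-≤ S p) p≉0) (regular-splitˡ S p reg)) ⟩
        rogersSzego (length S) z t * prodOver (_^ suc b) S
          ≈⟨ *-comm _ _ ⟩
        prodOver (_^ suc b) S * rogersSzego (length S) z t ∎)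
      (λ S T p → weightedSum-chain b T (pochNonzero-≤ (splitʳ-≤ S p) p≉0) (regular-splitʳ S p reg)))

  -- Writing H = e ⊛ 1 in the outermost factor and reassociating puts a twisted 1 next to the
  -- shorter chain, which is the preceding case. What stands to its left is the factor of
  -- `bounded-suc`.
  chain-bounded : ∀ a m X → PochNonzero (length X) → Regular X →
    (prodOver (_^ suc m) ⊛ chain (- a) m) X ≈ bounded a (suc m) X
  chain-bounded a zero    X p≉0 reg = sym (bounded-1 a reg)
  chain-bounded a (suc m) X p≉0 reg = begin
    (M (suc (suc m)) ⊛ (twist (_^ suc m) H ⊛ chain (- a) m)) X
      ≈⟨ ⊛-cong X (λ _ _ _ → refl) (λ S T p → ⊛-cong T
           (λ U V q → trans
             (*-congˡ (rogersSzego-⊛ (- a) ≡.refl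
               (pochNonzero-≤ (ℕ.≤-trans (splitˡ-≤ U q) (splitʳ-≤ S p)) p≉0) (regular-splitˡ U q (regular-splitʳ S p reg))))
             (trans (twist-⊛ (_^ suc m) (prodOver (λ _ → - a)) ones U) (⊛-cong U (λ _ _ _ → refl) (λ _ W _ → *-identityʳ _))))
           (λ _ _ _ → refl)) ⟩
    (M (suc (suc m)) ⊛ ((Z ⊛ M (suc m)) ⊛ chain (- a) m)) X
      ≈⟨ ⊛-cong X (λ _ _ _ → refl) (λ S T p → ⊛-assoc Z (M (suc m)) (chain (- a) m) T) ⟩
    (M (suc (suc m)) ⊛ (Z ⊛ (M (suc m) ⊛ chain (- a) m))) X
      ≈⟨ ⊛-assoc (M (suc (suc m))) Z _ X ⟨
    ((M (suc (suc m)) ⊛ Z) ⊛ (M (suc m) ⊛ chain (- a) m)) X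
      ≈⟨ ⊛-cong X (λ _ _ _ → refl) (λ S T p → chain-bounded a m T (pochNonzero-≤ (splitʳ-≤ S p) p≉0) (regular-splitʳ S p reg)) ⟩
    ((M (suc (suc m)) ⊛ Z) ⊛ bounded a (suc m)) X
      ≈⟨ bounded-suc a (suc m) reg ⟨
    bounded a (suc (suc m)) X ∎
    where
    M : ℕ → List Carrier → Carrier
    M k = prodOver (_^ k)
    H Z : List Carrier → Carrier
    H S = rogersSzego (length S) (- a) t
    Z = twist (_^ suc m) (prodOver (λ _ → - a))

  sumPerms-HL : ∀ as X → length X ≡ length as → sumPerms (length as) X (λ Z → monomial as Z * pairProd A Z) ≈ sym-HL as X
  sumPerms-HL []       []      eq = *-identityˡ 1#
  sumPerms-HL (a ∷ as) X       eq = sumPicks-cong {X = X} λ y Y p → begin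
    sumPerms (length as) Y (λ Z → (y ^ a * monomial as Z) * (prodOver (A y) Z * pairProd A Z))
      ≈⟨ sumPerms-cong (length as) (length≡ p) (λ Z q → trans (*-interchange _ _ _ _) (*-congʳ (*-congˡ (sym (prodOver-↭ (A y) q))))) ⟩
    sumPerms (length as) Y (λ Z → (y ^ a * prodOver (A y) Y) * (monomial as Z * pairProd A Z))
      ≈⟨ sumPerms-*ˡ (length as) Y _ ⟩
    (y ^ a * prodOver (A y) Y) * sumPerms (length as) Y (λ Z → monomial as Z * pairProd A Z)
      ≈⟨ *-congˡ (sumPerms-HL as Y (length≡ p)) ⟩
    (y ^ a * prodOver (A y) Y) * sym-HL as Y ∎
    where
    length≡ : ∀ {y Y} → X ↭ y ∷ Y → length Y ≡ length as
    length≡ p = ℕ.suc-injective (≡.trans (≡.sym (↭-length p)) eq)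

  vfac-count : ℕ → List ℕ → Carrier
  vfac-count b μ = prodRange (λ i → v (count (i ℕ.∸ 1) μ)) (suc b)

  vfac-toList : ∀ {n} b (μ : Vec ℕ n) → vfac b μ t ≈ vfac-count b (toList μ)
  vfac-toList b μ = prodRange-cong (suc b) (λ i → reflexive (≡.cong v (mult-toList (i ℕ.∸ 1) μ)))

  HL-sym-HL : ∀ {n} b (μ : Vec ℕ n) (x : Fin n → Carrier) →
    HL b μ t x ≈ vfac b μ t ⁻¹ * sym-HL (toList μ) (tabulate x)
  HL-sym-HL {n} b μ x = *-congˡ (begin
    _ ≈⟨ sumL-cong (λ σ → *-cong (mono-monomial (λ i → x (σ i)) μ) (prodPairs-tabulate A (λ i → x (σ i)))) (perms n) ⟩
    _ ≈⟨ sumL-perms x (λ Z → monomial (toList μ) Z * pairProd A Z) ⟩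
    sumPerms n (tabulate x) (λ Z → monomial (toList μ) Z * pairProd A Z)
      ≡⟨ ≡.cong (λ k → sumPerms k (tabulate x) (λ Z → monomial (toList μ) Z * pairProd A Z)) (≡.sym (length-toList μ)) ⟩
    sumPerms (length (toList μ)) (tabulate x) (λ Z → monomial (toList μ) Z * pairProd A Z)
      ≈⟨ sumPerms-HL (toList μ) (tabulate x) (≡.trans (length-tabulate x) (≡.sym (length-toList μ))) ⟩
    sym-HL (toList μ) (tabulate x) ∎)

  module _ {n : ℕ} (p≉0 : PochNonzero n) where

    v-count-nonzero : ∀ i μ → length μ ≡ n → v (count i μ) ≉ 0#
    v-count-nonzero i μ eq = v-nonzero (count i μ) (p≉0 (count i μ) (ℕ.≤-trans (count≤length i μ) (ℕ.≤-reflexive eq)))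

    vfac-nonzero : ∀ b μ → length μ ≡ n → vfac-count b μ ≉ 0#
    vfac-nonzero zero    μ eq = *-nonzero 1≉0 (v-count-nonzero 0 μ eq)
    vfac-nonzero (suc b) μ eq = *-nonzero (vfac-nonzero b μ eq) (v-count-nonzero (suc b) μ eq)

    weight-hm : ∀ z b μ → length μ ≡ n →
      prodRange (λ i → rogersSzego (count i μ) z t) b * vfac-count b μ ⁻¹ ≈ weight (g z) b μ
    weight-hm z zero μ eq = trans (*-identityˡ _) (⁻¹-cong (vfac-nonzero 0 μ eq) (*-identityˡ _))
    weight-hm z (suc b) μ eq = begin
      (prodRange _ b * rogersSzego (count (suc b) μ) z t) * (vfac-count b μ * v (count (suc b) μ)) ⁻¹
        ≈⟨ *-congˡ (⁻¹-distrib-* (vfac-nonzero b μ eq) (v-count-nonzero (suc b) μ eq)) ⟩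
      (prodRange _ b * rogersSzego (count (suc b) μ) z t) * (vfac-count b μ ⁻¹ * v (count (suc b) μ) ⁻¹)
        ≈⟨ *-interchange _ _ _ _ ⟩
      (prodRange _ b * vfac-count b μ ⁻¹) * g z (suc b) (count (suc b) μ)
        ≈⟨ *-congʳ (weight-hm z b μ eq) ⟩
      weight (g z) (suc b) μ ∎

    LHS-sumParts : ∀ m t₂ x → LHS n m t t₂ x ≈
      sumParts n m (λ μ → (prodRange (λ i → rogersSzego (count i μ) (- t₂) t) (m ℕ.∸ 1) * vfac-count m μ ⁻¹) * sym-HL μ (tabulate x))
    LHS-sumParts m t₂ x = begin
      LHS n m t t₂ x
        ≈⟨ sumL-cong summand (partitionsLE n m) ⟩
      _
        ≈⟨ sumL-partitions n m (λ μ → (prodRange (λ i → rogersSzego (count i μ) (- t₂) t) (m ℕ.∸ 1) * vfac-count m μ ⁻¹) * sym-HL μ (tabulate x)) ⟩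
      _ ∎
      where
      summand : ∀ μ → hm m μ t₂ t * HL m μ t x ≈
        (prodRange (λ i → rogersSzego (count i (toList μ)) (- t₂) t) (m ℕ.∸ 1) * vfac-count m (toList μ) ⁻¹) * sym-HL (toList μ) (tabulate x)
      summand μ = begin
        hm m μ t₂ t * HL m μ t x
          ≈⟨ *-cong (prodRange-cong (m ℕ.∸ 1) (λ i → reflexive (≡.cong (λ k → rogersSzego k (- t₂) t) (mult-toList i μ))))
               (trans (HL-sym-HL m μ x) (*-congʳ (sym (⁻¹-cong (vfac-nonzero m (toList μ) (length-toList μ)) (sym (vfac-toList m μ)))))) ⟩
        prodRange (λ i → rogersSzego (count i (toList μ)) (- t₂) t) (m ℕ.∸ 1) * (vfac-count m (toList μ) ⁻¹ * sym-HL (toList μ) (tabulate x))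
          ≈⟨ *-assoc _ _ _ ⟨
        _ ∎

    LHS-0 : ∀ t₂ x → Regular (tabulate x) → LHS n 0 t t₂ x ≈ 1#
    LHS-0 t₂ x reg = begin
      LHS n 0 t t₂ x
        ≈⟨ LHS-sumParts 0 t₂ x ⟩
      _
        ≡⟨ sumParts-zero n _ ⟩
      (1# * vfac-count 0 (replicate n 0) ⁻¹) * sym-HL (replicate n 0) (tabulate x)
        ≈⟨ *-congʳ (weight-hm (- t₂) 0 (replicate n 0) (length-replicate n)) ⟩
      v (count 0 (replicate n 0)) ⁻¹ * sym-HL (replicate n 0) (tabulate x)
        ≡⟨ ≡.cong₂ (λ k l → v k ⁻¹ * sym-HL (replicate l 0) (tabulate x))
             (≡.trans (count-replicate-self n 0) (≡.sym (length-tabulate x))) (≡.sym (length-tabulate x)) ⟩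
      level (λ k → v k ⁻¹) 0 (tabulate x)
        ≈⟨ level-v⁻¹ 0 (tabulate x) (≡.subst PochNonzero (≡.sym (length-tabulate x)) p≉0) reg ⟩
      prodOver (_^ 0) (tabulate x)
        ≈⟨ prodOver-1 (tabulate x) ⟩
      1# ∎

    LHS-suc : ∀ m t₂ x → Regular (tabulate x) → LHS n (suc m) t t₂ x ≈ bounded t₂ (suc m) (tabulate x)
    LHS-suc m t₂ x reg = begin
      LHS n (suc m) t t₂ x
        ≈⟨ LHS-sumParts (suc m) t₂ x ⟩
      sumParts n (suc m) (λ μ → (prodRange (λ i → rogersSzego (count i μ) (- t₂) t) m * vfac-count (suc m) μ ⁻¹) * sym-HL μ X)
        ≡⟨ ≡.cong (λ k → sumParts k (suc m) (λ μ → (prodRange (λ i → rogersSzego (count i μ) (- t₂) t) m * vfac-count (suc m) μ ⁻¹) * sym-HL μ X))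
             (≡.sym (length-tabulate x)) ⟩
      sumParts (length X) (suc m) (λ μ → (prodRange (λ i → rogersSzego (count i μ) (- t₂) t) m * vfac-count (suc m) μ ⁻¹) * sym-HL μ X)
        ≈⟨ sumParts-cong (length X) (suc m) (λ μ eq _ → *-congʳ (begin
             P μ * (vfac-count m μ * v (count (suc m) μ)) ⁻¹
               ≈⟨ *-congˡ (⁻¹-distrib-* (vfac-nonzero m μ (length≡ {μ} eq)) (v-count-nonzero (suc m) μ (length≡ {μ} eq))) ⟩
             P μ * (vfac-count m μ ⁻¹ * v (count (suc m) μ) ⁻¹)
               ≈⟨ *-assoc _ _ _ ⟨
             (P μ * vfac-count m μ ⁻¹) * v (count (suc m) μ) ⁻¹
               ≈⟨ *-congʳ (weight-hm (- t₂) m μ (length≡ {μ} eq)) ⟩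
             weight (g (- t₂)) m μ * v (count (suc m) μ) ⁻¹ ∎)) ⟩
      sumParts (length X) (suc m) (λ μ → (weight (g (- t₂)) m μ * v (count (suc m) μ) ⁻¹) * sym-HL μ X)
        -- The largest part m + 1 gets the weight 1/v alone, since the product h^(m+1) stops at i =
        -- m.
        ≈⟨ weightedSum-top (g (- t₂)) m (λ k → v k ⁻¹) X ⟩
      (level (λ k → v k ⁻¹) (suc m) ⊛ weightedSum (g (- t₂)) m) X
        ≈⟨ ⊛-cong X
             (λ S T p → level-v⁻¹ (suc m) S (pochNonzero-≤ (splitˡ-≤ S p) X≉0) (regular-splitˡ S p reg))
             (λ S T p → weightedSum-chain (- t₂) m T (pochNonzero-≤ (splitʳ-≤ S p) X≉0) (regular-splitʳ S p reg)) ⟩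
      (prodOver (_^ suc m) ⊛ chain (- t₂) m) X
        ≈⟨ chain-bounded t₂ m X X≉0 reg ⟩
      bounded t₂ (suc m) X ∎
      where
      X = tabulate x

      P : List ℕ → Carrier
      P μ = prodRange (λ i → rogersSzego (count i μ) (- t₂) t) m

      length≡ : ∀ {μ : List ℕ} → length μ ≡ length X → length μ ≡ n
      length≡ eq = ≡.trans eq (length-tabulate x)

      X≉0 : PochNonzero (length X)
      X≉0 = ≡.subst PochNonzero (≡.sym (length-tabulate x)) p≉0

-- The hyperoctahedral symmetrization.

module RightSide {c ℓ : Level} (R : CommutativeRing c ℓ)
  (_⁻¹ : CommutativeRing.Carrier R → CommutativeRing.Carrier R)
  (inverseʳ : Alg.FieldInv R _⁻¹) (t : CommutativeRing.Carrier R)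
  (t≉1 : ¬ CommutativeRing._≈_ R t (CommutativeRing.1# R)) where
  open CommutativeRing R hiding (zero)
  open Alg R _⁻¹
  open import Relation.Binary.Reasoning.Setoid setoid
  open import Algebra.Properties.CommutativeSemigroup *-commutativeSemigroup
    using () renaming (interchange to *-interchange)
  open IntegerSolver R using (solve; _:=_; _:+_; _:*_; _:-_; :-_; con)
  open FieldLemmas R _⁻¹ inverseʳ
  open ListSums R
  open ListProducts R
  open PartitionSums R
  open HallLittlewoodKernel R _⁻¹ inverseʳ t
  open SignedSums R _⁻¹ inverseʳ t
  open BoundedLittlewood R _⁻¹ inverseʳ t
  open HallLittlewoodSums R _⁻¹ inverseʳ t t≉1
  open DefinitionUnfolding R _⁻¹
  open LeftSide R _⁻¹ inverseʳ t t≉1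

  Σ± : List Carrier → (List Carrier → Carrier) → Carrier
  Σ± = sumSigns (λ _ → 1#) (λ _ → 1#)

  -- The equation serves to infer `h₁` and `h₂`. The halves change places because `signs` lists the
  -- inverted choice first, `sumSigns` the kept one.
  sumL-map-++ : ∀ {i j} {I : Set i} {J : Set j} (f : J → Carrier) {h₁ h₂ : I → J} {ys zs} →
    zs ≡ map h₁ ys ++ (map h₂ ys ++ []) → sumL (map f zs) ≈ sumL (map (λ y → f (h₂ y)) ys) + sumL (map (λ y → f (h₁ y)) ys)
  sumL-map-++ f {h₁} {h₂} {ys} ≡.refl = begin
    sumL (map f (map h₁ ys ++ (map h₂ ys ++ [])))
      ≡⟨ ≡.cong sumL (≡.trans (map-++ f (map h₁ ys) _) (≡.cong (map f (map h₁ ys) ++_) (≡.cong (map f) (++-identityʳ (map h₂ ys))))) ⟩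
    sumL (map f (map h₁ ys) ++ map f (map h₂ ys))
      ≈⟨ trans (sumL-++ (map f (map h₁ ys)) _) (+-comm _ _) ⟩
    sumL (map f (map h₂ ys)) + sumL (map f (map h₁ ys))
      ≡⟨ ≡.cong₂ _+_ (sumL-map-map f h₂ ys) (sumL-map-map f h₁ ys) ⟩
    sumL (map (λ y → f (h₂ y)) ys) + sumL (map (λ y → f (h₁ y)) ys) ∎

  sumL-signs : ∀ {n} (x : Fin n → Carrier) (φ : List Carrier → Carrier) →
    sumL (map (λ ε → φ (tabulate (λ i → if ε i then x i ⁻¹ else x i))) (signs n)) ≈ Σ± (tabulate x) φ
  sumL-signs {zero}  x φ = +-identityʳ _
  sumL-signs {suc n} x φ = trans
    (sumL-map-++ (λ ε → φ (tabulate (λ i → if ε i then x i ⁻¹ else x i))) {ys = signs n} ≡.refl)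
    (+-cong (trans (sumL-signs (λ i → x (Fin.suc i)) (λ Z → φ (x Fin.zero ∷ Z))) (sym (*-identityˡ _)))
      (trans (sumL-signs (λ i → x (Fin.suc i)) (λ Z → φ (x Fin.zero ⁻¹ ∷ Z))) (sym (*-identityˡ _))))

  -- With the permutations innermost, the symmetrization can be carried out for each fixed choice of
  -- signs.
  sumPerms-signs : ∀ n X (φ : List Carrier → Carrier) → length X ≡ n →
    sumPerms n X (λ Z → Σ± Z φ) ≈ Σ± X (λ Z → sumPerms n Z φ)
  sumPerms-signs zero    [] φ eq = refl
  sumPerms-signs (suc n) X  φ eq = begin
    sumPicks X (λ y Y → sumPerms n Y (λ Z → 1# * Σ± Z (λ W → φ (y ∷ W)) + 1# * Σ± Z (λ W → φ (y ⁻¹ ∷ W))))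
      ≈⟨ sumPicks-cong {X = X} (λ y Y p → trans (sumPerms-+ n Y) (+-cong
           (trans (sumPerms-*ˡ n Y 1#) (*-congˡ (sumPerms-signs n Y _ (length≡ p))))
           (trans (sumPerms-*ˡ n Y 1#) (*-congˡ (sumPerms-signs n Y _ (length≡ p)))))) ⟩
    sumPicks X (λ y Y → 1# * Σ± Y (λ Z → sumPerms n Z (λ W → φ (y ∷ W))) + 1# * Σ± Y (λ Z → sumPerms n Z (λ W → φ (y ⁻¹ ∷ W))))
      ≈⟨ sumSigns-picks X (λ y Z → sumPerms n Z (λ W → φ (y ∷ W))) ⟨
    Σ± X (λ Z → sumPerms (suc n) Z φ) ∎
    where
    length≡ : ∀ {y Y} → X ↭ y ∷ Y → length Y ≡ n
    length≡ p = ℕ.suc-injective (≡.trans (≡.sym (↭-length p)) eq)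

  -- Unlike in `sumSigns-absorb`, the factor is taken at the original entry for both signs.
  sumSigns-scale : ∀ {w₀ w₁} (h : Carrier → Carrier) X φ →
    prodOver h X * sumSigns w₀ w₁ X φ ≈ sumSigns (λ x → h x * w₀ x) (λ x → h x * w₁ x) X φ
  sumSigns-scale h []      φ = *-identityˡ _
  sumSigns-scale {w₀} {w₁} h (x ∷ X) φ = trans
    (solve 6 (λ h P w a v b → (h :* P) :* (w :* a :+ v :* b) := (h :* w) :* (P :* a) :+ (h :* v) :* (P :* b))
      refl (h x) (prodOver h X) (w₀ x) (sumSigns w₀ w₁ X (λ Z → φ (x ∷ Z))) (w₁ x) (sumSigns w₀ w₁ X (λ Z → φ (x ⁻¹ ∷ Z))))
    (+-cong (*-congˡ (sumSigns-scale h X _)) (*-congˡ (sumSigns-scale h X _)))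

  sq : Carrier → Carrier
  sq s = s * s

  sq-inverse : ∀ {s} → s ≉ 0# → sq (s ⁻¹) ≈ sq s ⁻¹
  sq-inverse s≉0 = sym (⁻¹-distrib-* s≉0 s≉0)

  -- Squaring commutes with inversion only up to `≈`, and the summand is not known to respect `≈`
  -- everywhere. So it is compared with `ψ` on pointwise equal lists.
  sumSigns-sq : ∀ {w₀ w₁ w₀′ w₁′ : Carrier → Carrier} {S} {φ ψ : List Carrier → Carrier} →
    All (λ s → s ≉ 0# × w₀ s ≈ w₀′ (sq s) × w₁ s ≈ w₁′ (sq s)) S →
    (∀ Y W → Pointwise _≈_ Y W → length Y ≡ length S → Signed (map sq S) W → φ Y ≈ ψ W) →
    sumSigns w₀ w₁ S (λ Z → φ (map sq Z)) ≈ sumSigns w₀′ w₁′ (map sq S) ψ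
  sumSigns-sq []                      h = h [] [] [] ≡.refl []
  sumSigns-sq ((s≉0 , e₀ , e₁) ∷ eqs) h = +-cong
    (*-cong e₀ (sumSigns-sq eqs λ Y W Y≈W l sg → h _ _ (refl ∷ Y≈W) (≡.cong suc l) (keep sg)))
    (*-cong e₁ (sumSigns-sq eqs λ Y W Y≈W l sg → h _ _ (sq-inverse s≉0 ∷ Y≈W) (≡.cong suc l) (flip sg)))

  generic-≈ : ∀ {x y} → x ≈ y → Generic y → Generic x
  generic-≈ x≈y (y≉0 , y≉1) = (λ x≈0 → y≉0 (trans (sym x≈y) x≈0)) , (λ x≈1 → y≉1 (trans (sym x≈y) x≈1))

  distinct-≈ : ∀ {x y x′ y′} → x ≈ x′ → y ≈ y′ → Distinct x′ y′ → Distinct x y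
  distinct-≈ x≈ y≈ (n , m) =
    (λ x≈y → n (trans (sym x≈) (trans x≈y y≈))) , (λ xy≈1 → m (trans (sym (*-cong x≈ y≈)) xy≈1))

  all-distinct-≈ : ∀ {x x′ Y W} → x ≈ x′ → Pointwise _≈_ Y W → All (Distinct x′) W → All (Distinct x) Y
  all-distinct-≈ x≈ []         []       = []
  all-distinct-≈ x≈ (e ∷ Y≈W) (d ∷ ds) = distinct-≈ x≈ e d ∷ all-distinct-≈ x≈ Y≈W ds

  regular-≈ : ∀ {Y W} → Pointwise _≈_ Y W → Regular W → Regular Y
  regular-≈ []         reg                 = reg
  regular-≈ (e ∷ Y≈W) (gx ∷ g , dx ∷ d) with regular-≈ Y≈W (g , d)
  ... | g′ , d′ = generic-≈ e gx ∷ g′ , all-distinct-≈ e Y≈W dx ∷ d′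

  w-cong : ∀ a {x y} → x ≈ y → Generic x → w a x ≈ w a y
  w-cong a x≈y (_ , x≉1) = *-cong (+-congˡ (-‿cong (*-congˡ x≈y))) (⁻¹-cong (a-b≉0 (≉-sym x≉1)) (+-congˡ (-‿cong x≈y)))

  prodOver-w-cong : ∀ a {Y W} → Pointwise _≈_ Y W → Regular Y → prodOver (w a) Y ≈ prodOver (w a) W
  prodOver-w-cong a []         reg = refl
  prodOver-w-cong a (e ∷ Y≈W) reg = *-cong (w-cong a e (All.head (proj₁ reg))) (prodOver-w-cong a Y≈W (regular-tail reg))

  Ψ-cong : ∀ {Y W} → Pointwise _≈_ Y W → Regular Y → Ψ Y ≈ Ψ W
  Ψ-cong []         reg                     = refl
  Ψ-cong (e ∷ Y≈W) reg@(gx ∷ g , dx ∷ d) = *-cong (row e gx Y≈W dx) (Ψ-cong Y≈W (g , d))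
    where
    row : ∀ {x x′ Y W} → x ≈ x′ → Generic x → Pointwise _≈_ Y W → All (Distinct x) Y → prodOver (B x) Y ≈ prodOver (B x′) W
    row e gx []          []       = refl
    row e gx (e′ ∷ Y≈W) (d ∷ ds) = *-cong
      (A-cong (proj₁ (distinct-inverse gx d)) (⁻¹-cong (proj₁ gx) e) e′) (row e gx Y≈W ds)

  w-inverse : ∀ a {x} → Generic x → w a (x ⁻¹) ≈ w̄ a x
  w-inverse a {x} gx = /-≈ (a-b≉0 (≉-sym (proj₂ (generic-inverse gx)))) (a-b≉0 (≉-sym (proj₂ gx))) (begin
    (1# - a * x ⁻¹) * (1# - x)
      ≈⟨ solve 3 (λ a x x′ → (con (+ 1) :- a :* x′) :* (con (+ 1) :- x) := con (+ 1) :- x :- a :* x′ :+ a :* (x :* x′)) refl a x (x ⁻¹) ⟩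
    1# - x - a * x ⁻¹ + a * (x * x ⁻¹)
      ≈⟨ +-cong (+-congʳ (+-congʳ (sym xx⁻¹))) (*-congˡ xx⁻¹) ⟩
    x * x ⁻¹ - x - a * x ⁻¹ + a * 1#
      ≈⟨ solve 3 (λ a x x′ → x :* x′ :- x :- a :* x′ :+ a :* con (+ 1) := (a :- x) :* (con (+ 1) :- x′)) refl a x (x ⁻¹) ⟩
    (a - x) * (1# - x ⁻¹) ∎)
    where xx⁻¹ = inverseʳ x (proj₁ gx)

  -- The type A kernel with its arguments exchanged: the picked variable now contributes a column,
  -- and `column-sum` again produces the t-factorial.
  sumPerms-reversed : ∀ n {X} → length X ≡ n → Regular X → sumPerms n X (pairProd (λ x y → A y x)) ≈ v n
  sumPerms-reversed zero    {[]} eq reg = sym v-zero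
  sumPerms-reversed (suc n) {X}  eq reg = begin
    sumPicks X (λ y Y → sumPerms n Y (λ Z → prodOver (λ x → A x y) Z * pairProd (λ x y → A y x) Z))
      ≈⟨ sumPicks-cong {X = X} (λ y Y p → begin
           sumPerms n Y (λ Z → prodOver (λ x → A x y) Z * pairProd (λ x y → A y x) Z)
             ≈⟨ sumPerms-cong n (length≡ p) (λ Z q → *-congʳ (sym (prodOver-↭ (λ x → A x y) q))) ⟩
           sumPerms n Y (λ Z → prodOver (λ x → A x y) Y * pairProd (λ x y → A y x) Z)
             ≈⟨ sumPerms-*ˡ n Y _ ⟩
           prodOver (λ x → A x y) Y * sumPerms n Y (pairProd (λ x y → A y x))
             ≈⟨ trans (*-congˡ (sumPerms-reversed n (length≡ p) (regular-tail (regular-↭ p reg)))) (*-comm _ _) ⟩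
           v n * prodOver (λ x → A x y) Y ∎) ⟩
    sumPicks X (λ y Y → v n * prodOver (λ x → A x y) Y)
      ≈⟨ sumPicks-*ˡ X (v n) ⟩
    v n * ΣA
      ≈⟨ *-cancelˡ-nonzero 1-t≉0 (begin
           (1# - t) * (v n * ΣA)                    ≈⟨ solve 3 (λ s v S → s :* (v :* S) := v :* (s :* S)) refl (1# - t) (v n) ΣA ⟩
           v n * ((1# - t) * ΣA)                    ≈⟨ *-congˡ (column-sum 1≉0 (regular-≉ reg)) ⟩
           v n * (1# - prodOver (λ _ → t) X)        ≈⟨ *-congˡ (+-congˡ (-‿cong (reflexive (≡.trans (prodOver-const t X) (≡.cong (t ^_) eq))))) ⟩
           v n * (1# - t * t ^ n)                   ≈⟨ v-suc n ⟨
           v (suc n) * (1# - t)                     ≈⟨ *-comm _ _ ⟩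
           (1# - t) * v (suc n)                     ∎) ⟩
    v (suc n) ∎
    where
    ΣA : Carrier
    ΣA = sumPicks X (λ y Y → prodOver (λ x → A x y) Y)

    length≡ : ∀ {y Y} → X ↭ y ∷ Y → length Y ≡ n
    length≡ p = ℕ.suc-injective (≡.trans (≡.sym (↭-length p)) eq)

  C : Carrier → Carrier → Carrier
  C x y = ((t * x - y) * (1# - t * x * y)) * ((x - y) * (1# - x * y)) ⁻¹

  -- Separates the symmetric factor `B` from the type A kernel. The latter appears as `A y x`
  -- because the numerator in the type B definition is t x - y.
  C-AB : ∀ {x y} → Generic x → Distinct x y → C x y ≈ A y x * B x y
  C-AB {x} {y} gx d = begin
    ((t * x - y) * (1# - t * x * y)) * ((x - y) * (1# - x * y)) ⁻¹
      ≈⟨ *-congˡ (⁻¹-distrib-* x-y≉0 1-xy≉0) ⟩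
    ((t * x - y) * (1# - t * x * y)) * ((x - y) ⁻¹ * (1# - x * y) ⁻¹)
      ≈⟨ *-interchange _ _ _ _ ⟩
    ((t * x - y) * (x - y) ⁻¹) * ((1# - t * x * y) * (1# - x * y) ⁻¹)
      ≈⟨ *-cong
           (/-≈ x-y≉0 (a-b≉0 (≉-sym (proj₁ d))) (solve 3 (λ t x y → (t :* x :- y) :* (y :- x) := (y :- t :* x) :* (x :- y)) refl t x y))
           (/-≈ 1-xy≉0 (a-b≉0 (proj₁ (distinct-inverse gx d))) (begin
             (1# - t * x * y) * (x ⁻¹ - y)
               ≈⟨ solve 4 (λ t x y x′ → (con (+ 1) :- t :* x :* y) :* (x′ :- y) := x′ :- y :+ t :* x :* y :* y :- t :* y :* (x :* x′)) refl t x y (x ⁻¹) ⟩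
             x ⁻¹ - y + t * x * y * y - t * y * (x * x ⁻¹)
               ≈⟨ +-cong (+-congʳ (+-congˡ (-‿cong (trans (sym (*-identityʳ y)) (*-congˡ (sym xx⁻¹)))))) (-‿cong (trans (*-congˡ xx⁻¹) (*-identityʳ _))) ⟩
             x ⁻¹ - y * (x * x ⁻¹) + t * x * y * y - t * y
               ≈⟨ solve 4 (λ t x y x′ → x′ :- y :* (x :* x′) :+ t :* x :* y :* y :- t :* y := (x′ :- t :* y) :* (con (+ 1) :- x :* y)) refl t x y (x ⁻¹) ⟩
             (x ⁻¹ - t * y) * (1# - x * y) ∎)) ⟩
    A y x * B x y ∎
    where
    x-y≉0  = a-b≉0 (proj₁ d)
    1-xy≉0 = a-b≉0 (≉-sym (proj₂ d))
    xx⁻¹   = inverseʳ x (proj₁ gx)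

  pairProd-C : ∀ {X} → Regular X → pairProd C X ≈ pairProd (λ x y → A y x) X * Ψ X
  pairProd-C {X} reg = trans (pairProd-cong (go reg)) (pairProd-* (λ x y → A y x) B X)
    where
    go : ∀ {X} → Regular X → AllPairs (λ x y → C x y ≈ A y x * B x y) X
    go ([] , [])              = []
    go (gx ∷ g , dx ∷ d) = All.map (C-AB gx) dx ∷ go (g , d)

  -- Everything except the reversed type A kernel is symmetric in the variables and leaves the sum.
  sumPerms-C : ∀ a n {Y} → length Y ≡ n → Regular Y →
    sumPerms n Y (λ Z → prodOver (w a) Z * pairProd C Z) ≈ (prodOver (w a) Y * Ψ Y) * v n
  sumPerms-C a n {Y} eq reg = begin
    sumPerms n Y (λ Z → prodOver (w a) Z * pairProd C Z)
      ≈⟨ sumPerms-cong n eq (λ Z p → begin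
           prodOver (w a) Z * pairProd C Z
             ≈⟨ *-cong (sym (prodOver-↭ (w a) p)) (pairProd-C (regular-↭ p reg)) ⟩
           prodOver (w a) Y * (pairProd (λ x y → A y x) Z * Ψ Z)
             ≈⟨ *-congˡ (trans (*-comm _ _) (*-congʳ (sym (pairProd-↭ B (regular-B-sym reg) p)))) ⟩
           prodOver (w a) Y * (Ψ Y * pairProd (λ x y → A y x) Z)
             ≈⟨ *-assoc _ _ _ ⟨
           (prodOver (w a) Y * Ψ Y) * pairProd (λ x y → A y x) Z ∎) ⟩
    sumPerms n Y (λ Z → (prodOver (w a) Y * Ψ Y) * pairProd (λ x y → A y x) Z)
      ≈⟨ trans (sumPerms-*ˡ n Y _) (*-congˡ (sumPerms-reversed n eq reg)) ⟩
    (prodOver (w a) Y * Ψ Y) * v n ∎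

  ^-inverse : ∀ {x} m → x ≉ 0# → x ^ m * (x ⁻¹) ^ m ≈ 1#
  ^-inverse zero    x≉0 = *-identityˡ 1#
  ^-inverse (suc m) x≉0 = trans (*-interchange _ _ _ _) (trans (*-cong (inverseʳ _ x≉0) (^-inverse m x≉0)) (*-identityˡ 1#))

  ^-cong : ∀ {x y} m → x ≈ y → x ^ m ≈ y ^ m
  ^-cong zero    x≈y = refl
  ^-cong (suc m) x≈y = *-cong x≈y (^-cong m x≈y)

  ^-distrib-* : ∀ x y m → (x * y) ^ m ≈ x ^ m * y ^ m
  ^-distrib-* x y zero    = sym (*-identityˡ 1#)
  ^-distrib-* x y (suc m) = trans (*-congˡ (^-distrib-* x y m)) (*-interchange _ _ _ _)

  sumSigns-weights : ∀ {w₀ w₁ w₀′ w₁′ X φ} → All (λ x → w₀ x ≈ w₀′ x × w₁ x ≈ w₁′ x) X →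
    sumSigns w₀ w₁ X φ ≈ sumSigns w₀′ w₁′ X φ
  sumSigns-weights []                = refl
  sumSigns-weights ((e₀ , e₁) ∷ eqs) = +-cong (*-cong e₀ (sumSigns-weights eqs)) (*-cong e₁ (sumSigns-weights eqs))

  signedSum-bounded : ∀ a m {X} → Regular X → signedSum (w a) (λ x → x ^ m * w̄ a x) X ≈ bounded a m X
  signedSum-bounded a m {X} reg = trans (signedSum-splits (w a) _ reg)
    (⊛-cong X (λ S _ _ → trans (*-congʳ (prodOver-* (_^ m) (w̄ a) S)) (*-assoc _ _ _)) (λ _ _ _ → refl))

  vfac-rectangle : ∀ n m → vfac m (Vec.replicate n m) t ≈ v n
  vfac-rectangle n m = begin
    vfac m (Vec.replicate n m) t
      ≈⟨ vfac-toList m (Vec.replicate n m) ⟩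
    vfac-count m (toList (Vec.replicate n m))
      ≡⟨ ≡.cong (vfac-count m) (toList-replicate n m) ⟩
    prodRange f m * v (count m (replicate n m))
      ≈⟨ *-cong (lower m ℕ.≤-refl) (reflexive (≡.cong v (count-replicate-self n m))) ⟩
    1# * v n
      ≈⟨ *-identityˡ _ ⟩
    v n ∎
    where
    f : ℕ → Carrier
    f i = v (count (i ℕ.∸ 1) (replicate n m))

    lower : ∀ b → b ℕ.≤ m → prodRange f b ≈ 1#
    lower zero    _   = refl
    lower (suc b) b<m = trans (*-cong (lower b (ℕ.<⇒≤ b<m))
      (trans (reflexive (≡.cong v (count-absent (All.replicate⁺ n (λ m≡b → ℕ.<⇒≢ b<m (≡.sym m≡b)))))) v-zero)) (*-identityˡ 1#)

  module _ {n : ℕ} (m : ℕ) (a : Carrier) (s : Fin n → Carrier) (s≉0 : ∀ i → s i ≉ 0#)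
    (reg : Regular (tabulate (λ i → sq (s i)))) where

    X S : List Carrier
    X = tabulate (λ i → sq (s i))
    S = tabulate s

    S-X : map sq S ≡ X
    S-X = map-tabulate s sq

    summand : List Carrier → Carrier
    summand Z = prodOver (λ r → (r ⁻¹) ^ m) Z * (prodOver (w a) (map sq Z) * pairProd C (map sq Z))

    G : List Carrier → Carrier
    G Y = sumPerms n Y (λ Z → prodOver (w a) Z * pairProd C Z)

    sumPerms-summand : ∀ Z → length Z ≡ n → sumPerms n Z summand ≈ prodOver (λ r → (r ⁻¹) ^ m) Z * G (map sq Z)
    sumPerms-summand Z eq = begin
      sumPerms n Z summand
        ≈⟨ sumPerms-cong n eq (λ W p → *-congʳ (sym (prodOver-↭ (λ r → (r ⁻¹) ^ m) p))) ⟩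
      sumPerms n Z (λ W → prodOver (λ r → (r ⁻¹) ^ m) Z * (prodOver (w a) (map sq W) * pairProd C (map sq W)))
        ≈⟨ sumPerms-*ˡ n Z _ ⟩
      prodOver (λ r → (r ⁻¹) ^ m) Z * sumPerms n Z (λ W → prodOver (w a) (map sq W) * pairProd C (map sq W))
        ≈⟨ *-congˡ (sumPerms-map n sq Z _) ⟨
      prodOver (λ r → (r ⁻¹) ^ m) Z * G (map sq Z) ∎

    signed-length : ∀ {X Z} → Signed X Z → length Z ≡ length X
    signed-length []       = ≡.refl
    signed-length (keep s) = ≡.cong suc (signed-length s)
    signed-length (flip s) = ≡.cong suc (signed-length s)

    -- Against the prefactor s^m, a kept variable contributes s^m s^(-m) = 1 and an inverted one s^m
    -- s^m = x^m. The half-integral powers disappear, leaving the sign weights of `bounded a m`.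
    hyperoctahedral-sum : prodOver (_^ m) S * sumPerms n S (λ Z → Σ± Z summand) ≈ bounded a m X * v n
    hyperoctahedral-sum = begin
      prodOver (_^ m) S * sumPerms n S (λ Z → Σ± Z summand)
        ≈⟨ *-congˡ (sumPerms-signs n S summand (length-tabulate s)) ⟩
      prodOver (_^ m) S * Σ± S (λ Z → sumPerms n Z summand)
        ≈⟨ *-congˡ (sumSigns-cong {X = S} (λ Z sg → sumPerms-summand Z (≡.trans (signed-length sg) (length-tabulate s)))) ⟩
      prodOver (_^ m) S * Σ± S (λ Z → prodOver (λ r → (r ⁻¹) ^ m) Z * G (map sq Z))
        ≈⟨ *-congˡ (sumSigns-absorb (λ r → (r ⁻¹) ^ m) S) ⟩
      prodOver (_^ m) S * sumSigns (λ r → 1# * (r ⁻¹) ^ m) (λ r → 1# * ((r ⁻¹) ⁻¹) ^ m) S (λ Z → G (map sq Z))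
        ≈⟨ sumSigns-scale (_^ m) S _ ⟩
      sumSigns (λ r → r ^ m * (1# * (r ⁻¹) ^ m)) (λ r → r ^ m * (1# * ((r ⁻¹) ⁻¹) ^ m)) S (λ Z → G (map sq Z))
        ≈⟨ sumSigns-sq {w₀′ = λ _ → 1#} {w₁′ = _^ m} {φ = G} {ψ = ψ} (All.tabulate⁺ {f = s} weights) evaluate ⟩
      sumSigns (λ _ → 1#) (_^ m) (map sq S) ψ
        ≡⟨ ≡.cong (λ X → sumSigns (λ _ → 1#) (_^ m) X ψ) S-X ⟩
      sumSigns (λ _ → 1#) (_^ m) X ψ
        ≈⟨ sumSigns-*ˡ X (v n) ⟩
      v n * sumSigns (λ _ → 1#) (_^ m) X (λ W → prodOver (w a) W * Ψ W)
        ≈⟨ trans (*-comm _ _) (*-congʳ (sumSigns-absorb (w a) X)) ⟩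
      sumSigns (λ x → 1# * w a x) (λ x → x ^ m * w a (x ⁻¹)) X Ψ * v n
        ≈⟨ *-congʳ (sumSigns-weights (All.map (λ gx → *-identityˡ _ , *-congˡ (w-inverse a gx)) (proj₁ reg))) ⟩
      signedSum (w a) (λ x → x ^ m * w̄ a x) X * v n
        ≈⟨ *-congʳ (signedSum-bounded a m reg) ⟩
      bounded a m X * v n ∎
      where
      ψ : List Carrier → Carrier
      ψ W = v n * (prodOver (w a) W * Ψ W)

      weights : ∀ i → s i ≉ 0# × (s i ^ m * (1# * (s i ⁻¹) ^ m) ≈ 1#) × (s i ^ m * (1# * ((s i ⁻¹) ⁻¹) ^ m) ≈ sq (s i) ^ m)
      weights i = s≉0 i
        , trans (*-congˡ (*-identityˡ _)) (^-inverse m (s≉0 i))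
        , trans (*-congˡ (trans (*-identityˡ _) (^-cong m (⁻¹-involutive (s≉0 i))))) (sym (^-distrib-* (s i) (s i) m))

      evaluate : ∀ Y W → Pointwise _≈_ Y W → length Y ≡ length S → Signed (map sq S) W → G Y ≈ ψ W
      evaluate Y W Y≈W len-Y sg = begin
        G Y                                   ≈⟨ sumPerms-C a n (≡.trans len-Y (length-tabulate s)) Y-reg ⟩
        (prodOver (w a) Y * Ψ Y) * v n        ≈⟨ *-congʳ (*-cong (prodOver-w-cong a Y≈W Y-reg) (Ψ-cong Y≈W Y-reg)) ⟩
        (prodOver (w a) W * Ψ W) * v n        ≈⟨ *-comm _ _ ⟩
        ψ W                                   ∎
        where
        Y-reg = regular-≈ Y≈W (regular-signed (≡.subst (λ X → Signed X W) S-X sg) reg)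

    sumL-hyperoctahedral : ∀ (F : (Fin n → Carrier) → Carrier) → (∀ r → F r ≈ summand (tabulate r)) →
      sumL (concatMap (λ σ → map (λ ε → F (act σ ε s)) (signs n)) (perms n)) ≈ sumPerms n S (λ Z → Σ± Z summand)
    sumL-hyperoctahedral F F≈ = begin
      sumL terms
        ≡⟨ ≡.cong sumL (map-id terms) ⟨
      sumL (map (λ z → z) terms)
        ≈⟨ sumL-concatMap-map (λ z → z) {λ σ ε → F (act σ ε s)} {perms n} {signs n} ≡.refl ⟩
      sumL (map (λ σ → sumL (map (λ ε → F (act σ ε s)) (signs n))) (perms n))
        ≈⟨ sumL-cong (λ σ → trans (sumL-cong (λ ε → F≈ (act σ ε s)) (signs n)) (sumL-signs (λ i → s (σ i)) summand)) (perms n) ⟩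
      sumL (map (λ σ → Σ± (tabulate (λ i → s (σ i))) summand) (perms n))
        ≈⟨ sumL-perms s (λ Z → Σ± Z summand) ⟩
      sumPerms n S (λ Z → Σ± Z summand) ∎
      where
      terms : List Carrier
      terms = concatMap (λ σ → map (λ ε → F (act σ ε s)) (signs n)) (perms n)

    summand-tabulate : ∀ (r : Fin n → Carrier) →
      mono (λ i → r i ⁻¹) (Vec.replicate n m)
        * prodFin (λ i → w a (sq (r i)))
        * prodPairs (λ i j → C (sq (r i)) (sq (r j)))
      ≈ summand (tabulate r)
    summand-tabulate r = begin
      mono (λ i → r i ⁻¹) (Vec.replicate n m) * prodFin (λ i → w a (sq (r i))) * prodPairs (λ i j → C (sq (r i)) (sq (r j)))
        ≈⟨ *-cong (*-cong
             (trans (prodFin-cong (λ i → reflexive (≡.cong (r i ⁻¹ ^_) (lookup-replicate i m)))) (prodFin-tabulate (λ r → (r ⁻¹) ^ m) r))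
             (trans (prodFin-tabulate (λ r → w a (sq r)) r) (sym (prodOver-map (w a) sq (tabulate r)))))
             (trans (prodPairs-tabulate (λ r r′ → C (sq r) (sq r′)) r) (sym (pairProd-map C sq (tabulate r)))) ⟩
      prodOver (λ r → (r ⁻¹) ^ m) (tabulate r) * prodOver (w a) (map sq (tabulate r)) * pairProd C (map sq (tabulate r))
        ≈⟨ *-assoc _ _ _ ⟩
      summand (tabulate r) ∎
      where
      pairProd-map : ∀ (f : Carrier → Carrier → Carrier) (g : Carrier → Carrier) Y → pairProd f (map g Y) ≈ pairProd (λ x y → f (g x) (g y)) Y
      pairProd-map f g []      = refl
      pairProd-map f g (y ∷ Y) = *-cong (prodOver-map (f (g y)) g Y) (pairProd-map f g Y)

    denominator : Carrier
    denominator = poch (- a) t (n ℕ.∸ len (Vec.replicate n m))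

    RHS-bounded : denominator ≉ 0# → PochNonzero n →
      RHS n m t a s ≈ (denominator * v n) ⁻¹ * (bounded a m X * v n)
    RHS-bounded d≉0 p≉0 = begin
      RHS n m t a s
        ≈⟨ *-cong (prodFin-tabulate (_^ m) s) (*-cong
             (sym (⁻¹-cong (*-nonzero d≉0 (v-nonzero n (p≉0 n ℕ.≤-refl))) (*-congˡ (sym (vfac-rectangle n m)))))
             (sumL-hyperoctahedral _ summand-tabulate)) ⟩
      prodOver (_^ m) S * ((denominator * v n) ⁻¹ * sumPerms n S (λ Z → Σ± Z summand))
        ≈⟨ solve 3 (λ p d Σ → p :* (d :* Σ) := d :* (p :* Σ)) refl _ _ _ ⟩
      (denominator * v n) ⁻¹ * (prodOver (_^ m) S * sumPerms n S (λ Z → Σ± Z summand))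
        ≈⟨ *-congˡ hyperoctahedral-sum ⟩
      (denominator * v n) ⁻¹ * (bounded a m X * v n) ∎


-- Assembly, separating m = 0 from m > 0.

len-replicate-suc : ∀ n m → len (Vec.replicate n (suc m)) ≡ n
len-replicate-suc zero    m = ≡.refl
len-replicate-suc (suc n) m = ≡.cong suc (len-replicate-suc n m)

len-replicate-zero : ∀ n → len (Vec.replicate n 0) ≡ 0
len-replicate-zero zero    = ≡.refl
len-replicate-zero (suc n) = len-replicate-zero n

theorem4p8 : ∀ {c ℓ : Level} (R : CommutativeRing c ℓ)
    (_⁻¹ : CommutativeRing.Carrier R → CommutativeRing.Carrier R) →
    let open CommutativeRing R
        open Alg R _⁻¹
    in FieldInv →
    (n m : ℕ) (t t₂ : Carrier) (s : Fin n → Carrier) →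
    let x : Fin n → Carrier
        x i = s i * s i
    in (∀ i → ¬ (s i ≈ 0#)) →
       (∀ i → ¬ (x i ≈ 1#)) →
       (∀ i j → i ≢ j → ¬ (x i ≈ x j)) →
       (∀ i j → i ≢ j → ¬ (x i * x j ≈ 1#)) →
       ¬ (t ≈ 1#) →
       (∀ k → k ≤ n → ¬ (poch t t k ≈ 0#)) →
       (∀ k → k ≤ n → ¬ (poch (- t₂) t k ≈ 0#)) →
       LHS n m t t₂ x ≈ RHS n m t t₂ s
theorem4p8 R _⁻¹ inverseʳ n m t t₂ s s≉0 x≉1 x≉x xx≉1 t≉1 p≉0 q≉0 = main m
  where
  open CommutativeRing R hiding (zero)
  open Alg R _⁻¹
  open import Relation.Binary.Reasoning.Setoid setoid
  open FieldLemmas R _⁻¹ inverseʳ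
  open SignedSums R _⁻¹ inverseʳ t
  open BoundedLittlewood R _⁻¹ inverseʳ t
  open HallLittlewoodSums R _⁻¹ inverseʳ t t≉1
  open LeftSide R _⁻¹ inverseʳ t t≉1
  open RightSide R _⁻¹ inverseʳ t t≉1

  x : Fin n → Carrier
  x i = s i * s i

  reg : Regular (tabulate x)
  reg = All.tabulate⁺ (λ i → *-nonzero (s≉0 i) (s≉0 i) , x≉1 i)
      , AllPairs.tabulate⁺ (λ i≢j → x≉x _ _ i≢j , xx≉1 _ _ i≢j)

  v≉0 : v n ≉ 0#
  v≉0 = v-nonzero n (p≉0 n ℕ.≤-refl)

  main : ∀ m → LHS n m t t₂ x ≈ RHS n m t t₂ s
  -- The rectangle has length 0, so the normalisation contains the full (-t₂; t)_n, and this cancels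
  -- the value of `bounded t₂ 0`.
  main zero = sym (begin
    RHS n 0 t t₂ s
      ≈⟨ RHS-bounded 0 t₂ s s≉0 reg (q≉0 _ (ℕ.m∸n≤m n (len (Vec.replicate n 0)))) p≉0 ⟩
    (poch (- t₂) t (n ℕ.∸ len (Vec.replicate n 0)) * v n) ⁻¹ * (bounded t₂ 0 (tabulate x) * v n)
      ≡⟨ ≡.cong (λ k → (poch (- t₂) t (n ℕ.∸ k) * v n) ⁻¹ * (bounded t₂ 0 (tabulate x) * v n)) (len-replicate-zero n) ⟩
    (q * v n) ⁻¹ * (bounded t₂ 0 (tabulate x) * v n)
      ≈⟨ *-congˡ (*-congʳ (trans (bounded-0 t₂ reg) (reflexive (≡.cong (poch (- t₂) t) (length-tabulate x))))) ⟩
    (q * v n) ⁻¹ * (q * v n)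
      ≈⟨ trans (*-comm _ _) (inverseʳ _ (*-nonzero (q≉0 n ℕ.≤-refl) v≉0)) ⟩
    1#
      ≈⟨ LHS-0 p≉0 t₂ x reg ⟨
    LHS n 0 t t₂ x ∎)
    where
    q : Carrier
    q = poch (- t₂) t n
  -- All n parts are positive, so the Pochhammer symbol in the normalisation is the empty product.
  main (suc m) = sym (begin
    RHS n (suc m) t t₂ s
      ≈⟨ RHS-bounded (suc m) t₂ s s≉0 reg (q≉0 _ (ℕ.m∸n≤m n (len (Vec.replicate n (suc m))))) p≉0 ⟩
    (poch (- t₂) t (n ℕ.∸ len (Vec.replicate n (suc m))) * v n) ⁻¹ * (bounded t₂ (suc m) (tabulate x) * v n)
      ≡⟨ ≡.cong (λ k → (poch (- t₂) t k * v n) ⁻¹ * (bounded t₂ (suc m) (tabulate x) * v n))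
           (≡.trans (≡.cong (n ℕ.∸_) (len-replicate-suc n m)) (ℕ.n∸n≡0 n)) ⟩
    (1# * v n) ⁻¹ * (bounded t₂ (suc m) (tabulate x) * v n)
      ≈⟨ *-congʳ (⁻¹-cong (*-nonzero 1≉0 v≉0) (*-identityˡ _)) ⟩
    v n ⁻¹ * (bounded t₂ (suc m) (tabulate x) * v n)
      ≈⟨ trans (*-comm _ _) (trans (*-assoc _ _ _) (trans (*-congˡ (inverseʳ _ v≉0)) (*-identityʳ _))) ⟩
    bounded t₂ (suc m) (tabulate x)
      ≈⟨ LHS-suc p≉0 m t₂ x reg ⟨
    LHS n (suc m) t t₂ x ∎)
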